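{- For every $n$ there exist an undirected unweighted $n$-node graph $G$ and a pair of nodes $(s,t)$ such that every $2$-FT distance preserver of the single pair $(s,t)$ in $G$ has $\Omega(n^{11/10-o(1)})$ edges.
   Context: A subgraph $H\subseteq G=(V,E)$ is a $2$-FT distance preserver of the pair $(s,t)$ if $\mathrm{dist}_{H\setminus F}(s,t)=\mathrm{dist}_{G\setminus F}(s,t)$ for every edge set $F\subseteq E$ with $|F|\leq 2$. -}

module Defs where

open import Data.Nat using (ℕ; zero; suc; _≤_; _<ᵇ_)
open import Data.Fin using (Fin; toℕ)
open import Data.Bool using (Bool; true; false; _∧_; if_then_else_)
open import Data.List using (List; length; map; allFin)
open import Data.Nat.ListAction using (sum)
open import Data.List.Relation.Unary.All using (All)
open import Data.List.Membership.Propositional using (_∈_)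
open import Data.Product using (Σ; _×_; _,_; proj₁; proj₂; ∃)
open import Relation.Nullary using (¬_)
open import Relation.Binary.PropositionalEquality using (_≡_)
open import Function.Bundles using (_⇔_)

record Graph (n : ℕ) : Set where
  field
    adj    : Fin n → Fin n → Bool
    sym    : ∀ i j → adj i j ≡ adj j i
    irrefl : ∀ i → adj i i ≡ false
open Graph public

edgeCount : ∀ {n} → Graph n → ℕ
edgeCount {n} G =
  sum (map (λ i → sum (map (λ j → if (toℕ i <ᵇ toℕ j) ∧ adj G i j then 1 else 0)
                               (allFin n)))
           (allFin n))

_⊆G_ : ∀ {n} → Graph n → Graph n → Set
H ⊆G G = ∀ i j → adj H i j ≡ true → adj G i j ≡ true

-- An edge set F, listed as pairs (u , v) each representing the
-- undirected edge {u,v}.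
EdgeList : ℕ → Set
EdgeList n = List (Fin n × Fin n)

AdjMinus : ∀ {n} → Graph n → EdgeList n → Fin n → Fin n → Set
AdjMinus G F u v = (adj G u v ≡ true) × ¬ ((u , v) ∈ F) × ¬ ((v , u) ∈ F)

data Walk {n : ℕ} (R : Fin n → Fin n → Set) : Fin n → Fin n → ℕ → Set where
  nil  : ∀ {u} → Walk R u u 0
  cons : ∀ {u v w k} → R u v → Walk R v w k → Walk R u w (suc k)

DistLe : ∀ {n} → Graph n → EdgeList n → Fin n → Fin n → ℕ → Set
DistLe G F s t d = ∃ λ k → k ≤ d × Walk (AdjMinus G F) s t k

-- dist_{H\F}(s,t) = dist_{G\F}(s,t) (as extended naturals), expressed as:
-- for every d, dist_{H\F}(s,t) ≤ d iff dist_{G\F}(s,t) ≤ d.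
SameDist : ∀ {n} → Graph n → Graph n → EdgeList n → Fin n → Fin n → Set
SameDist H G F s t = ∀ d → DistLe H F s t d ⇔ DistLe G F s t d

FT2Preserver : ∀ {n} → Graph n → Graph n → Fin n → Fin n → Set
FT2Preserver {n} G H s t =
  H ⊆G G ×
  (∀ (F : EdgeList n) → length F ≤ 2 →
     All (λ e → adj G (proj₁ e) (proj₂ e) ≡ true) F →
     SameDist H G F s t)

{-# OPTIONS --safe #-}

-- Join the points (a , b , y) of a box by the steps (v , w , 65r² − v² − w²) with 0 ≤ v, w < r.
-- The step vectors lie on a paraboloid: for each direction (u₁ , u₂) the functional
-- Φ = y + 2u₁a + 2u₂b grows by N = 65r² + u₁² + u₂² along the step (u₁ , u₂), and by
-- (v − u₁)² + (w − u₂)² less along the step (v , w). So k steps raise Φ by kN only along a straight line.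
-- A hub on the side of s fixes u₁, b and y + 2u₁a and is attached to all points of the box with these
-- values; a hub on the side of t fixes u₂, a and y + 2u₂b, so that a pair of hubs fixes Φ at both
-- ends and singles out one line. The hubs of a side hang on a spine starting at s (at t); cutting the
-- spine right behind a hub makes it the best exit, so two faults select a pair of hubs and force all
-- edges of its line.
-- In a box with sides of order r⁵, r⁵ and r⁶ there are of order r⁸ hubs, and the whole graph has of
-- order r¹⁶ vertices, while each of the order r¹⁸ steps in the middle of the box lies on a forced line.
-- This gives Ω(n^(9/8)) edges, which is why one threshold serves all k.
-- A line is forced because of a potential that rises by at most N along each surviving edge and by
-- N times the distance from s to t: a shortest walk rises by exactly N at every step.

module Submission where

open import Defs hiding (sym; irrefl)
open import Data.Bool using (Bool; true; false; _∧_; if_then_else_)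
open import Data.Empty using (⊥; ⊥-elim)
open import Data.Fin as Fin using (Fin; toℕ; combine; fromℕ<; remQuot)
import Data.Fin.Properties as Fin
open import Data.List using (List; []; _∷_; _++_; length; map; tabulate; allFin)
open import Data.List.Membership.Propositional using (_∈_)
open import Data.List.Relation.Unary.All as All using (All)
open import Data.List.Relation.Unary.Any using (here; there)
open import Data.Product using (Σ; _×_; _,_; proj₁; proj₂; ∃; uncurry)
open import Data.Sum as Sum using (_⊎_; inj₁; inj₂)
open import Data.Unit using (⊤; tt)
open import Relation.Nullary using (¬_; Dec; yes; no; contradiction; does)
open import Relation.Binary.PropositionalEquality

-- The danger is a walk that enters the box from a foreign hub, or leaves the box and returns
-- through one. Write z for r⁴. Over all points attached to the hubs of a side, Φ varies by at most
-- 32r²z + 66r², whereas an arm of z + 2 edges is worth at least 65r²(z + 2). A hub before the fault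
-- is farther from the terminal by 3 edges per index, and hubs are ordered so that this outweighs
-- whatever such a hub gains in Φ. The order works only for selected hubs whose second coordinate
-- lies in the upper half of its range. Therefore the middle of the box sits at small a and large b,
-- a shape that survives reversing a line and exchanging a with b. The value z = r⁴ balances the
-- graph: a box with sides of order rz, rz and r²z has r⁴z³ points; a side has r⁴z hubs, hence r⁸z²
-- vertices on spine and columns, and r⁴z³ on arms, since each hub has of order z arms of length of
-- order z.

module Construction where

  import Data.Bool.Properties as Bool
  open import Data.Integer hiding (suc)
  open import Data.Integer.Properties
  open import Algebra.Properties.AbelianGroup +-0-abelianGroup using (∙-cancelˡ; ∙-cancelʳ)
  open import Data.Integer.Tactic.RingSolver
  open import Data.Nat as ℕ using (ℕ; zero; suc; z≤n; s≤s)
  import Data.Nat.DivMod as ℕ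
  import Data.Nat.Properties as ℕ
  import Data.Nat.Tactic.RingSolver as ℕ-Solver
  open import Data.Product.Function.NonDependent.Propositional using (_×-↔_)
  open import Data.Product.Properties using (≡-dec)
  open import Data.Sum.Function.Propositional using (_⊎-↔_)
  open import Function using (id)
  open import Function.Bundles using (_↔_; Inverse; Equivalence)
  open import Function.Construct.Composition using (_↔-∘_)
  open import Function.Construct.Identity using (↔-id)
  open import Relation.Binary.Definitions using (tri<; tri≈; tri>)
  open import Relation.Nullary.Decidable using (_×-dec_; _⊎-dec_; dec-true; dec-false)

  -- Polynomial inequalities over the integers.

  infixl 6 _⊕_
  infixl 7 _⊗_

  _⊕_ : ∀ {x y} → 0ℤ ≤ x → 0ℤ ≤ y → 0ℤ ≤ x + y
  _⊕_ = +-mono-≤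

  _⊗_ : ∀ {x y} → 0ℤ ≤ x → 0ℤ ≤ y → 0ℤ ≤ x * y
  _⊗_ {+ x} {+ y} _ _ = subst (0ℤ ≤_) (pos-* x y) (+≤+ z≤n)

  0≤sq : ∀ x → 0ℤ ≤ x * x
  0≤sq (+ x) = subst (0ℤ ≤_) (pos-* x x) (+≤+ z≤n)
  0≤sq -[1+ x ] = +≤+ z≤n

  0≤+ : ∀ {n} → 0ℤ ≤ + n
  0≤+ = +≤+ z≤n

  -- The form of all polynomial estimates here: the slack is given as a sum of products of
  -- nonnegative terms, built with `_⊕_` and `_⊗_`, and the ring solver confirms that it is the
  -- difference of the two sides.
  ≤-slack : ∀ {x y d} → 0ℤ ≤ d → y ≡ x + d → x ≤ y
  ≤-slack {x} p e = subst₂ _≤_ (+-identityʳ x) (sym e) (+-monoʳ-≤ x p)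

  sq≡0 : ∀ x → x * x ≡ 0ℤ → x ≡ 0ℤ
  sq≡0 x e with i*j≡0⇒i≡0∨j≡0 x e
  ... | inj₁ p = p
  ... | inj₂ p = p

  sum≡0 : ∀ {x y} → 0ℤ ≤ x → 0ℤ ≤ y → x + y ≡ 0ℤ → x ≡ 0ℤ × y ≡ 0ℤ
  sum≡0 {+ zero} {+ zero} _ _ _ = refl , refl

  -- Either product with a direction is at most 2R · 8RZ, so the left side stays below 32R²Z + 66R²,
  -- while N (Z + 2) is at least 65R²Z + 130R². Arms of length Z + 2 rely on this.
  shift-≤ : ∀ N R Z u u' o b b' c θ θ' → 0ℤ ≤ N - + 65 * (R * R) → 0ℤ ≤ R → 0ℤ ≤ Z →
    0ℤ ≤ R - u → 0ℤ ≤ u' → 0ℤ ≤ o → 0ℤ ≤ R - o → 0ℤ ≤ b → 0ℤ ≤ + 8 * (R * Z) - b' →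
    0ℤ ≤ c → 0ℤ ≤ + 8 * Z - c → 0ℤ ≤ θ → 0ℤ ≤ + 66 * (R * R) - θ' →
    (θ' - θ) + + 2 * o * (b' - b) + + 2 * (u - u') * (c * R) ≤ N * (Z + + 2)
  shift-≤ N R Z u u' o b b' c θ θ' N0 R0 Z0 Ru u'0 o0 Ro b0 Xb' c0 Bc θ0 Wθ' =
    ≤-slack (Wθ' ⊕ θ0 ⊕ 0≤+ {2} ⊗ o0 ⊗ (Xb' ⊕ b0) ⊕ 0≤+ {2} ⊗ (Ru ⊕ u'0) ⊗ (c0 ⊗ R0) ⊕ 0≤+ {2} ⊗ (R0 ⊗ R0) ⊗ Bc
         ⊕ 0≤+ {16} ⊗ Ro ⊗ (R0 ⊗ Z0) ⊕ 0≤+ {33} ⊗ (R0 ⊗ R0 ⊗ Z0) ⊕ 0≤+ {64} ⊗ (R0 ⊗ R0) ⊕ N0 ⊗ (Z0 ⊕ 0≤+ {2}))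
      (solve (N ∷ R ∷ Z ∷ u ∷ u' ∷ o ∷ b ∷ b' ∷ c ∷ θ ∷ θ' ∷ []))

  order-≤-same : ∀ N R u o b b' c θ θ' e → 0ℤ ≤ N → 0ℤ ≤ N - + 65 * (R * R) → 0ℤ ≤ R → 0ℤ ≤ o → 0ℤ ≤ b - b' →
    0ℤ ≤ θ → 0ℤ ≤ + 66 * (R * R) - θ' → 0ℤ ≤ e - + 1 →
    N + ((θ' - θ) + + 2 * o * (b' - b) + + 2 * (u - u) * (c * R)) ≤ + 3 * N * e
  order-≤-same N R u o b b' c θ θ' e N0 N65 R0 o0 bb θ0 Wθ' e1 =
    ≤-slack (0≤+ {3} ⊗ N0 ⊗ e1 ⊕ 0≤+ {2} ⊗ N65 ⊕ 0≤+ {64} ⊗ (R0 ⊗ R0) ⊕ Wθ' ⊕ θ0 ⊕ 0≤+ {2} ⊗ o0 ⊗ bb)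
      (solve (N ∷ R ∷ u ∷ o ∷ b ∷ b' ∷ c ∷ θ ∷ θ' ∷ e ∷ []))

  order-≤-below : ∀ N Z s e → 0ℤ ≤ N → 0ℤ ≤ Z → s ≤ N * (Z + + 2) → 0ℤ ≤ e - (+ 1 + Z) → N + s ≤ + 3 * N * e
  order-≤-below N Z s e N0 Z0 h e1 =
    ≤-slack (0≤+ {3} ⊗ N0 ⊗ e1 ⊕ 0≤+ {2} ⊗ (N0 ⊗ Z0) ⊕ i≤j⇒0≤j-i h) (solve (N ∷ Z ∷ s ∷ e ∷ []))

  -- A smaller first coordinate lowers the index by a whole layer of 8RZ · 66R² hubs. As b is in the
  -- upper half, the second coordinates give back less than half of a layer, and more than 264R³Z
  -- indices remain; for small b the gap could be a single index.
  index-gap : ∀ R Z u u' b b' θ θ' → 0ℤ ≤ R - + 1 → 0ℤ ≤ R → 0ℤ ≤ Z → 0ℤ ≤ u - u' - + 1 → 0ℤ ≤ b - + 4 * (R * Z) →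
    0ℤ ≤ + 8 * (R * Z) - b' - + 1 → 0ℤ ≤ θ → 0ℤ ≤ + 66 * (R * R) - θ' - + 1 →
    0ℤ ≤ (+ 66 * (R * R) * (+ 8 * (R * Z) * u + b) + θ) - (+ 66 * (R * R) * (+ 8 * (R * Z) * u' + b') + θ') - (+
        1 + Z)
  index-gap R Z u u' b b' θ θ' R1 R0 Z0 uu b4 Xb' θ0 Wθ' =
    ≤-slack (0≤+ {528} ⊗ (R0 ⊗ Z0 ⊗ uu ⊗ (R0 ⊗ R0)) ⊕ 0≤+ {66} ⊗ (R0 ⊗ R0) ⊗ (Xb' ⊕ b4) ⊕ Wθ' ⊕ θ0
        ⊕ 0≤+ {263} ⊗ (Z0 ⊗ R0 ⊗ (R0 ⊗ R0)) ⊕ Z0 ⊗ R1 ⊗ (R0 ⊗ R0 ⊕ R0 ⊕ 0≤+ {1}))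
      (solve (R ∷ Z ∷ u ∷ u' ∷ b ∷ b' ∷ θ ∷ θ' ∷ []))

  -- Here ρ is the offset inside a block of R points. The `+ 1` makes the bound strict, which keeps
  -- edges at foreign hubs from being tight.
  tilt-< : ∀ N R u u' ρ → 0ℤ ≤ N - + 65 * (R * R) → 0ℤ ≤ R - + 1 → 0ℤ ≤ R → 0ℤ ≤ R - u → 0ℤ ≤ u' → 0ℤ ≤ ρ →
      0ℤ ≤ R - ρ →
    + 1 + + 2 * (u - u') * ρ ≤ N
  tilt-< N R u u' ρ N65 R1 R0 Ru u'0 ρ0 Rρ =
    ≤-slack (N65 ⊕ 0≤+ {62} ⊗ (R0 ⊗ R0) ⊕ R1 ⊗ (R0 ⊕ 0≤+ {1}) ⊕ 0≤+ {2} ⊗ (Ru ⊗ ρ0 ⊕ u'0 ⊗ ρ0 ⊕ R0 ⊗ Rρ))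
      (solve (N ∷ R ∷ u ∷ u' ∷ ρ ∷ []))

  -- Potentials that change by at most N along an edge.

  Near : ℤ → ℤ → ℤ → Set
  Near N x y = (y ≤ x + N) × (x ≤ y + N)

  near-sym : ∀ {N x y} → Near N x y → Near N y x
  near-sym (p , q) = q , p

  near-refl : ∀ {N x} → 0ℤ ≤ N → Near N x x
  near-refl {N} {x} N0 = le , le
    where le = ≤-slack N0 refl

  near-step : ∀ {N x y} → 0ℤ ≤ N → y ≡ x + N → Near N x y
  near-step {N} {x} N0 refl = ≤-refl , ≤-slack (N0 ⊕ N0) (solve (N ∷ x ∷ []))

  near-⊓ : ∀ {N x y x' y'} → Near N x y → Near N x' y' → Near N (x ⊓ x') (y ⊓ y')
  near-⊓ {N} {x} {y} {x'} {y'} (p , q) (p' , q') = bound x x' p p' , bound y y' q q'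
    where
    bound : ∀ a c {b d} → b ≤ a + N → d ≤ c + N → b ⊓ d ≤ (a ⊓ c) + N
    bound a c {b} {d} h k = subst (b ⊓ d ≤_) (sym (mono-≤-distrib-⊓ (+-monoˡ-≤ N) a c)) (⊓-mono-≤ h k)

  -- Finite indices as integers, and the sizes of the parts.

  ⟦_⟧ : ∀ {n} → Fin n → ℤ
  ⟦ i ⟧ = + toℕ i

  0≤⟦_⟧ : ∀ {n} (i : Fin n) → 0ℤ ≤ ⟦ i ⟧
  0≤⟦ i ⟧ = 0≤+

  ⟦_⟧< : ∀ {n} (i : Fin n) → 0ℤ ≤ + n - ⟦ i ⟧ - + 1
  ⟦_⟧< {n} i = subst (0ℤ ≤_) (eq (+ n) ⟦ i ⟧) (i≤j⇒0≤j-i (+≤+ (Fin.toℕ<n i)))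
    where
    eq : ∀ m i → m - (+ 1 + i) ≡ m - i - + 1
    eq = solve-∀

  ⟦_⟧≤ : ∀ {n} (i : Fin n) → 0ℤ ≤ + n - ⟦ i ⟧
  ⟦ i ⟧≤ = i≤j⇒0≤j-i (+≤+ (ℕ.<⇒≤ (Fin.toℕ<n i)))

  combine-monoʳ-< : ∀ {m n} (i : Fin m) {k l : Fin n} → k Fin.< l → combine i k Fin.< combine i l
  combine-monoʳ-< {m} {n} i {k} {l} k<l = subst₂ ℕ._<_ (sym (Fin.toℕ-combine i k)) (sym (Fin.toℕ-combine i l))
    (ℕ.+-monoʳ-< (n ℕ.* toℕ i) k<l)

  -- To be used with z = r⁴.
  module Sizes (r z : ℕ) where

    R Z : ℤ
    R = + r
    Z = + z

    opaque
      -- `X` is the side of the box for a and for b, `Y` the one for y. `B` blocks of r points fill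
      -- a side `X`, and `T` leaves room for arm positions up to z + 2.
      X W Y B T : ℕ
      X = 8 ℕ.* (r ℕ.* z)
      W = 66 ℕ.* (r ℕ.* r)
      Y = 96 ℕ.* (r ℕ.* (r ℕ.* z))
      B = 8 ℕ.* z
      T = 4 ℕ.* z

      X≡ : X ≡ 8 ℕ.* (r ℕ.* z)
      X≡ = refl

      W≡ : W ≡ 66 ℕ.* (r ℕ.* r)
      W≡ = refl

      Y≡ : Y ≡ 96 ℕ.* (r ℕ.* (r ℕ.* z))
      Y≡ = refl

      B≡ : B ≡ 8 ℕ.* z
      B≡ = refl

      T≡ : T ≡ 4 ℕ.* z
      T≡ = refl

    σ : ℕ
    σ = r ℕ.* X ℕ.* W

    +X : + X ≡ + 8 * (R * Z)
    +X = trans (cong +_ X≡) (trans (pos-* 8 (r ℕ.* z)) (cong (+ 8 *_) (pos-* r z)))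

    +W : + W ≡ + 66 * (R * R)
    +W = trans (cong +_ W≡) (trans (pos-* 66 (r ℕ.* r)) (cong (+ 66 *_) (pos-* r r)))

    +Y : + Y ≡ + 96 * (R * (R * Z))
    +Y = trans (cong +_ Y≡) (trans (pos-* 96 (r ℕ.* (r ℕ.* z)))
      (cong (+ 96 *_) (trans (pos-* r (r ℕ.* z)) (cong (R *_) (pos-* r z)))))

    +B : + B ≡ + 8 * Z
    +B = trans (cong +_ B≡) (pos-* 8 z)

    X≤ : (b : Fin X) → 0ℤ ≤ + 8 * (R * Z) - ⟦ b ⟧
    X≤ b = subst (λ x → 0ℤ ≤ x - ⟦ b ⟧) +X ⟦ b ⟧≤

    X< : (b : Fin X) → 0ℤ ≤ + 8 * (R * Z) - ⟦ b ⟧ - + 1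
    X< b = subst (λ x → 0ℤ ≤ x - ⟦ b ⟧ - + 1) +X ⟦ b ⟧<

    W≤ : (θ : Fin W) → 0ℤ ≤ + 66 * (R * R) - ⟦ θ ⟧
    W≤ θ = subst (λ x → 0ℤ ≤ x - ⟦ θ ⟧) +W ⟦ θ ⟧≤

    W< : (θ : Fin W) → 0ℤ ≤ + 66 * (R * R) - ⟦ θ ⟧ - + 1
    W< θ = subst (λ x → 0ℤ ≤ x - ⟦ θ ⟧ - + 1) +W ⟦ θ ⟧<

    B≤ : (c : Fin B) → 0ℤ ≤ + 8 * Z - ⟦ c ⟧
    B≤ c = subst (λ x → 0ℤ ≤ x - ⟦ c ⟧) +B ⟦ c ⟧≤

    -- Hubs and the graph on the side of one terminal.

    Hub : Set
    Hub = Fin r × Fin X × Fin W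

    hubIndex : Hub → Fin σ
    hubIndex (u , b , θ) = combine (combine u b) θ

    index : Hub → ℕ
    index h = toℕ (hubIndex h)

    index-injective : ∀ {h k} → index h ≡ index k → h ≡ k
    index-injective {u , b , θ} {u' , b' , θ'} e
      with Fin.combine-injective (combine u b) θ (combine u' b') θ' (Fin.toℕ-injective e)
    ... | e' , refl with Fin.combine-injective u b u' b' e'
    ... | refl , refl = refl

    +index : ∀ u b θ → + index (u , b , θ) ≡ + 66 * (R * R) * (+ 8 * (R * Z) * ⟦ u ⟧ + ⟦ b ⟧) + ⟦ θ ⟧
    +index u b θ = begin
      + index (u , b , θ)                                   ≡⟨ cong +_ (Fin.toℕ-combine (combine u b) θ) ⟩
      + (W ℕ.* toℕ (combine u b) ℕ.+ toℕ θ)                  ≡⟨ pos-+ (W ℕ.* toℕ (combine u b)) (toℕ θ) ⟩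
      + (W ℕ.* toℕ (combine u b)) + ⟦ θ ⟧                    ≡⟨ cong (_+ ⟦ θ ⟧) (pos-* W (toℕ (combine u b))) ⟩
      + W * ⟦ combine u b ⟧ + ⟦ θ ⟧                          ≡⟨ cong₂ (λ w x → w * x + ⟦ θ ⟧) +W inner ⟩
      + 66 * (R * R) * (+ 8 * (R * Z) * ⟦ u ⟧ + ⟦ b ⟧) + ⟦ θ ⟧ ∎
      where
      open ≡-Reasoning
      inner : ⟦ combine u b ⟧ ≡ + 8 * (R * Z) * ⟦ u ⟧ + ⟦ b ⟧
      inner = begin
        ⟦ combine u b ⟧               ≡⟨ cong +_ (Fin.toℕ-combine u b) ⟩
        + (X ℕ.* toℕ u ℕ.+ toℕ b)      ≡⟨ pos-+ (X ℕ.* toℕ u) (toℕ b) ⟩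
        + (X ℕ.* toℕ u) + ⟦ b ⟧        ≡⟨ cong (_+ ⟦ b ⟧) (pos-* X (toℕ u)) ⟩
        + X * ⟦ u ⟧ + ⟦ b ⟧            ≡⟨ cong (λ x → x * ⟦ u ⟧ + ⟦ b ⟧) +X ⟩
        + 8 * (R * Z) * ⟦ u ⟧ + ⟦ b ⟧  ∎

    _≟ʰ_ : (h k : Hub) → Dec (h ≡ k)
    _≟ʰ_ = ≡-dec Fin._≟_ (≡-dec Fin._≟_ Fin._≟_)

    -- The columns hang on a spine, the diagonal through the vertices pad i (4i), which starts at the
    -- terminal pad 0 0. Hub h is the top of column index h, at distance 4σ − 3 · index h from the
    -- terminal. From it arms lead to blocks of r attached points each, and they are so long that
    -- passing through a foreign hub never pays off.
    data Side : Set where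
      pad : Fin (2 ℕ.* σ) → Fin (8 ℕ.* σ) → Side
      arm : Hub → Fin B → Fin T → Side

    Link : Side → Side → Set
    Link (pad i τ) (pad i' τ') =
        (i' ≡ i × toℕ τ' ≡ suc (toℕ τ))
      ⊎ (toℕ i' ≡ suc (toℕ i) × toℕ τ ≡ 4 ℕ.* toℕ i × toℕ τ' ≡ 4 ℕ.* toℕ i')
    Link (pad i τ) (arm h c τ') = toℕ i ≡ index h × toℕ τ ≡ 4 ℕ.* σ × toℕ τ' ≡ 0
    Link (arm h c τ) (pad i τ') = ⊥
    Link (arm h c τ) (arm h' c' τ') = h' ≡ h × c' ≡ c × toℕ τ' ≡ suc (toℕ τ)

    -- Hub (u , b , θ) sees the points (α , β , y) with β = b and y + 2uα = 16r²z + θ, where 0 ≤ θ < W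
    -- and W is at least the increment of y + 2uα along a step (u , _), so that each such line meets this window.
    Dock : Hub → Fin B → Fin T → ℤ → ℤ → ℤ → Set
    Dock (u , b , θ) c τ α β y = ⟦ τ ⟧ ≡ Z + + 2 × β ≡ ⟦ b ⟧ × y + + 2 * ⟦ u ⟧ * α ≡ + 16 * (R * (R * Z)) + ⟦ θ ⟧
      × ⟦ c ⟧ * R ≤ α × α ≤ ⟦ c ⟧ * R + R

    IsFault : Hub → Side → Side → Set
    IsFault h (pad i τ) (pad i' τ') = toℕ i ≡ index h × toℕ τ ≡ 4 ℕ.* index h × toℕ i' ≡ suc (index h) ×
        toℕ τ' ≡ 4 ℕ.* suc (index h)
    IsFault h _ _ = ⊥

    -- The potential on one side, for a selected hub.

    module Potential (1≤r : 1 ℕ.≤ r) (N o : ℤ) (target : Hub)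
        (0≤N-65RR : 0ℤ ≤ N - + 65 * (R * R)) (0≤o : 0ℤ ≤ o) (0≤R-o : 0ℤ ≤ R - o)
        (4RZ≤b : 0ℤ ≤ ⟦ proj₁ (proj₂ target) ⟧ - + 4 * (R * Z)) where

      u₀ b₀ θ₀ : ℤ
      u₀ = ⟦ proj₁ target ⟧
      b₀ = ⟦ proj₁ (proj₂ target) ⟧
      θ₀ = ⟦ proj₂ (proj₂ target) ⟧
      i₀ : ℕ
      i₀ = index target

      opaque
        0≤R-1 : 0ℤ ≤ R - + 1
        0≤R-1 = i≤j⇒0≤j-i (+≤+ 1≤r)

        0≤N : 0ℤ ≤ N
        0≤N = ≤-slack (0≤N-65RR ⊕ 0≤+ {65} ⊗ (0≤+ {r} ⊗ 0≤+ {r})) (eq N R)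
          where
          eq : ∀ n s → n ≡ 0ℤ + (n - + 65 * (s * s) + + 65 * (s * s))
          eq = solve-∀

        -- The factor of N counts 4σ - 3i₀ edges along spine and column, one edge into the arm, and
        -- Z + 2 edges to its tip.
        cap : ℤ
        cap = N * (+ (4 ℕ.* σ) - + 3 * + i₀ + (Z + + 3))

        -- Levels are distances from the terminal times N, cut off at the level of the arm tips of the
        -- target; columns behind the fault are cut off from the terminal and get this level throughout.
        padLevel : ℕ → ℕ → ℤ
        padLevel i τ with i ℕ.≤? i₀
        ... | yes _ = N * (+ τ - + 3 * + i) ⊓ cap
        ... | no _  = cap

        -- Φ at a point attached to the hub, minus Φ at the points attached to the target, evaluated
        -- at α = cR, the start of block `c`. It comes from y + 2u₀α = (y + 2uα) + 2(u₀ - u)α, where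
        -- the window of the hub fixes y + 2uα.
        shift : Hub → Fin B → ℤ
        shift (u , b , θ) c = (⟦ θ ⟧ - θ₀) + + 2 * o * (⟦ b ⟧ - b₀) + + 2 * (u₀ - ⟦ u ⟧) * (⟦ c ⟧ * R)

        -- The level of the docked points minus N for the target, and about their level for all other
        -- hubs: thus no edge between a foreign hub and the box is tight.
        tip : Hub → Fin B → ℤ
        tip h c with h ≟ʰ target
        ... | yes _ = cap
        ... | no _  = cap + N + shift h c

        -- On an arm this is the smaller of two bounds: what the column top permits and what the tip
        -- permits. `tip-≤` ensures that the tip gets its prescribed value, and `tip-≥` that the
        -- edge at the root changes the level by at most N.
        level : Side → ℤ
        level (pad i τ) = padLevel (toℕ i) (toℕ τ)
        level (arm h c τ) = (padLevel (index h) (4 ℕ.* σ) + N * (⟦ τ ⟧ + + 1)) ⊓ (tip h c + N * (Z + + 2 - ⟦ τ ⟧))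

        shift-upper : ∀ h c → shift h c ≤ N * (Z + + 2)
        shift-upper (u , b , θ) c = shift-≤ N R Z u₀ ⟦ u ⟧ o b₀ ⟦ b ⟧ ⟦ c ⟧ θ₀ ⟦ θ ⟧ 0≤N-65RR (0≤+ {r}) (0≤+ {z})
            ⟦ proj₁ target ⟧≤ 0≤⟦ u ⟧ 0≤o 0≤R-o
          0≤⟦ proj₁ (proj₂ target) ⟧ (X≤ b) 0≤⟦ c ⟧ (B≤ c) 0≤⟦ proj₂ (proj₂ target) ⟧ (W≤ θ)

        -- For a fixed block, exchanging the hub with the target negates `shift`, and the bound
        -- `shift-≤` applies to both orders.
        shift-lower : ∀ h c → 0ℤ ≤ N * (Z + + 2) + shift h c
        shift-lower (u , b , θ) c = subst (0ℤ ≤_) (eq (N * (Z + + 2)) o u₀ b₀ θ₀ ⟦ u ⟧ ⟦ b ⟧ ⟦ θ ⟧ (⟦ c ⟧ * R))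
            (i≤j⇒0≤j-i
          (shift-≤ N R Z ⟦ u ⟧ u₀ o ⟦ b ⟧ b₀ ⟦ c ⟧ ⟦ θ ⟧ θ₀ 0≤N-65RR (0≤+ {r}) (0≤+ {z}) ⟦ u ⟧≤ 0≤⟦ proj₁ target ⟧ 0≤o
              0≤R-o
            0≤⟦ b ⟧ (X≤ (proj₁ (proj₂ target))) 0≤⟦ c ⟧ (B≤ c) 0≤⟦ θ ⟧ (W≤ (proj₂ (proj₂ target)))))
          where
          eq : ∀ n o u b θ u' b' θ' c → n - ((θ - θ') + + 2 * o * (b - b') + + 2 * (u' - u) * c)
             ≡ n + ((θ' - θ) + + 2 * o * (b' - b) + + 2 * (u - u') * c)
          eq = solve-∀

        padLevel-≤cap : ∀ i τ → padLevel i τ ≤ cap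
        padLevel-≤cap i τ with i ℕ.≤? i₀
        ... | yes _ = i⊓j≤j (N * (+ τ - + 3 * + i)) cap
        ... | no _  = ≤-refl

        padLevel-natural : ∀ {i} τ → i ℕ.≤ i₀ → padLevel i τ ≡ N * (+ τ - + 3 * + i) ⊓ cap
        padLevel-natural {i} τ p with i ℕ.≤? i₀
        ... | yes _ = refl
        ... | no ¬p = contradiction p ¬p

        padLevel-beyond : ∀ {i} τ → i₀ ℕ.< i → padLevel i τ ≡ cap
        padLevel-beyond {i} τ p with i ℕ.≤? i₀
        ... | yes q = contradiction q (ℕ.<⇒≱ p)
        ... | no _ = refl

        rise-near : ∀ i τ → Near N (padLevel i τ) (padLevel i (suc τ))
        rise-near i τ with i ℕ.≤? i₀
        ... | yes _ = near-⊓ (near-step 0≤N (eq N (+ τ) (+ i))) (near-refl 0≤N)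
          where
          eq : ∀ n t i → n * (+ 1 + t - + 3 * i) ≡ n * (t - + 3 * i) + n
          eq = solve-∀
        ... | no _ = near-refl 0≤N

        spine-value : ∀ i → N * (+ (4 ℕ.* i) - + 3 * + i) ≡ N * + i
        spine-value i = trans (cong (λ x → N * (x - + 3 * + i)) (pos-* 4 i)) (eq N (+ i))
          where
          eq : ∀ n i → n * (+ 4 * i - + 3 * i) ≡ n * i
          eq = solve-∀

        -- At `i₀` the level leaps from its natural value to `cap`; that spine edge is the one to be
        -- cut.
        diag-near : ∀ i → i ≢ i₀ → Near N (padLevel i (4 ℕ.* i)) (padLevel (suc i) (4 ℕ.* suc i))
        diag-near i ne with ℕ.<-cmp i i₀
        ... | tri< i< _ _ = subst₂ (Near N) (sym (value i (ℕ.<⇒≤ i<))) (sym (value (suc i) i<))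
                (near-⊓ (near-step 0≤N (eq N (+ i))) (near-refl 0≤N))
          where
          value : ∀ k → k ℕ.≤ i₀ → padLevel k (4 ℕ.* k) ≡ N * + k ⊓ cap
          value k le = trans (padLevel-natural (4 ℕ.* k) le) (cong (_⊓ cap) (spine-value k))
          eq : ∀ n i → n * (+ 1 + i) ≡ n * i + n
          eq = solve-∀
        ... | tri≈ _ e _ = contradiction e ne
        ... | tri> _ _ i> = subst₂ (Near N) (sym (padLevel-beyond (4 ℕ.* i) i>))
                (sym (padLevel-beyond (4 ℕ.* suc i) (ℕ.m<n⇒m<1+n i>))) (near-refl 0≤N)

        tip-≥ : ∀ h c → cap ≤ tip h c + N * (Z + + 3)
        tip-≥ h c with h ≟ʰ target
        ... | yes _ = ≤-slack (0≤N ⊗ (0≤+ {z} ⊕ 0≤+ {3})) refl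
        ... | no _  = ≤-slack (shift-lower h c ⊕ 0≤+ {2} ⊗ 0≤N) (eq cap N Z (shift h c))
          where
          eq : ∀ k n z s → k + n + s + n * (z + + 3) ≡ k + (n * (z + + 2) + s + + 2 * n)
          eq = solve-∀

        -- One index less saves a spine edge and adds four column edges, so it costs 3N. With a
        -- smaller first coordinate the index gap exceeds Z and pays for any `shift`. With an equal
        -- one b ≤ b₀, so the term with `o` is at most 0 and only the window term remains, at most
        -- 66R² ≤ 2N.
        index-above : ∀ h → index h ℕ.< i₀ → ∀ c → N + shift h c ≤ + 3 * N * (+ i₀ - + index h)
        index-above (u , b , θ) h< c with ℕ.<-cmp (toℕ u) (toℕ (proj₁ target))
        ... | tri< u< _ _ = order-≤-below N Z (shift (u , b , θ) c) (+ i₀ - + index (u , b , θ)) 0≤N (0≤+ {z})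
                (shift-upper (u , b , θ) c)
                (subst (0ℤ ≤_) (cong₂ (λ x y → x - y - (+ 1 + Z)) (sym (+index _ _ _)) (sym (+index u b θ)))
                  (index-gap R Z u₀ ⟦ u ⟧ b₀ ⟦ b ⟧ θ₀ ⟦ θ ⟧ 0≤R-1 (0≤+ {r}) (0≤+ {z})
                    (subst (0ℤ ≤_) (eq u₀ ⟦ u ⟧) (i≤j⇒0≤j-i (+≤+ u<))) 4RZ≤b (X< b) 0≤⟦ proj₂ (proj₂ target) ⟧
                        (W< θ)))
          where
          eq : ∀ v w → v - (+ 1 + w) ≡ v - w - + 1
          eq = solve-∀
        ... | tri≈ _ u≡ _ rewrite Fin.toℕ-injective u≡ =
                order-≤-same N R u₀ o b₀ ⟦ b ⟧ ⟦ c ⟧ θ₀ ⟦ θ ⟧ _ 0≤N 0≤N-65RR (0≤+ {r}) 0≤o (i≤j⇒0≤j-i (+≤+ b≤))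
                  0≤⟦ proj₂ (proj₂ target) ⟧ (W≤ θ) (subst (0ℤ ≤_) (eq (+ i₀) (+ index (_ , b , θ)))
                      (i≤j⇒0≤j-i (+≤+ h<)))
          where
          eq : ∀ v w → v - (+ 1 + w) ≡ v - w - + 1
          eq = solve-∀
          b≤ : toℕ b ℕ.≤ toℕ (proj₁ (proj₂ target))
          b≤ = ℕ.≮⇒≥ λ b> → ℕ.<-asym h< (Fin.combine-monoˡ-< (proj₂ (proj₂ target)) θ
              (combine-monoʳ-< (proj₁ target) b>))
        ... | tri> _ _ u> = contradiction h< (ℕ.<-asym
                (Fin.combine-monoˡ-< (proj₂ (proj₂ target)) θ (Fin.combine-monoˡ-< (proj₁ (proj₂ target)) b u>)))

        ≤-⊓+ : ∀ {x m} a b → x ≤ a + m → x ≤ b + m → x ≤ (a ⊓ b) + m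
        ≤-⊓+ {x} {m} a b p q = subst (x ≤_) (sym (mono-≤-distrib-⊓ (+-monoˡ-≤ m) a b)) (⊓-glb p q)

        -- A violation would mean a shortcut into the box through `h`. Behind the fault the column
        -- lies at `cap`, and the arm alone is long enough. Before it the natural level of the
        -- column top may be below `cap`, and there the order of the hubs enters by `index-above`.
        tip-≤ : ∀ h c → tip h c ≤ padLevel (index h) (4 ℕ.* σ) + N * (Z + + 3)
        tip-≤ h c with h ≟ʰ target
        ... | yes refl = subst (λ x → cap ≤ x + N * (Z + + 3)) (sym (padLevel-natural (4 ℕ.* σ) ℕ.≤-refl))
                (≤-⊓+ (N * (+ (4 ℕ.* σ) - + 3 * + i₀)) cap (≤-reflexive (eq N (+ (4 ℕ.* σ) - + 3 * + i₀) Z))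
                    (≤-slack (0≤N ⊗ (0≤+ {z} ⊕ 0≤+ {3})) refl))
          where
          eq : ∀ n l z → n * (l + (z + + 3)) ≡ n * l + n * (z + + 3)
          eq = solve-∀
        ... | no ne with ℕ.<-cmp (index h) i₀
        ...   | tri≈ _ e _ = contradiction (index-injective e) ne
        ...   | tri> _ _ h> = subst (λ x → cap + N + shift h c ≤ x + N * (Z + + 3))
            (sym (padLevel-beyond (4 ℕ.* σ) h>))
                (≤-slack (i≤j⇒0≤j-i (shift-upper h c)) (eq cap N Z (shift h c)))
          where
          eq : ∀ k n z s → k + n * (z + + 3) ≡ k + n + s + (n * (z + + 2) - s)
          eq = solve-∀
        ...   | tri< h< _ _ = subst (λ x → cap + N + shift h c ≤ x + N * (Z + + 3))
            (sym (padLevel-natural (4 ℕ.* σ) (ℕ.<⇒≤ h<)))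
                (≤-⊓+ (N * (+ (4 ℕ.* σ) - + 3 * + index h)) cap (≤-slack (i≤j⇒0≤j-i (index-above h h< c))
                    (eq′ N (+ (4 ℕ.* σ)) (+ i₀) (+ index h) Z (shift h c)))
                  (≤-slack (i≤j⇒0≤j-i (shift-upper h c)) (eq cap N Z (shift h c))))
          where
          eq : ∀ k n z s → k + n * (z + + 3) ≡ k + n + s + (n * (z + + 2) - s)
          eq = solve-∀
          eq′ : ∀ n l i j z s → n * (l - + 3 * j) + n * (z + + 3) ≡ n * (l - + 3 * i + (z + + 3)) + n + s + (+
              3 * n * (i - j) - (n + s))
          eq′ = solve-∀

        link-near : ∀ x y → Link x y → ¬ IsFault target x y → Near N (level x) (level y)
        link-near (pad i τ) (pad i' τ') (inj₁ (refl , e)) _ rewrite e = rise-near (toℕ i) (toℕ τ)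
        link-near (pad i τ) (pad i' τ') (inj₂ (e , f , g)) nf rewrite f | g | e =
          diag-near (toℕ i) λ i≡ → nf (i≡ , cong (4 ℕ.*_) i≡ , cong suc i≡ , cong (λ k → 4 ℕ.* suc k) i≡)
        link-near (pad i τ) (arm h c τ') (e , f , g) _ rewrite e | f | g = up , down
          where
          p : ℤ
          p = padLevel (index h) (4 ℕ.* σ)
          up : (p + N * + 1) ⊓ (tip h c + N * (Z + + 2 - 0ℤ)) ≤ p + N
          up = ≤-trans (i⊓j≤i (p + N * + 1) _) (≤-reflexive (cong (λ x → p + x) (*-identityʳ N)))
          down : p ≤ (p + N * + 1) ⊓ (tip h c + N * (Z + + 2 - 0ℤ)) + N
          down = ≤-⊓+ (p + N * + 1) _ (≤-slack (0≤+ {2} ⊗ 0≤N) (eq p N))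
                   (≤-trans (padLevel-≤cap (index h) (4 ℕ.* σ))
                       (≤-trans (tip-≥ h c) (≤-reflexive (eq′ (tip h c) N Z))))
            where
            eq : ∀ p n → p + n * + 1 + n ≡ p + + 2 * n
            eq = solve-∀
            eq′ : ∀ t n z → t + n * (z + + 3) ≡ t + n * (z + + 2 - 0ℤ) + n
            eq′ = solve-∀
        link-near (arm h c τ) (arm h' c' τ') (refl , refl , e) _ rewrite e =
          near-⊓ (near-step 0≤N (eq p N ⟦ τ ⟧)) (near-sym (near-step 0≤N (eq′ (tip h c) N Z ⟦ τ ⟧)))
          where
          p : ℤ
          p = padLevel (index h) (4 ℕ.* σ)
          eq : ∀ p n t → p + n * (+ 1 + t + + 1) ≡ p + n * (t + + 1) + n
          eq = solve-∀
          eq′ : ∀ k n z t → k + n * (z + + 2 - t) ≡ k + n * (z + + 2 - (+ 1 + t)) + n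
          eq′ = solve-∀

        level-tip : ∀ h c τ → ⟦ τ ⟧ ≡ Z + + 2 → level (arm h c τ) ≡ tip h c
        level-tip h c τ e = trans (cong (λ t → (padLevel (index h) (4 ℕ.* σ) + N * (t + + 1)) ⊓
            (tip h c + N * (Z + + 2 - t))) e) (trans
          (i≥j⇒i⊓j≡j (≤-trans (≤-reflexive (eq (tip h c) N Z))
              (≤-trans (tip-≤ h c) (≤-reflexive (eq′ (padLevel (index h) (4 ℕ.* σ)) N Z)))))
          (eq (tip h c) N Z))
          where
          eq : ∀ k n z → k + n * (z + + 2 - (z + + 2)) ≡ k
          eq = solve-∀
          eq′ : ∀ p n z → p + n * (z + + 3) ≡ p + n * (z + + 2 + + 1)
          eq′ = solve-∀

        level-root : ∀ i τ → toℕ i ≡ 0 → toℕ τ ≡ 0 → level (pad i τ) ≡ 0ℤ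
        level-root i τ e f rewrite e | f = trans (padLevel-natural {0} 0 z≤n)
          (trans (cong (_⊓ cap) (*-zeroʳ N)) (i≤j⇒i⊓j≡i 0≤cap))
          where
          eq : ∀ i s z → i + (s - (i + + 1)) + + 3 * (s - (i + + 1)) + + 4 + z + + 3 ≡ + 4 * s - + 3 * i + (z + + 3)
          eq = solve-∀
          0≤cap : 0ℤ ≤ cap
          0≤cap = 0≤N ⊗ subst (0ℤ ≤_) (trans (eq (+ i₀) (+ σ) Z) (cong (λ x → x - + 3 * + i₀ + (Z + + 3))
              (sym (pos-* 4 σ))))
            (0≤+ {i₀} ⊕ s ⊕ 0≤+ {3} ⊗ s ⊕ 0≤+ {4} ⊕ 0≤+ {z} ⊕ 0≤+ {3})
            where
            eq₂ : ∀ s i → s - i - + 1 ≡ s - (i + + 1)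
            eq₂ = solve-∀
            s : 0ℤ ≤ + σ - (+ i₀ + + 1)
            s = subst (0ℤ ≤_) (eq₂ (+ σ) (+ i₀)) ⟦ hubIndex target ⟧<

        origin : ℤ
        origin = + 16 * (R * (R * Z)) + θ₀ + + 2 * o * b₀

        -- Φ, normalised so that points attached to the target lie exactly N above its arm tips. The
        -- other coordinate `o` of the direction is the one fixed by the hub on the opposite side.
        bulk : ℤ → ℤ → ℤ → ℤ
        bulk α β y = cap + N + (y + + 2 * u₀ * α + + 2 * o * β - origin)

        tilt-near : ∀ {u v ρ} → 0ℤ ≤ u → 0ℤ ≤ R - u → 0ℤ ≤ v → 0ℤ ≤ R - v → 0ℤ ≤ ρ → 0ℤ ≤ R - ρ →
          + 1 + + 2 * (u - v) * ρ ≤ N × + 1 - + 2 * (u - v) * ρ ≤ N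
        tilt-near {u} {v} {ρ} u0 Ru v0 Rv ρ0 Rρ = tilt-< N R u v ρ 0≤N-65RR 0≤R-1 (0≤+ {r}) Ru v0 ρ0 Rρ ,
          ≤-trans (≤-reflexive (eq u v ρ)) (tilt-< N R v u ρ 0≤N-65RR 0≤R-1 (0≤+ {r}) Rv u0 ρ0 Rρ)
          where
          eq : ∀ u v ρ → + 1 - + 2 * (u - v) * ρ ≡ + 1 + + 2 * (v - u) * ρ
          eq = solve-∀

        tip-target : ∀ c → tip target c ≡ cap
        tip-target c with target ≟ʰ target
        ... | yes _ = refl
        ... | no ne = contradiction refl ne

        tip-other : ∀ {h} c → h ≢ target → tip h c ≡ cap + N + shift h c
        tip-other {h} c ne with h ≟ʰ target
        ... | yes e = contradiction e ne
        ... | no _ = refl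

        dock-target : ∀ c τ α β y → Dock target c τ α β y → y + + 2 * u₀ * α + + 2 * o * β ≡ origin
        dock-target c τ α β y (_ , β≡ , e , _) = trans (cong₂ (λ p q → p + + 2 * o * q) e β≡) refl

        bulk-target : ∀ c τ α β y → Dock target c τ α β y → bulk α β y ≡ tip target c + N
        bulk-target c τ α β y d = trans (cong (λ x → cap + N + (x - origin)) (dock-target c τ α β y d))
          (trans (eq (cap + N) origin) (cong (_+ N) (sym (tip-target c))))
          where
          eq : ∀ k w → k + (w - w) ≡ k
          eq = solve-∀

        bulk-other : ∀ h c τ α β y → Dock h c τ α β y → h ≢ target →
          bulk α β y ≡ tip h c + + 2 * (u₀ - ⟦ proj₁ h ⟧) * (α - ⟦ c ⟧ * R)
        bulk-other (u , b , θ) c τ α β y (_ , β≡ , e , _) ne rewrite β≡ =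
          trans (eq′ (cap + N) y α u₀ ⟦ u ⟧ o ⟦ b ⟧ origin)
         (trans (cong (λ x → cap + N + (x + + 2 * (u₀ - ⟦ u ⟧) * α + + 2 * o * ⟦ b ⟧ - origin)) e)
         (trans (eq (cap + N) α u₀ ⟦ u ⟧ o ⟦ b ⟧ b₀ ⟦ θ ⟧ θ₀ (+ 16 * (R * (R * Z))) (⟦ c ⟧ * R))
                (cong (_+ + 2 * (u₀ - ⟦ u ⟧) * (α - ⟦ c ⟧ * R)) (sym (tip-other c ne)))))
          where
          eq′ : ∀ k y α u u' o b w →
              k + (y + + 2 * u * α + + 2 * o * b - w) ≡ k + (y + + 2 * u' * α + + 2 * (u - u') * α + + 2 * o * b - w)
          eq′ = solve-∀
          eq : ∀ k α u u' o b' b θ' θ q c → k + (q + θ' + + 2 * (u - u') * α + + 2 * o * b' - (q + θ + + 2 * o * b))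
             ≡ k + ((θ' - θ) + + 2 * o * (b' - b) + + 2 * (u - u') * c) + + 2 * (u - u') * (α - c)
          eq = solve-∀

        dock-offset : ∀ h c τ α β y → Dock h c τ α β y →
          + 1 + + 2 * (u₀ - ⟦ proj₁ h ⟧) * (α - ⟦ c ⟧ * R) ≤ N × + 1 - + 2 * (u₀ - ⟦ proj₁ h ⟧) * (α - ⟦ c ⟧ * R) ≤ N
        dock-offset (u , _) c τ α β y (_ , _ , _ , lo , hi) = tilt-near 0≤⟦ proj₁ target ⟧ ⟦ proj₁ target ⟧≤ 0≤⟦ u ⟧
            ⟦ u ⟧≤
          (i≤j⇒0≤j-i lo) (subst (0ℤ ≤_) (eq (⟦ c ⟧ * R) R α) (i≤j⇒0≤j-i hi))
          where
          eq : ∀ c s a → c + s - a ≡ s - (a - c)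
          eq = solve-∀

        dock-near : ∀ h c τ α β y → Dock h c τ α β y → Near N (level (arm h c τ)) (bulk α β y)
        dock-near h c τ α β y d = cases (h ≟ʰ target)
          where
          s : ℤ
          s = + 2 * (u₀ - ⟦ proj₁ h ⟧) * (α - ⟦ c ⟧ * R)
          eq : ∀ k n s → k + n ≡ k + s + (+ 1 + (n - (+ 1 + s)))
          eq = solve-∀
          eq′ : ∀ k n s → k + s + n ≡ k + (+ 1 + (n - (+ 1 - s)))
          eq′ = solve-∀
          cases : Dec (h ≡ target) → Near N (level (arm h c τ)) (bulk α β y)
          cases (yes refl) = subst (λ x → Near N x (bulk α β y)) (sym (level-tip h c τ (proj₁ d)))
              (near-step 0≤N (bulk-target c τ α β y d))
          cases (no ne) = subst₂ (Near N) (sym (level-tip h c τ (proj₁ d))) (sym (bulk-other h c τ α β y d ne))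
            (≤-slack (0≤+ {1} ⊕ i≤j⇒0≤j-i (proj₁ (dock-offset h c τ α β y d))) (eq (tip h c) N s) ,
             ≤-slack (0≤+ {1} ⊕ i≤j⇒0≤j-i (proj₂ (dock-offset h c τ α β y d))) (eq′ (tip h c) N s))

        -- At a foreign hub the change along the edge is just the offset inside the block, which is
        -- less than N by `tilt-<`.
        dock-tight : ∀ h c τ α β y → Dock h c τ α β y → bulk α β y ≡ level (arm h c τ) + N → h ≡ target
        dock-tight h c τ α β y d e = cases (h ≟ʰ target)
          where
          s : ℤ
          s = + 2 * (u₀ - ⟦ proj₁ h ⟧) * (α - ⟦ c ⟧ * R)
          cases : Dec (h ≡ target) → h ≡ target
          cases (yes p) = p
          cases (no ne) = contradiction
            (≤-trans (≤-reflexive (cong (λ x → + 1 + x) (sym s≡N))) (proj₁ (dock-offset h c τ α β y d)))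
            (<⇒≱ (suc[i]≤j⇒i<j ≤-refl))
            where
            s≡N : s ≡ N
            s≡N = ∙-cancelˡ (tip h c) s N (trans (sym (bulk-other h c τ α β y d ne))
              (trans e (cong (λ x → x + N) (level-tip h c τ (proj₁ d)))))

        dock-tip : ∀ c τ α β y → Dock target c τ α β y → bulk α β y ≡ cap + N
        dock-tip c τ α β y d = trans (bulk-target c τ α β y d) (cong (_+ N) (tip-target c))

        cap≡ : cap ≡ N * (+ (4 ℕ.* σ) - + 3 * + i₀ + (Z + + 3))
        cap≡ = refl

        origin≡ : origin ≡ + 16 * (R * (R * Z)) + θ₀ + + 2 * o * b₀
        origin≡ = refl

        bulk≡ : ∀ α β y → bulk α β y ≡ cap + N + (y + + 2 * u₀ * α + + 2 * o * β - origin)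
        bulk≡ _ _ _ = refl

  -- The whole network: the box with both sides attached.

  ⟦⟧-injective : ∀ {n} {i j : Fin n} → ⟦ i ⟧ ≡ ⟦ j ⟧ → i ≡ j
  ⟦⟧-injective e = Fin.toℕ-injective (+-injective e)

  module Network (r z : ℕ) (1≤r : 1 ℕ.≤ r) (junks : ℕ) where
    open Sizes r z

    -- The `junk` vertices are isolated; they bring the number of vertices to any prescribed n.
    data Vertex : Set where
      grid : Fin Y → Fin X → Fin X → Vertex
      side : Bool → Side → Vertex
      junk : Fin junks → Vertex

    grid-≡ : ∀ {y y' : Fin Y} {a a' b b' : Fin X} → ⟦ y ⟧ ≡ ⟦ y' ⟧ → ⟦ a ⟧ ≡ ⟦ a' ⟧ → ⟦ b ⟧ ≡ ⟦ b' ⟧ →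
        grid y a b ≡ grid y' a' b'
    grid-≡ {y} {y'} {a} {a'} {b} {b'} ey ea eb
      with refl ← ⟦⟧-injective {i = y} {y'} ey | refl ← ⟦⟧-injective {i = a} {a'} ea | refl ← ⟦⟧-injective {i = b}
          {b'} eb = refl

    opaque
      mirrorX mirrorY : ℤ → ℤ
      mirrorX x = + 8 * (R * Z) - + 1 - x
      mirrorY y = + 96 * (R * (R * Z)) - + 1 - y

      mirrorX≡ : ∀ x → mirrorX x ≡ + 8 * (R * Z) - + 1 - x
      mirrorX≡ _ = refl

      mirrorY≡ : ∀ y → mirrorY y ≡ + 96 * (R * (R * Z)) - + 1 - y
      mirrorY≡ _ = refl

      mirrorX-involutive : ∀ x → mirrorX (mirrorX x) ≡ x
      mirrorX-involutive = eq (+ 8 * (R * Z))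
        where
        eq : ∀ m x → m - + 1 - (m - + 1 - x) ≡ x
        eq = solve-∀

    -- Side false belongs to s. Side true belongs to t and is its image under the point reflection of
    -- the box followed by the exchange of a and b.
    DockAt : Bool → Hub → Fin B → Fin T → ℤ → ℤ → ℤ → Set
    DockAt false h c τ y a b = Dock h c τ a b y
    DockAt true h c τ y a b =
      Dock h c τ (mirrorX b) (mirrorX a) (mirrorY y)

    Step : Fin Y → Fin X → Fin X → Fin Y → Fin X → Fin X → Fin r → Fin r → Set
    Step y a b y' a' b' v w = ⟦ a' ⟧ ≡ ⟦ a ⟧ + ⟦ v ⟧ × ⟦ b' ⟧ ≡ ⟦ b ⟧ + ⟦ w ⟧
      × ⟦ y' ⟧ ≡ ⟦ y ⟧ + (+ 65 * (R * R) - ⟦ v ⟧ * ⟦ v ⟧ - ⟦ w ⟧ * ⟦ w ⟧)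

    -- Each edge has one orientation: from either terminal towards the box, and along increasing y
    -- inside it. On the side of t this runs against a walk from s to t.
    Edge : Vertex → Vertex → Set
    Edge (grid y a b) (grid y' a' b') = ∃ λ v → ∃ λ w → Step y a b y' a' b' v w
    Edge (side s x) (side s' x') = s' ≡ s × Link x x'
    Edge (side s (arm h c τ)) (grid y a b) = DockAt s h c τ ⟦ y ⟧ ⟦ a ⟧ ⟦ b ⟧
    Edge _ _ = ⊥

    Link? : ∀ x y → Dec (Link x y)
    Link? (pad i τ) (pad i' τ') = (i' Fin.≟ i ×-dec toℕ τ' ℕ.≟ suc (toℕ τ))
      ⊎-dec (toℕ i' ℕ.≟ suc (toℕ i) ×-dec toℕ τ ℕ.≟ 4 ℕ.* toℕ i ×-dec toℕ τ' ℕ.≟ 4 ℕ.* toℕ i')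
    Link? (pad i τ) (arm h c τ') = toℕ i ℕ.≟ index h ×-dec toℕ τ ℕ.≟ 4 ℕ.* σ ×-dec toℕ τ' ℕ.≟ 0
    Link? (arm h c τ) (pad i τ') = no λ ()
    Link? (arm h c τ) (arm h' c' τ') = h' ≟ʰ h ×-dec c' Fin.≟ c ×-dec toℕ τ' ℕ.≟ suc (toℕ τ)

    Dock? : ∀ h c τ α β y → Dec (Dock h c τ α β y)
    Dock? (u , b , θ) c τ α β y = (⟦ τ ⟧ ≟ Z + + 2) ×-dec (β ≟ ⟦ b ⟧)
      ×-dec (y + + 2 * ⟦ u ⟧ * α ≟ + 16 * (R * (R * Z)) + ⟦ θ ⟧) ×-dec (⟦ c ⟧ * R ≤? α) ×-dec (α ≤? ⟦ c ⟧ * R + R)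

    DockAt? : ∀ s h c τ y a b → Dec (DockAt s h c τ y a b)
    DockAt? false h c τ y a b = Dock? h c τ a b y
    DockAt? true h c τ y a b =
      Dock? h c τ (mirrorX b) (mirrorX a) (mirrorY y)

    Edge? : ∀ x y → Dec (Edge x y)
    Edge? (grid y a b) (grid y' a' b') = Fin.any? λ v → Fin.any? λ w →
      (⟦ a' ⟧ ≟ ⟦ a ⟧ + ⟦ v ⟧) ×-dec (⟦ b' ⟧ ≟ ⟦ b ⟧ + ⟦ w ⟧)
        ×-dec (⟦ y' ⟧ ≟ ⟦ y ⟧ + (+ 65 * (R * R) - ⟦ v ⟧ * ⟦ v ⟧ - ⟦ w ⟧ * ⟦ w ⟧))
    Edge? (grid _ _ _) (side _ _) = no λ ()
    Edge? (grid _ _ _) (junk _) = no λ ()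
    Edge? (side s (pad _ _)) (grid _ _ _) = no λ ()
    Edge? (side s (arm h c τ)) (grid y a b) = DockAt? s h c τ ⟦ y ⟧ ⟦ a ⟧ ⟦ b ⟧
    Edge? (side s (pad i τ)) (side s' x') = (s' Bool.≟ s) ×-dec Link? (pad i τ) x'
    Edge? (side s (arm h c τ)) (side s' x') = (s' Bool.≟ s) ×-dec Link? (arm h c τ) x'
    Edge? (side s (pad _ _)) (junk _) = no λ ()
    Edge? (side s (arm _ _ _)) (junk _) = no λ ()
    Edge? (junk _) _ = no λ ()

    0≤R-1 : 0ℤ ≤ R - + 1
    0≤R-1 = i≤j⇒0≤j-i (+≤+ 1≤r)

    -- This excludes loops, and it makes the first end of a box edge the one with the smaller code.
    advance-pos : ∀ (v w : Fin r) → + 1 ≤ + 65 * (R * R) - ⟦ v ⟧ * ⟦ v ⟧ - ⟦ w ⟧ * ⟦ w ⟧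
    advance-pos v w = ≤-slack
      (⟦ v ⟧≤ ⊗ (0≤+ {r} ⊕ 0≤⟦ v ⟧) ⊕ ⟦ w ⟧≤ ⊗ (0≤+ {r} ⊕ 0≤⟦ w ⟧) ⊕ 0≤+ {62} ⊗ (0≤+ {r} ⊗ 0≤+ {r}) ⊕ 0≤R-1 ⊗ (0≤+
          {r} ⊕ 0≤+ {1}))
      (eq R ⟦ v ⟧ ⟦ w ⟧)
      where
      eq : ∀ r v w → + 65 * (r * r) - v * v - w * w
         ≡ + 1 + ((r - v) * (r + v) + (r - w) * (r + w) + + 62 * (r * r) + (r - + 1) * (r + + 1))
      eq = solve-∀

    step-< : ∀ {y a b y' a' b'} v w → Step y a b y' a' b' v w → y Fin.< y'
    step-< {y} v w (_ , _ , e) = drop‿+≤+ (≤-trans (≤-reflexive (+-comm (+ 1) ⟦ y ⟧))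
      (≤-trans (+-monoʳ-≤ ⟦ y ⟧ (advance-pos v w)) (≤-reflexive (sym e))))

    IsFaultV : Hub → Hub → Vertex → Vertex → Set
    IsFaultV hS hT (side false x) (side false y) = IsFault hS x y
    IsFaultV hS hT (side true x) (side true y) = IsFault hT x y
    IsFaultV _ _ _ _ = ⊥

    Edge-irrefl : ∀ x → ¬ Edge x x
    Edge-irrefl (grid y a b) (v , w , st) = ℕ.<-irrefl refl (step-< {y} {a} {b} {y} {a} {b} v w st)
    Edge-irrefl (side s (pad i τ)) (_ , inj₁ (_ , e)) = ℕ.1+n≢n (sym e)
    Edge-irrefl (side s (pad i τ)) (_ , inj₂ (e , _)) = ℕ.1+n≢n (sym e)
    Edge-irrefl (side s (arm h c τ)) (_ , _ , _ , e) = ℕ.1+n≢n (sym e)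
    Edge-irrefl (junk _) ()

    -- The potential of the whole network for a pair of hubs.

    module Replacement (u₁ u₂ : Fin r) (b₁ : Fin X) (θ₁ : Fin W) (b₂ : Fin X) (θ₂ : Fin W)
        (b₁-large : 0ℤ ≤ ⟦ b₁ ⟧ - + 4 * (R * Z)) (b₂-large : 0ℤ ≤ ⟦ b₂ ⟧ - + 4 * (R * Z)) where

      hS hT : Hub
      hS = u₁ , b₁ , θ₁
      hT = u₂ , b₂ , θ₂

      opaque
        N : ℤ
        N = + 65 * (R * R) + ⟦ u₁ ⟧ * ⟦ u₁ ⟧ + ⟦ u₂ ⟧ * ⟦ u₂ ⟧

        0≤N-65RR : 0ℤ ≤ N - + 65 * (R * R)
        0≤N-65RR = subst (0ℤ ≤_) (eq (+ 65 * (R * R)) (⟦ u₁ ⟧ * ⟦ u₁ ⟧) (⟦ u₂ ⟧ * ⟦ u₂ ⟧)) (0≤sq ⟦ u₁ ⟧ ⊕ 0≤sq ⟦ u₂ ⟧)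
          where
          eq : ∀ m v w → v + w ≡ m + v + w - m
          eq = solve-∀

        0<N : 0ℤ < N
        0<N = <-≤-trans (+<+ (s≤s z≤n)) (≤-slack {+ 1}
          (0≤+ {64} ⊗ (0≤+ {r} ⊗ 0≤+ {r}) ⊕ 0≤R-1 ⊗ (0≤+ {r} ⊕ 0≤+ {1}) ⊕ 0≤sq ⟦ u₁ ⟧ ⊕ 0≤sq ⟦ u₂ ⟧)
              (eq R ⟦ u₁ ⟧ ⟦ u₂ ⟧))
          where
          eq : ∀ r u t →
              + 65 * (r * r) + u * u + t * t ≡ + 1 + (+ 64 * (r * r) + (r - + 1) * (r + + 1) + u * u + t * t)
          eq = solve-∀

        -- The loss against N is at most 2R², so a step in the wrong direction still changes the
        -- potential by at most N when walked either way. The `+ 1` shows that walking a step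
        -- backwards is never tight.
        gap≤ : ∀ (v w : Fin r) →
          (⟦ v ⟧ - ⟦ u₁ ⟧) * (⟦ v ⟧ - ⟦ u₁ ⟧) + (⟦ w ⟧ - ⟦ u₂ ⟧) * (⟦ w ⟧ - ⟦ u₂ ⟧) + + 1 ≤ + 2 * N
        gap≤ v w = ≤-slack
          ((⟦ v ⟧≤ ⊕ 0≤⟦ u₁ ⟧) ⊗ (⟦ u₁ ⟧≤ ⊕ 0≤⟦ v ⟧) ⊕ (⟦ w ⟧≤ ⊕ 0≤⟦ u₂ ⟧) ⊗ (⟦ u₂ ⟧≤ ⊕ 0≤⟦ w ⟧)
            ⊕ 0≤+ {127} ⊗ (0≤+ {r} ⊗ 0≤+ {r}) ⊕ 0≤R-1 ⊗ (0≤+ {r} ⊕ 0≤+ {1}) ⊕ 0≤+ {2} ⊗ (0≤sq ⟦ u₁ ⟧ ⊕ 0≤sq ⟦ u₂ ⟧))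
          (eq R ⟦ v ⟧ ⟦ w ⟧ ⟦ u₁ ⟧ ⟦ u₂ ⟧)
          where
          eq : ∀ r v w u t → + 2 * (+ 65 * (r * r) + u * u + t * t) ≡ (v - u) * (v - u) + (w - t) * (w - t) + + 1 +
            ((r - v + u) * (r - u + v) + (r - w + t) * (r - t + w) + + 127 * (r * r) + (r - + 1) * (r + + 1) + + 2 *
                (u * u + t * t))
          eq = solve-∀

        slope-step : ∀ k p y a b v w →
          k + (y + (+ 65 * (R * R) - v * v - w * w) + + 2 * ⟦ u₁ ⟧ * (a + v) + + 2 * ⟦ u₂ ⟧ * (b + w) - p)
            ≡ k + (y + + 2 * ⟦ u₁ ⟧ * a + + 2 * ⟦ u₂ ⟧ * b - p) + N - ((v - ⟦ u₁ ⟧) * (v - ⟦ u₁ ⟧) + (w - ⟦ u₂ ⟧) *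
                (w - ⟦ u₂ ⟧))
        slope-step k p y a b v w = eq k p (+ 65 * (R * R)) ⟦ u₁ ⟧ ⟦ u₂ ⟧ v w y a b
          where
          eq : ∀ k p m u t v w y a b →
            k + (y + (m - v * v - w * w) + + 2 * u * (a + v) + + 2 * t * (b + w) - p)
              ≡ k + (y + + 2 * u * a + + 2 * t * b - p) + (m + u * u + t * t) - ((v - u) * (v - u) + (w - t) *
                  (w - t))
          eq = solve-∀

        slope-line : ∀ k q m b →
          k + (q + m * (+ 65 * (R * R) + ⟦ u₁ ⟧ * ⟦ u₁ ⟧ - ⟦ u₂ ⟧ * ⟦ u₂ ⟧) + + 2 * ⟦ u₂ ⟧ * (b + m * ⟦ u₂ ⟧) -
              (q + + 2 * ⟦ u₂ ⟧ * b)) ≡ k + m * N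
        slope-line k q m b = eq k q m (+ 65 * (R * R)) ⟦ u₁ ⟧ ⟦ u₂ ⟧ b
          where
          eq : ∀ k q m g u v b → k + (q + m * (g + u * u - v * v) + + 2 * v * (b + m * v) - (q + + 2 * v * b))
             ≡ k + m * (g + u * u + v * v)
          eq = solve-∀

      module PS = Potential 1≤r N ⟦ u₂ ⟧ hS 0≤N-65RR 0≤⟦ u₂ ⟧ ⟦ u₂ ⟧≤ b₁-large
      module PT = Potential 1≤r N ⟦ u₁ ⟧ hT 0≤N-65RR 0≤⟦ u₁ ⟧ ⟦ u₁ ⟧≤ b₂-large

      opaque
        unfolding mirrorX

        -- The constant that makes the two sides agree on the box, as `bulk-sum` states. For hubs
        -- that are joined by a line it is N times the length of the replacement path.
        total : ℤ
        total = PS.cap + PT.cap + + 2 * N - PS.origin - PT.origin + (+ 96 * (R * (R * Z)) - + 1)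
          + + 2 * (⟦ u₁ ⟧ + ⟦ u₂ ⟧) * (+ 8 * (R * Z) - + 1)

        -- The point reflection negates the linear part of Φ, and the exchange of a and b undoes the
        -- exchanged roles of `u₁` and `u₂` in `PT`.
        bulk-sum : ∀ y a b → total - PT.bulk (mirrorX b) (mirrorX a) (mirrorY y) ≡ PS.bulk a b y
        bulk-sum y a b = trans (cong (λ x → total - x) (PT.bulk≡ (mirrorX b) (mirrorX a) (mirrorY y)))
          (trans (eq PS.cap PT.cap N PS.origin PT.origin (+ 96 * (R * (R * Z)) - + 1) (+ 8 * (R * Z) - + 1) ⟦ u₁ ⟧
              ⟦ u₂ ⟧ y a b)
            (sym (PS.bulk≡ a b y)))
          where
          eq : ∀ k l n p q h w u v y a b →
            k + l + + 2 * n - p - q + h + + 2 * (u + v) * w -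
                (l + n + ((h - y) + + 2 * v * (w - b) + + 2 * u * (w - a) - q))
              ≡ k + n + (y + + 2 * u * a + + 2 * v * b - p)
          eq = solve-∀

      Ψ : Vertex → ℤ
      Ψ (grid y a b) = PS.bulk ⟦ a ⟧ ⟦ b ⟧ ⟦ y ⟧
      Ψ (side false x) = PS.level x
      Ψ (side true x) = total - PT.level x
      Ψ (junk _) = 0ℤ

      near-reflect : ∀ {x y} → Near N x y → Near N (total - x) (total - y)
      near-reflect {x} {y} (p , q) =
        ≤-slack (i≤j⇒0≤j-i q) (eq total x y N) , ≤-slack (i≤j⇒0≤j-i p) (eq total y x N)
        where
        eq : ∀ t x y n → t - x + n ≡ t - y + (y + n - x)
        eq = solve-∀

      bulk-step : ∀ {y a b y' a' b'} v w → Step y a b y' a' b' v w →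
        Ψ (grid y' a' b') ≡ Ψ (grid y a b) + N - ((⟦ v ⟧ - ⟦ u₁ ⟧) * (⟦ v ⟧ - ⟦ u₁ ⟧) + (⟦ w ⟧ - ⟦ u₂ ⟧) *
            (⟦ w ⟧ - ⟦ u₂ ⟧))
      bulk-step {y} {a} {b} {y'} {a'} {b'} v w (ea , eb , ey) = begin
        PS.bulk ⟦ a' ⟧ ⟦ b' ⟧ ⟦ y' ⟧ ≡⟨ cong₂ (λ x x' → PS.bulk x x' ⟦ y' ⟧) ea eb ⟩
        PS.bulk (⟦ a ⟧ + ⟦ v ⟧) (⟦ b ⟧ + ⟦ w ⟧) ⟦ y' ⟧ ≡⟨ cong (PS.bulk (⟦ a ⟧ + ⟦ v ⟧) (⟦ b ⟧ + ⟦ w ⟧)) ey ⟩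
        PS.bulk (⟦ a ⟧ + ⟦ v ⟧) (⟦ b ⟧ + ⟦ w ⟧) (⟦ y ⟧ + g) ≡⟨ PS.bulk≡ (⟦ a ⟧ + ⟦ v ⟧) (⟦ b ⟧ + ⟦ w ⟧) (⟦ y ⟧ + g) ⟩
        PS.cap + N + (⟦ y ⟧ + g + + 2 * ⟦ u₁ ⟧ * (⟦ a ⟧ + ⟦ v ⟧) + + 2 * ⟦ u₂ ⟧ * (⟦ b ⟧ + ⟦ w ⟧) - PS.origin)
          ≡⟨ slope-step (PS.cap + N) PS.origin ⟦ y ⟧ ⟦ a ⟧ ⟦ b ⟧ ⟦ v ⟧ ⟦ w ⟧ ⟩
        PS.cap + N + (⟦ y ⟧ + + 2 * ⟦ u₁ ⟧ * ⟦ a ⟧ + + 2 * ⟦ u₂ ⟧ * ⟦ b ⟧ - PS.origin) + N - s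
          ≡⟨ cong (λ x → x + N - s) (sym (PS.bulk≡ ⟦ a ⟧ ⟦ b ⟧ ⟦ y ⟧)) ⟩
        PS.bulk ⟦ a ⟧ ⟦ b ⟧ ⟦ y ⟧ + N - s ∎
        where
        open ≡-Reasoning
        g s : ℤ
        g = + 65 * (R * R) - ⟦ v ⟧ * ⟦ v ⟧ - ⟦ w ⟧ * ⟦ w ⟧
        s = (⟦ v ⟧ - ⟦ u₁ ⟧) * (⟦ v ⟧ - ⟦ u₁ ⟧) + (⟦ w ⟧ - ⟦ u₂ ⟧) * (⟦ w ⟧ - ⟦ u₂ ⟧)

      edge-near : ∀ x y → Edge x y → ¬ IsFaultV hS hT x y → Near N (Ψ x) (Ψ y)
      edge-near (grid y a b) (grid y' a' b') (v , w , st) _ = up , down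
        where
        g P Q : ℤ
        g = (⟦ v ⟧ - ⟦ u₁ ⟧) * (⟦ v ⟧ - ⟦ u₁ ⟧) + (⟦ w ⟧ - ⟦ u₂ ⟧) * (⟦ w ⟧ - ⟦ u₂ ⟧)
        P = Ψ (grid y a b)
        Q = Ψ (grid y' a' b')
        Q≡ : Q ≡ P + N - g
        Q≡ = bulk-step {y} {a} {b} {y'} {a'} {b'} v w st
        up : Q ≤ P + N
        up = ≤-slack (0≤sq (⟦ v ⟧ - ⟦ u₁ ⟧) ⊕ 0≤sq (⟦ w ⟧ - ⟦ u₂ ⟧))
            (trans (eq (P + N) g) (cong (λ x → x + g) (sym Q≡)))
          where
          eq : ∀ p g → p ≡ p - g + g
          eq = solve-∀
        down : P ≤ Q + N
        down = ≤-slack (i≤j⇒0≤j-i (gap≤ v w) ⊕ 0≤+ {1}) (trans (cong (λ x → x + N) Q≡) (eq P N g))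
          where
          eq : ∀ p n g → p + n - g + n ≡ p + (+ 2 * n - (g + + 1) + + 1)
          eq = solve-∀
      edge-near (side false (arm h c τ)) (grid y a b) d _ = PS.dock-near h c τ ⟦ a ⟧ ⟦ b ⟧ ⟦ y ⟧ d
      edge-near (side true (arm h c τ)) (grid y a b) d _ = subst (Near N (total - PT.level (arm h c τ)))
          (bulk-sum ⟦ y ⟧ ⟦ a ⟧ ⟦ b ⟧)
        (near-reflect (PT.dock-near h c τ (mirrorX ⟦ b ⟧) (mirrorX ⟦ a ⟧) (mirrorY ⟦ y ⟧) d))
      edge-near (side false x) (side .false y) (refl , l) nf = PS.link-near x y l nf
      edge-near (side true x) (side .true y) (refl , l) nf = near-reflect (PT.link-near x y l nf)

      -- The last equation follows y + 2u₁a, which the hub on the side of s fixes, instead of y; per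
      -- step it grows by (65R² - u₁² - u₂²) + 2u₁².
      OnLine : ℤ → ℕ → Fin Y → Fin X → Fin X → Set
      OnLine aₛ m y a b = ⟦ a ⟧ ≡ aₛ + + m * ⟦ u₁ ⟧ × ⟦ b ⟧ ≡ ⟦ b₁ ⟧ + + m * ⟦ u₂ ⟧
        × ⟦ y ⟧ + + 2 * ⟦ u₁ ⟧ * ⟦ a ⟧ ≡ + 16 * (R * (R * Z)) + ⟦ θ₁ ⟧ + + m * (+ 65 * (R * R) + ⟦ u₁ ⟧ * ⟦ u₁
            ⟧ - ⟦ u₂ ⟧ * ⟦ u₂ ⟧)

      line-bulk : ∀ m (y : Fin Y) (a b : Fin X) → ⟦ b ⟧ ≡ ⟦ b₁ ⟧ + + m * ⟦ u₂ ⟧ →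
        ⟦ y ⟧ + + 2 * ⟦ u₁ ⟧ * ⟦ a ⟧ ≡ + 16 * (R * (R * Z)) + ⟦ θ₁ ⟧ + + m * (+ 65 * (R * R) + ⟦ u₁ ⟧ * ⟦ u₁ ⟧ - ⟦ u₂
            ⟧ * ⟦ u₂ ⟧) →
        PS.bulk ⟦ a ⟧ ⟦ b ⟧ ⟦ y ⟧ ≡ PS.cap + N + + m * N
      line-bulk m y a b eb ey = begin
        PS.bulk ⟦ a ⟧ ⟦ b ⟧ ⟦ y ⟧ ≡⟨ PS.bulk≡ ⟦ a ⟧ ⟦ b ⟧ ⟦ y ⟧ ⟩
        PS.cap + N + (⟦ y ⟧ + + 2 * ⟦ u₁ ⟧ * ⟦ a ⟧ + + 2 * ⟦ u₂ ⟧ * ⟦ b ⟧ - PS.origin)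
          ≡⟨ cong₂ (λ p q → PS.cap + N + (p + + 2 * ⟦ u₂ ⟧ * q - PS.origin)) ey eb ⟩
        PS.cap + N + (q + + m * g + + 2 * ⟦ u₂ ⟧ * (⟦ b₁ ⟧ + + m * ⟦ u₂ ⟧) - PS.origin)
          ≡⟨ cong (λ x → PS.cap + N + (q + + m * g + + 2 * ⟦ u₂ ⟧ * (⟦ b₁ ⟧ + + m * ⟦ u₂ ⟧) - x)) PS.origin≡ ⟩
        PS.cap + N + (q + + m * g + + 2 * ⟦ u₂ ⟧ * (⟦ b₁ ⟧ + + m * ⟦ u₂ ⟧) - (q + + 2 * ⟦ u₂ ⟧ * ⟦ b₁ ⟧))
          ≡⟨ slope-line (PS.cap + N) q (+ m) ⟦ b₁ ⟧ ⟩
        PS.cap + N + + m * N ∎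
        where
        open ≡-Reasoning
        q g : ℤ
        q = + 16 * (R * (R * Z)) + ⟦ θ₁ ⟧
        g = + 65 * (R * R) + ⟦ u₁ ⟧ * ⟦ u₁ ⟧ - ⟦ u₂ ⟧ * ⟦ u₂ ⟧

      -- Tight steps that avoid one edge of the line.

      module Critical (aₛ : ℤ) (k mₑ : ℕ) (mₑ<k : mₑ ℕ.< k)
          (yₑ : Fin Y) (aₑ bₑ : Fin X) (y⁺ : Fin Y) (a⁺ b⁺ : Fin X)
          (online : OnLine aₛ mₑ yₑ aₑ bₑ) (step : Step yₑ aₑ bₑ y⁺ a⁺ b⁺ u₁ u₂)
          (end : aₛ + + k * ⟦ u₁ ⟧ ≡ mirrorX ⟦ b₂ ⟧) (total≡ : total ≡ PS.cap + PT.cap + + 2 * N + + k * N) where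

        -- Contains everything that tight steps other than the critical one reach from s.
        Reached : Vertex → Set
        Reached (grid y a b) = ∃ λ m → ⟦ b ⟧ ≡ ⟦ b₁ ⟧ + + m * ⟦ u₂ ⟧
          × ⟦ y ⟧ + + 2 * ⟦ u₁ ⟧ * ⟦ a ⟧ ≡ + 16 * (R * (R * Z)) + ⟦ θ₁ ⟧ + + m * (+ 65 * (R * R) + ⟦ u₁ ⟧ * ⟦ u₁
              ⟧ - ⟦ u₂ ⟧ * ⟦ u₂ ⟧)
          × (⟦ a ⟧ ≡ aₛ + + m * ⟦ u₁ ⟧ → m ℕ.≤ mₑ)
        Reached (side false _) = ⊤
        Reached (side true _) = ⊥
        Reached (junk _) = ⊥

        Used : Vertex → Vertex → Set
        Used x y = x ≡ grid yₑ aₑ bₑ × y ≡ grid y⁺ a⁺ b⁺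

        reached-dock : ∀ c τ y a b → Dock hS c τ ⟦ a ⟧ ⟦ b ⟧ ⟦ y ⟧ → Reached (grid y a b)
        reached-dock c τ y a b (_ , b≡ , e , _) = 0 , trans b≡ (sym (+-identityʳ ⟦ b₁ ⟧)) , trans e
            (sym (+-identityʳ _)) , λ _ → z≤n

        -- The hub on the side of s leaves a free, so `Reached` is a family of parallel lines. A
        -- point attached to `hT` has the value of Φ that forces m = k, and its a is that of the
        -- critical line; but on that line m stops at mₑ < k.
        not-reached : ∀ c τ y a b → DockAt true hT c τ ⟦ y ⟧ ⟦ a ⟧ ⟦ b ⟧ → ¬ Reached (grid y a b)
        not-reached c τ y a b d (m , eb , ey , before) = ℕ.<⇒≱ mₑ<k (subst (ℕ._≤ mₑ) m≡k (before a≡))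
          where
          open ≡-Reasoning
          mN≡kN : + m * N ≡ + k * N
          mN≡kN = ∙-cancelˡ (PS.cap + N) (+ m * N) (+ k * N) (begin
            PS.cap + N + + m * N  ≡⟨ sym (line-bulk m y a b eb ey) ⟩
            PS.bulk ⟦ a ⟧ ⟦ b ⟧ ⟦ y ⟧ ≡⟨ sym (bulk-sum ⟦ y ⟧ ⟦ a ⟧ ⟦ b ⟧) ⟩
            total - PT.bulk (mirrorX ⟦ b ⟧) (mirrorX ⟦ a ⟧) (mirrorY ⟦ y ⟧)
              ≡⟨ cong₂ _-_ total≡ (PT.dock-tip c τ (mirrorX ⟦ b ⟧) (mirrorX ⟦ a ⟧) (mirrorY ⟦ y ⟧) d) ⟩
            PS.cap + PT.cap + + 2 * N + + k * N - (PT.cap + N) ≡⟨ eq PS.cap PT.cap N (+ k) ⟩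
            PS.cap + N + + k * N ∎)
            where
            eq : ∀ p q n k → p + q + + 2 * n + k * n - (q + n) ≡ p + n + k * n
            eq = solve-∀
          m≡k : m ≡ k
          m≡k = +-injective (*-cancelʳ-≡ (+ m) (+ k) N {{>-nonZero 0<N}} mN≡kN)
          a≡ : ⟦ a ⟧ ≡ aₛ + + m * ⟦ u₁ ⟧
          a≡ = begin
            ⟦ a ⟧                    ≡⟨ sym (mirrorX-involutive ⟦ a ⟧) ⟩
            mirrorX (mirrorX ⟦ a ⟧)  ≡⟨ cong mirrorX (proj₁ (proj₂ d)) ⟩
            mirrorX ⟦ b₂ ⟧           ≡⟨ sym end ⟩
            aₛ + + k * ⟦ u₁ ⟧        ≡⟨ cong (λ i → aₛ + + i * ⟦ u₁ ⟧) (sym m≡k) ⟩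
            aₛ + + m * ⟦ u₁ ⟧        ∎

        tight-direction : ∀ y a b y' a' b' v w → Step y a b y' a' b' v w → Ψ (grid y' a' b') ≡ Ψ (grid y a b) + N →
            v ≡ u₁ × w ≡ u₂
        tight-direction y a b y' a' b' v w st e =
          ⟦⟧-injective (diff (sq≡0 (⟦ v ⟧ - ⟦ u₁ ⟧) (proj₁ zeros))) , ⟦⟧-injective
              (diff (sq≡0 (⟦ w ⟧ - ⟦ u₂ ⟧) (proj₂ zeros)))
          where
          P = Ψ (grid y a b) + N
          g₁ = (⟦ v ⟧ - ⟦ u₁ ⟧) * (⟦ v ⟧ - ⟦ u₁ ⟧)
          g₂ = (⟦ w ⟧ - ⟦ u₂ ⟧) * (⟦ w ⟧ - ⟦ u₂ ⟧)
          eq : ∀ p g → p - (p - g) ≡ g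
          eq = solve-∀
          eq′ : ∀ p → p - p ≡ 0ℤ
          eq′ = solve-∀
          g≡0 : g₁ + g₂ ≡ 0ℤ
          g≡0 = trans (sym (eq P (g₁ + g₂)))
              (trans (cong (λ x → P - x) (trans (sym (bulk-step {y} {a} {b} {y'} {a'} {b'} v w st)) e)) (eq′ P))
          zeros = sum≡0 (0≤sq (⟦ v ⟧ - ⟦ u₁ ⟧)) (0≤sq (⟦ w ⟧ - ⟦ u₂ ⟧)) g≡0
          diff : ∀ {p q} → p - q ≡ 0ℤ → p ≡ q
          diff {p} {q} e = i-j≡0⇒i≡j p q e

        -- A step in this direction keeps a point on or off the critical line. So the bound on m can
        -- fail only at position `mₑ` of that line, where the step is the critical edge itself.
        reached-step : ∀ y a b y' a' b' → Step y a b y' a' b' u₁ u₂ → Reached (grid y a b) →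
          Reached (grid y' a' b') ⊎ Used (grid y a b) (grid y' a' b')
        reached-step y a b y' a' b' (ea , eb , ey) (m , b≡ , y≡ , before) = cases (⟦ a ⟧ ≟ aₛ + + m * ⟦ u₁ ⟧)
            (m ℕ.≟ mₑ)
          where
          eq-b : ∀ b m u → b + m * u + u ≡ b + (+ 1 + m) * u
          eq-b = solve-∀
          eq-y : ∀ y a u v g → y + (g - u * u - v * v) + + 2 * u * (a + u) ≡ y + + 2 * u * a + (g + u * u - v * v)
          eq-y = solve-∀
          pull-back : ⟦ a' ⟧ ≡ aₛ + + suc m * ⟦ u₁ ⟧ → ⟦ a ⟧ ≡ aₛ + + m * ⟦ u₁ ⟧
          pull-back e = ∙-cancelʳ ⟦ u₁ ⟧ ⟦ a ⟧ (aₛ + + m * ⟦ u₁ ⟧)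
              (trans (sym ea) (trans e (sym (eq-b aₛ (+ m) ⟦ u₁ ⟧))))
          advance : (⟦ a ⟧ ≡ aₛ + + m * ⟦ u₁ ⟧ → m ≢ mₑ) → Reached (grid y' a' b')
          advance ne = suc m ,
            trans eb (trans (cong (λ x → x + ⟦ u₂ ⟧) b≡) (eq-b ⟦ b₁ ⟧ (+ m) ⟦ u₂ ⟧)) ,
            trans (cong₂ (λ p q → p + + 2 * ⟦ u₁ ⟧ * q) ey ea)
              (trans (eq-y ⟦ y ⟧ ⟦ a ⟧ ⟦ u₁ ⟧ ⟦ u₂ ⟧ (+ 65 * (R * R)))
              (trans (cong (λ x → x + (+ 65 * (R * R) + ⟦ u₁ ⟧ * ⟦ u₁ ⟧ - ⟦ u₂ ⟧ * ⟦ u₂ ⟧)) y≡)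
                (eq-b (+ 16 * (R * (R * Z)) + ⟦ θ₁ ⟧) (+ m) (+ 65 * (R * R) + ⟦ u₁ ⟧ * ⟦ u₁ ⟧ - ⟦ u₂ ⟧ * ⟦ u₂ ⟧)))) ,
            λ e → ℕ.≤∧≢⇒< (before (pull-back e)) (ne (pull-back e))
          cases : Dec (⟦ a ⟧ ≡ aₛ + + m * ⟦ u₁ ⟧) → Dec (m ≡ mₑ) → Reached (grid y' a' b') ⊎ Used (grid y a b)
              (grid y' a' b')
          cases (no a≢) _ = inj₁ (advance λ e → contradiction e a≢)
          cases (yes _) (no m≢) = inj₁ (advance λ _ → m≢)
          cases (yes a≡) (yes refl) = inj₂ (grid-≡ yy aa bb , grid-≡
              (trans ey (trans (cong (λ x → x + (+ 65 * (R * R) - ⟦ u₁ ⟧ * ⟦ u₁ ⟧ - ⟦ u₂ ⟧ * ⟦ u₂ ⟧)) yy)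
                  (sym (proj₂ (proj₂ step)))))
              (trans ea (trans (cong (λ x → x + ⟦ u₁ ⟧) aa) (sym (proj₁ step))))
              (trans eb (trans (cong (λ x → x + ⟦ u₂ ⟧) bb) (sym (proj₁ (proj₂ step))))))
            where
            aa : ⟦ a ⟧ ≡ ⟦ aₑ ⟧
            aa = trans a≡ (sym (proj₁ online))
            bb : ⟦ b ⟧ ≡ ⟦ bₑ ⟧
            bb = trans b≡ (sym (proj₁ (proj₂ online)))
            yy : ⟦ y ⟧ ≡ ⟦ yₑ ⟧
            yy = ∙-cancelʳ (+ 2 * ⟦ u₁ ⟧ * ⟦ a ⟧) ⟦ y ⟧ ⟦ yₑ ⟧
              (trans y≡ (trans (sym (proj₂ (proj₂ online))) (cong (λ x → ⟦ yₑ ⟧ + + 2 * ⟦ u₁ ⟧ * x) (sym aa))))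

        no-tight-retreat : ∀ y a b y' a' b' v w → Step y a b y' a' b' v w → Ψ (grid y a b) ≢ Ψ (grid y' a' b') + N
        no-tight-retreat y a b y' a' b' v w st e = <⇒≱ (suc[i]≤j⇒i<j ≤-refl) (≤-trans (≤-reflexive (eq g))
            (subst (λ x → g + + 1 ≤ x) 2N≡g (gap≤ v w)))
          where
          g = (⟦ v ⟧ - ⟦ u₁ ⟧) * (⟦ v ⟧ - ⟦ u₁ ⟧) + (⟦ w ⟧ - ⟦ u₂ ⟧) * (⟦ w ⟧ - ⟦ u₂ ⟧)
          P Q : ℤ
          P = Ψ (grid y a b)
          Q = Ψ (grid y' a' b')
          eq : ∀ g → + 1 + g ≡ g + + 1
          eq = solve-∀
          eq₁ : ∀ p n g → + 2 * n ≡ (p + n - g) + n - p + g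
          eq₁ = solve-∀
          eq₂ : ∀ p g → p - p + g ≡ g
          eq₂ = solve-∀
          2N≡g : + 2 * N ≡ g
          2N≡g = trans (eq₁ P N g)
              (trans (cong (λ x → x + N - P + g) (sym (bulk-step {y} {a} {b} {y'} {a'} {b'} v w st)))
            (trans (cong (λ x → x - P + g) (sym e)) (eq₂ P g)))

        -- A tight step into the side of t becomes a tight step out of it in terms of `PT`, the form
        -- that `PT.dock-tight` expects.
        tight-mirror : ∀ y a b l → total - l ≡ Ψ (grid y a b) + N → PT.bulk (mirrorX ⟦ b ⟧) (mirrorX ⟦ a ⟧)
            (mirrorY ⟦ y ⟧) ≡ l + N
        tight-mirror y a b l t = trans (eq total p l N) (trans (cong (λ x → l + N + (x - (total - p + N)))
            (trans t (cong (λ x → x + N) (sym (bulk-sum ⟦ y ⟧ ⟦ a ⟧ ⟦ b ⟧))))) (eq′ (l + N) (total - p + N)))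
          where
          p = PT.bulk (mirrorX ⟦ b ⟧) (mirrorX ⟦ a ⟧) (mirrorY ⟦ y ⟧)
          eq : ∀ t p l n → p ≡ l + n + (t - l - (t - p + n))
          eq = solve-∀
          eq′ : ∀ l p → l + (p - p) ≡ l
          eq′ = solve-∀

        reached-dock′ : ∀ {h} → h ≡ hS → ∀ c τ y a b → Dock h c τ ⟦ a ⟧ ⟦ b ⟧ ⟦ y ⟧ → Reached (grid y a b)
        reached-dock′ refl = reached-dock

        not-reached′ : ∀ {h} → h ≡ hT → ∀ c τ y a b → DockAt true h c τ ⟦ y ⟧ ⟦ a ⟧ ⟦ b ⟧ → ¬ Reached (grid y a b)
        not-reached′ refl = not-reached

        reached-step′ : ∀ y a b y' a' b' {v w} → v ≡ u₁ × w ≡ u₂ → Step y a b y' a' b' v w → Reached (grid y a b) →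
          Reached (grid y' a' b') ⊎ Used (grid y a b) (grid y' a' b')
        reached-step′ y a b y' a' b' (refl , refl) = reached-step y a b y' a' b'

        closed-forward : ∀ x y → Edge x y → Ψ y ≡ Ψ x + N → Reached x → Reached y ⊎ Used x y
        closed-forward (grid y a b) (grid y' a' b') (v , w , st) t c =
          reached-step′ y a b y' a' b' (tight-direction y a b y' a' b' v w st t) st c
        closed-forward (side false (arm h c τ)) (grid y a b) d t _ =
          inj₁ (reached-dock′ (PS.dock-tight h c τ ⟦ a ⟧ ⟦ b ⟧ ⟦ y ⟧ d t) c τ y a b d)
        closed-forward (side false x) (side s y) (refl , _) _ _ = inj₁ tt

        closed-backward : ∀ x y → Edge y x → Ψ y ≡ Ψ x + N → Reached x → Reached y ⊎ Used x y
        closed-backward (grid y a b) (grid y' a' b') (v , w , st) t _ = contradiction t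
            (no-tight-retreat y' a' b' y a b v w st)
        closed-backward (grid y a b) (side false (arm h c τ)) _ _ _ = inj₁ tt
        closed-backward (grid y a b) (side true (arm h c τ)) d t reached =
          contradiction reached (not-reached′ (PT.dock-tight h c τ (mirrorX ⟦ b ⟧) (mirrorX ⟦ a ⟧) (mirrorY ⟦ y ⟧) d
            (tight-mirror y a b (PT.level (arm h c τ)) t)) c τ y a b d)
        closed-backward (side false x) (side s y) (refl , _) _ _ = inj₁ tt

        closed : ∀ x y → Edge x y ⊎ Edge y x → Ψ y ≡ Ψ x + N → Reached x → Reached y ⊎ Used x y
        closed x y (inj₁ e) = closed-forward x y e
        closed x y (inj₂ e) = closed-backward x y e

  -- Walks and their rise in potential.

  module _ {n : ℕ} {R : Fin n → Fin n → Set} where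

    _++ʷ_ : ∀ {u v w k l} → Walk R u v k → Walk R v w l → Walk R u w (k ℕ.+ l)
    nil ++ʷ q = q
    cons e p ++ʷ q = cons e (p ++ʷ q)

    reverseʷ : (∀ {u v} → R u v → R v u) → ∀ {u v k} → Walk R u v k → Walk R v u k
    reverseʷ sy nil = nil
    reverseʷ sy {k = suc k} (cons e p) = subst (Walk R _ _) (ℕ.+-comm k 1) (reverseʷ sy p ++ʷ cons (sy e) nil)

    walk-along : (f : ℕ → Fin n) → ∀ k → (∀ m → m ℕ.< k → R (f m) (f (suc m))) → Walk R (f 0) (f k) k
    walk-along f zero _ = nil
    walk-along f (suc k) e = cons (e 0 (s≤s z≤n)) (walk-along (λ m → f (suc m)) k (λ m m<k → e (suc m) (s≤s m<k)))

    module _ (φ : Fin n → ℤ) (N : ℤ) (bounded : ∀ {u v} → R u v → φ v ≤ φ u + N) where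

      walk-rise : ∀ {u v k} → Walk R u v k → φ v ≤ φ u + N * + k
      walk-rise {u} nil = ≤-reflexive (sym (trans (cong (λ x → φ u + x) (*-zeroʳ N)) (+-identityʳ (φ u))))
      walk-rise {u} {v} {suc k} (cons {v = w} e p) = ≤-trans (walk-rise p) (≤-trans (+-monoˡ-≤ (N * + k) (bounded e))
        (≤-reflexive (eq (φ u) N (+ k))))
        where
        eq : ∀ x n k → x + n + n * k ≡ x + n * (+ 1 + k)
        eq = solve-∀

      first-step-tight : ∀ {u v w k} → R u v → Walk R v w k → φ u + N * + suc k ≤ φ w → φ v ≡ φ u + N
      first-step-tight {u} {v} {w} {k} e p h = ≤-antisym (bounded e)
        (subst₂ _≤_ (eq (φ u) N (+ k)) (eq′ (φ v) (N * + k)) (+-monoˡ-≤ (- (N * + k)) (≤-trans h (walk-rise p))))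
        where
        eq : ∀ x n k → x + n * (+ 1 + k) + - (n * k) ≡ x + n
        eq = solve-∀
        eq′ : ∀ x y → x + y + - y ≡ x
        eq′ = solve-∀

      -- Since the walk rises as much as its length permits, no step may fall short; hence closure
      -- under tight steps suffices to carry `P` along.
      tight-walk : (P : Fin n → Set) (Goal : Set) → (∀ {u v} → R u v → φ v ≡ φ u + N → P u → P v ⊎ Goal) →
        ∀ {u v k} → Walk R u v k → φ u + N * + k ≤ φ v → P u → P v ⊎ Goal
      tight-walk P Goal closed nil _ p = inj₁ p
      tight-walk P Goal closed {u} {v} {suc k} (cons {v = w} e q) h p with closed e (first-step-tight e q h) p
      ... | inj₂ g = inj₂ g
      ... | inj₁ p' = tight-walk P Goal closed q
              (≤-trans (≤-reflexive (trans (cong (λ x → x + N * + k) (first-step-tight e q h)) (eq (φ u) N (+ k)))) h)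
                  p'
        where
        eq : ∀ x n k → x + n + n * k ≡ x + n * (+ 1 + k)
        eq = solve-∀

  -- Numbering the vertices.

  module Encoding (r z : ℕ) (1≤r : 1 ℕ.≤ r) (junks : ℕ) where
    open Sizes r z
    open Network r z 1≤r junks

    SideCode VertexCode : Set
    SideCode = (Fin (2 ℕ.* σ) × Fin (8 ℕ.* σ)) ⊎ (((Fin r × Fin X) × Fin W) × (Fin B × Fin T))
    VertexCode = (Fin Y × (Fin X × Fin X)) ⊎ ((SideCode ⊎ SideCode) ⊎ Fin junks)

    sideSize size : ℕ
    sideSize = 2 ℕ.* σ ℕ.* (8 ℕ.* σ) ℕ.+ σ ℕ.* (B ℕ.* T)
    size = Y ℕ.* (X ℕ.* X) ℕ.+ ((sideSize ℕ.+ sideSize) ℕ.+ junks)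

    sideCode : Fin sideSize ↔ SideCode
    sideCode = (Fin.*↔× ⊎-↔ (((Fin.*↔× ×-↔ ↔-id _) ↔-∘ Fin.*↔×) ×-↔ Fin.*↔×) ↔-∘ Fin.*↔×) ↔-∘ Fin.+↔⊎

    vertexCode : Fin size ↔ VertexCode
    vertexCode = (((↔-id _ ×-↔ Fin.*↔×) ↔-∘ Fin.*↔×) ⊎-↔ (((sideCode ⊎-↔ sideCode) ↔-∘ Fin.+↔⊎) ⊎-↔ ↔-id _) ↔-∘
        Fin.+↔⊎) ↔-∘ Fin.+↔⊎

    toSide : SideCode → Side
    toSide (inj₁ (i , τ)) = pad i τ
    toSide (inj₂ (((u , b) , θ) , (c , τ))) = arm (u , b , θ) c τ

    fromSide : Side → SideCode
    fromSide (pad i τ) = inj₁ (i , τ)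
    fromSide (arm (u , b , θ) c τ) = inj₂ (((u , b) , θ) , (c , τ))

    toVertex : VertexCode → Vertex
    toVertex (inj₁ (y , a , b)) = grid y a b
    toVertex (inj₂ (inj₁ (inj₁ x))) = side false (toSide x)
    toVertex (inj₂ (inj₁ (inj₂ x))) = side true (toSide x)
    toVertex (inj₂ (inj₂ j)) = junk j

    fromVertex : Vertex → VertexCode
    fromVertex (grid y a b) = inj₁ (y , a , b)
    fromVertex (side false x) = inj₂ (inj₁ (inj₁ (fromSide x)))
    fromVertex (side true x) = inj₂ (inj₁ (inj₂ (fromSide x)))
    fromVertex (junk j) = inj₂ (inj₂ j)

    to∘from-side : ∀ x → toSide (fromSide x) ≡ x
    to∘from-side (pad i τ) = refl
    to∘from-side (arm h c τ) = refl

    from∘to-side : ∀ x → fromSide (toSide x) ≡ x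
    from∘to-side (inj₁ _) = refl
    from∘to-side (inj₂ _) = refl

    to∘from : ∀ x → toVertex (fromVertex x) ≡ x
    to∘from (grid y a b) = refl
    to∘from (side false x) = cong (side false) (to∘from-side x)
    to∘from (side true x) = cong (side true) (to∘from-side x)
    to∘from (junk j) = refl

    from∘to : ∀ x → fromVertex (toVertex x) ≡ x
    from∘to (inj₁ _) = refl
    from∘to (inj₂ (inj₁ (inj₁ x))) = cong (λ y → inj₂ (inj₁ (inj₁ y))) (from∘to-side x)
    from∘to (inj₂ (inj₁ (inj₂ x))) = cong (λ y → inj₂ (inj₁ (inj₂ y))) (from∘to-side x)
    from∘to (inj₂ (inj₂ _)) = refl

    opaque
      enc : Vertex → Fin size
      enc x = Inverse.from vertexCode (fromVertex x)

      dec : Fin size → Vertex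
      dec i = toVertex (Inverse.to vertexCode i)

      dec∘enc : ∀ x → dec (enc x) ≡ x
      dec∘enc x = trans (cong toVertex (Inverse.strictlyInverseˡ vertexCode (fromVertex x))) (to∘from x)

      enc∘dec : ∀ i → enc (dec i) ≡ i
      enc∘dec i = trans (cong (Inverse.from vertexCode) (from∘to (Inverse.to vertexCode i)))
          (Inverse.strictlyInverseʳ vertexCode i)

      enc-injective : ∀ {x y} → enc x ≡ enc y → x ≡ y
      enc-injective {x} {y} e = trans (sym (dec∘enc x)) (trans (cong dec e) (dec∘enc y))

      -- `edgeCount` counts a pair only in increasing order of the codes; y is the leading digit of
      -- the code of a box point, so box edges are counted at their starts.
      enc-grid-< : ∀ {y a b y' a' b'} → y Fin.< y' → enc (grid y a b) Fin.< enc (grid y' a' b')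
      enc-grid-< {y} {a} {b} {y'} {a'} {b'} y< = subst₂ ℕ._<_
        (sym (Fin.toℕ-↑ˡ (combine y (combine a b)) _)) (sym (Fin.toℕ-↑ˡ (combine y' (combine a' b')) _))
        (Fin.combine-monoˡ-< (combine a b) (combine a' b') y<)

    Adjacent : Vertex → Vertex → Set
    Adjacent x y = Edge x y ⊎ Edge y x

    adjacent? : ∀ x y → Dec (Adjacent x y)
    adjacent? x y = Edge? x y ⊎-dec Edge? y x

    adjacent-sym : ∀ x y → does (adjacent? x y) ≡ does (adjacent? y x)
    adjacent-sym x y = Bool.∨-comm (does (Edge? x y)) (does (Edge? y x))

    network : Graph size
    network = record
      { adj = λ i j → does (adjacent? (dec i) (dec j))
      ; sym = λ i j → adjacent-sym (dec i) (dec j)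
      ; irrefl = λ i → dec-false (adjacent? (dec i) (dec i)) λ { (inj₁ e) → Edge-irrefl (dec i) e ; (inj₂ e) →
          Edge-irrefl (dec i) e }
      }

    adj⇒Adjacent : ∀ i j → adj network i j ≡ true → Adjacent (dec i) (dec j)
    adj⇒Adjacent i j = witness (adjacent? (dec i) (dec j))
      where
      witness : ∀ {A : Set} (d : Dec A) → does d ≡ true → A
      witness (yes p) _ = p

    Adjacent⇒adj : ∀ x y → Adjacent x y → adj network (enc x) (enc y) ≡ true
    Adjacent⇒adj x y p = trans (cong₂ (λ v w → does (adjacent? v w)) (dec∘enc x) (dec∘enc y))
        (dec-true (adjacent? x y) p)

  -- Out-of-range arguments are sent to 0.
  opaque
    pin : ∀ {n} → 0 ℕ.< n → ℕ → Fin n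
    pin {n} 0<n m with m ℕ.<? n
    ... | yes m<n = fromℕ< m<n
    ... | no _ = fromℕ< 0<n

    toℕ-pin : ∀ {n} (0<n : 0 ℕ.< n) {m} → m ℕ.< n → toℕ (pin 0<n m) ≡ m
    toℕ-pin {n} 0<n {m} m<n with m ℕ.<? n
    ... | yes p = Fin.toℕ-fromℕ< p
    ... | no ¬p = contradiction m<n ¬p

  -- The two faults and the surviving edges.

  module Faults (r z : ℕ) (1≤r : 1 ℕ.≤ r) (junks : ℕ) (5≤z : 5 ℕ.≤ z) where
    open Sizes r z
    open Network r z 1≤r junks
    open Encoding r z 1≤r junks

    0<z : 0 ℕ.< z
    0<z = ℕ.≤-trans (s≤s z≤n) 5≤z

    0<rz : 0 ℕ.< r ℕ.* z
    0<rz = ℕ.*-mono-< {0} {r} 1≤r 0<z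

    0<X : 0 ℕ.< X
    0<X = subst (0 ℕ.<_) (sym X≡) (ℕ.*-mono-< {0} {8} (s≤s z≤n) 0<rz)

    0<Y : 0 ℕ.< Y
    0<Y = subst (0 ℕ.<_) (sym Y≡) (ℕ.*-mono-< {0} {96} (s≤s z≤n) (ℕ.*-mono-< {0} {r} 1≤r 0<rz))

    0<W : 0 ℕ.< W
    0<W = subst (0 ℕ.<_) (sym W≡) (ℕ.*-mono-< {0} {66} (s≤s z≤n) (ℕ.*-mono-< {0} {r} 1≤r 1≤r))

    0<σ : 0 ℕ.< σ
    0<σ = ℕ.*-mono-< {0} {r ℕ.* X} (ℕ.*-mono-< {0} {r} 1≤r 0<X) 0<W

    K<T : z ℕ.+ 2 ℕ.< T
    K<T = subst (z ℕ.+ 2 ℕ.<_) (sym T≡)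
        (ℕ.+-monoʳ-< z (ℕ.≤-trans (s≤s (s≤s (s≤s z≤n))) (ℕ.≤-trans 5≤z (ℕ.m≤m+n z _))))

    0<2σ : 0 ℕ.< 2 ℕ.* σ
    0<2σ = ℕ.*-mono-< {0} {2} (s≤s z≤n) 0<σ

    0<8σ : 0 ℕ.< 8 ℕ.* σ
    0<8σ = ℕ.*-mono-< {0} {8} (s≤s z≤n) 0<σ

    padAt : Bool → ℕ → ℕ → Vertex
    padAt s i τ = side s (pad (pin 0<2σ i) (pin 0<8σ τ))

    source sink : Fin size
    source = enc (padAt false 0 0)
    sink = enc (padAt true 0 0)

    -- The spine edge behind the last hub ends in column σ, one beyond the columns of hubs; the
    -- doubled width makes room for it.
    i≤σ⇒i<2σ : ∀ {i} → i ℕ.≤ σ → i ℕ.< 2 ℕ.* σ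
    i≤σ⇒i<2σ {i} p = ℕ.<-≤-trans (ℕ.m<m+n i 0<σ) (ℕ.+-mono-≤ p (ℕ.m≤m+n σ 0))

    τ≤4σ⇒τ<8σ : ∀ {τ} → τ ℕ.≤ 4 ℕ.* σ → τ ℕ.< 8 ℕ.* σ
    τ≤4σ⇒τ<8σ p = ℕ.≤-<-trans p (ℕ.*-monoˡ-< σ {{ℕ.>-nonZero 0<σ}} {4} {8} (s≤s (s≤s (s≤s (s≤s (s≤s z≤n))))))

    module _ (hS hT : Hub) where

      hubOf : Bool → Hub
      hubOf false = hS
      hubOf true = hT

      faultEdge : Bool → Fin size × Fin size
      faultEdge s = enc (padAt s i (4 ℕ.* i)) , enc (padAt s (suc i) (4 ℕ.* suc i))
        where i = index (hubOf s)

      faults : EdgeList size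
      faults = faultEdge false ∷ faultEdge true ∷ []

      IsFault⇒≡ : ∀ s x y → IsFault (hubOf s) x y →
        side s x ≡ padAt s (index (hubOf s)) (4 ℕ.* index (hubOf s)) ×
        side s y ≡ padAt s (suc (index (hubOf s))) (4 ℕ.* suc (index (hubOf s)))
      IsFault⇒≡ s (pad i τ) (pad i' τ') (e₁ , e₂ , e₃ , e₄) =
        cong₂ (λ j k → side s (pad j k)) (at 0<2σ e₁ (i≤σ⇒i<2σ (ℕ.<⇒≤ i<σ)))
            (at 0<8σ e₂ (τ≤4σ⇒τ<8σ (ℕ.*-monoʳ-≤ 4 (ℕ.<⇒≤ i<σ)))) ,
        cong₂ (λ j k → side s (pad j k)) (at 0<2σ e₃ (i≤σ⇒i<2σ i<σ)) (at 0<8σ e₄ (τ≤4σ⇒τ<8σ (ℕ.*-monoʳ-≤ 4 i<σ)))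
        where
        i<σ : index (hubOf s) ℕ.< σ
        i<σ = Fin.toℕ<n (hubIndex (hubOf s))
        at : ∀ {n} (0<n : 0 ℕ.< n) {j : Fin n} {m} → toℕ j ≡ m → m ℕ.< n → j ≡ pin 0<n m
        at 0<n e m<n = Fin.toℕ-injective (trans e (sym (toℕ-pin 0<n m<n)))

      faultEdge-IsFault : ∀ s → IsFault (hubOf s)
        (pad (pin 0<2σ (index (hubOf s))) (pin 0<8σ (4 ℕ.* index (hubOf s))))
        (pad (pin 0<2σ (suc (index (hubOf s)))) (pin 0<8σ (4 ℕ.* suc (index (hubOf s)))))
      faultEdge-IsFault s = toℕ-pin 0<2σ (i≤σ⇒i<2σ (ℕ.<⇒≤ i<σ)) , toℕ-pin 0<8σ (τ≤4σ⇒τ<8σ (ℕ.*-monoʳ-≤ 4 (ℕ.<⇒≤ i<σ)))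
          ,
        toℕ-pin 0<2σ (i≤σ⇒i<2σ i<σ) , toℕ-pin 0<8σ (τ≤4σ⇒τ<8σ (ℕ.*-monoʳ-≤ 4 i<σ))
        where
        i<σ : index (hubOf s) ℕ.< σ
        i<σ = Fin.toℕ<n (hubIndex (hubOf s))

      IsFaultV⇒∈ : ∀ x y → IsFaultV hS hT x y → (enc x , enc y) ∈ faults
      IsFaultV⇒∈ (side false x) (side false y) f with p , q ← IsFault⇒≡ false x y f =
          here (cong₂ (λ v w → enc v , enc w) p q)
      IsFaultV⇒∈ (side true x) (side true y) f with p , q ← IsFault⇒≡ true x y f =
          there (here (cong₂ (λ v w → enc v , enc w) p q))

      ∈⇒IsFaultV : ∀ x y → (enc x , enc y) ∈ faults → IsFaultV hS hT x y
      ∈⇒IsFaultV x y (here e) = subst₂ (IsFaultV hS hT) (sym (enc-injective (cong proj₁ e)))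
          (sym (enc-injective (cong proj₂ e))) (faultEdge-IsFault false)
      ∈⇒IsFaultV x y (there (here e)) = subst₂ (IsFaultV hS hT) (sym (enc-injective (cong proj₁ e)))
          (sym (enc-injective (cong proj₂ e))) (faultEdge-IsFault true)

      IsFault⇒Link : ∀ h x y → IsFault h x y → Link x y
      IsFault⇒Link h (pad i τ) (pad i' τ') (e₁ , e₂ , e₃ , e₄) =
        inj₂ (trans e₃ (cong suc (sym e₁)) , trans e₂ (cong (4 ℕ.*_) (sym e₁)) , trans e₄ (cong (4 ℕ.*_) (sym e₃)))

      faults-adjacent : All (λ e → adj network (proj₁ e) (proj₂ e) ≡ true) faults
      faults-adjacent = edge false All.∷ edge true All.∷ All.[]
        where
        edge : ∀ s → adj network (proj₁ (faultEdge s)) (proj₂ (faultEdge s)) ≡ true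
        edge s = Adjacent⇒adj (padAt s i (4 ℕ.* i)) (padAt s (suc i) (4 ℕ.* suc i)) (inj₁ (refl ,
          IsFault⇒Link (hubOf s) (pad (pin 0<2σ i) (pin 0<8σ (4 ℕ.* i)))
              (pad (pin 0<2σ (suc i)) (pin 0<8σ (4 ℕ.* suc i))) (faultEdge-IsFault s)))
          where
          i : ℕ
          i = index (hubOf s)

      -- A surviving edge has to avoid the faults in both orientations, and `IsFault` knows only the
      -- outward one.
      link-forward : ∀ h x y → Link x y → ¬ IsFault h y x
      link-forward h (pad i τ) (pad i' τ') (inj₁ (refl , _)) (e₁ , _ , e₃ , _) = ℕ.1+n≢n (trans (sym e₃) e₁)
      link-forward h (pad i τ) (pad i' τ') (inj₂ (e , _)) (e₁ , _ , e₃ , _) =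
        ℕ.<-irrefl (trans (sym e₁) (trans e (cong suc e₃))) (ℕ.m<n⇒m<1+n (ℕ.n<1+n _))

      fault-forward : ∀ x y → Edge x y → ¬ IsFaultV hS hT y x
      fault-forward (side false x) (side false y) (_ , l) f = link-forward hS x y l f
      fault-forward (side true x) (side true y) (_ , l) f = link-forward hT x y l f

      IsFaultV⇒IsFault : ∀ s x y → IsFaultV hS hT (side s x) (side s y) → IsFault (hubOf s) x y
      IsFaultV⇒IsFault false x y f = f
      IsFaultV⇒IsFault true x y f = f

      Surviving : Fin size → Fin size → Set
      Surviving = AdjMinus network faults

      surviving-sym : ∀ {u v} → Surviving u v → Surviving v u
      surviving-sym {u} {v} (e , p , q) = trans (Graph.sym network v u) e , q , p

      survives : ∀ x y → Edge x y → ¬ IsFaultV hS hT x y → Surviving (enc x) (enc y)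
      survives x y e nf = Adjacent⇒adj x y (inj₁ e) , (λ m → nf (∈⇒IsFaultV x y m)) ,
          (λ m → fault-forward x y e (∈⇒IsFaultV y x m))

  pos-∸ : ∀ {m n} → n ℕ.≤ m → + (m ℕ.∸ n) ≡ + m - + n
  pos-∸ {m} {n} n≤m = trans (sym (⊖-≥ n≤m)) (sym (m-n≡m⊖n m n))

  -- Paths from a terminal to the arm tips of its selected hub.

  module Detours (r z : ℕ) (1≤r : 1 ℕ.≤ r) (junks : ℕ) (5≤z : 5 ℕ.≤ z) where
    open Sizes r z
    open Network r z 1≤r junks
    open Encoding r z 1≤r junks
    open Faults r z 1≤r junks 5≤z

    0<T : 0 ℕ.< T
    0<T = ℕ.≤-<-trans z≤n K<T

    armAt : Bool → Hub → Fin B → ℕ → Vertex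
    armAt s h c τ = side s (arm h c (pin 0<T τ))

    index<σ : ∀ h → index h ℕ.< σ
    index<σ h = Fin.toℕ<n (hubIndex h)

    sideLength : Hub → ℕ
    sideLength h = index h ℕ.+ (4 ℕ.* σ ℕ.∸ 4 ℕ.* index h) ℕ.+ 1 ℕ.+ (z ℕ.+ 2)

    -- The right side is the factor of N in `cap`: the path rises by N at every edge.
    +sideLength : ∀ h → + sideLength h ≡ + (4 ℕ.* σ) - + 3 * + index h + (Z + + 3)
    +sideLength h = trans
      (cong (λ x → + index h + x + + 1 + (Z + + 2))
        (trans (pos-∸ (ℕ.*-monoʳ-≤ 4 (ℕ.<⇒≤ (index<σ h)))) (cong (λ x → + (4 ℕ.* σ) - x) (pos-* 4 (index h)))))
      (eq (+ index h) (+ (4 ℕ.* σ)) Z)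
      where
      eq : ∀ i s z → i + (s - + 4 * i) + + 1 + (z + + 2) ≡ s - + 3 * i + (z + + 3)
      eq = solve-∀

    module _ (hS hT : Hub) where

      side-walk : ∀ s c → Walk (Surviving hS hT) (enc (padAt s 0 0)) (enc (armAt s (hubOf hS hT s) c (z ℕ.+ 2)))
          (sideLength (hubOf hS hT s))
      side-walk s c = ((spine ++ʷ rise) ++ʷ cons fan nil) ++ʷ reach
        where
        R′ = Surviving hS hT
        h = hubOf hS hT s
        i = index h
        no-fault : ∀ x y → ¬ IsFault h x y → ¬ IsFaultV hS hT (side s x) (side s y)
        no-fault x y nf f = nf (IsFaultV⇒IsFault hS hT s x y f)
        pin-i : ∀ {m} → m ℕ.≤ i → toℕ (pin 0<2σ m) ≡ m
        pin-i m≤i = toℕ-pin 0<2σ (i≤σ⇒i<2σ (ℕ.≤-trans m≤i (ℕ.<⇒≤ (index<σ h))))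
        pin-τ : ∀ {m} → m ℕ.≤ 4 ℕ.* σ → toℕ (pin 0<8σ m) ≡ m
        pin-τ m≤ = toℕ-pin 0<8σ (τ≤4σ⇒τ<8σ m≤)
        4i≤4σ : 4 ℕ.* i ℕ.≤ 4 ℕ.* σ
        4i≤4σ = ℕ.*-monoʳ-≤ 4 (ℕ.<⇒≤ (index<σ h))
        -- The path leaves the spine in column `i`, exactly where the cut edge would continue.
        spine : Walk R′ (enc (padAt s 0 0)) (enc (padAt s i (4 ℕ.* i))) i
        spine = walk-along (λ m → enc (padAt s m (4 ℕ.* m))) i λ m m<i →
          let m≤i = ℕ.<⇒≤ m<i
              pin-4 : ∀ {l} → l ℕ.≤ i → toℕ (pin 0<8σ (4 ℕ.* l)) ≡ 4 ℕ.* toℕ (pin 0<2σ l)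
              pin-4 l≤i = trans (pin-τ (ℕ.≤-trans (ℕ.*-monoʳ-≤ 4 l≤i) 4i≤4σ)) (cong (4 ℕ.*_) (sym (pin-i l≤i)))
          in survives hS hT (padAt s m (4 ℕ.* m)) (padAt s (suc m) (4 ℕ.* suc m))
               (refl , inj₂ (trans (pin-i m<i) (cong suc (sym (pin-i m≤i))) , pin-4 m≤i , pin-4 m<i))
               (no-fault _ _ λ (e , _) → ℕ.<-irrefl (trans (sym (pin-i m≤i)) e) m<i)
        rise : Walk R′ (enc (padAt s i (4 ℕ.* i))) (enc (padAt s i (4 ℕ.* σ))) (4 ℕ.* σ ℕ.∸ 4 ℕ.* i)
        rise = subst (λ k → Walk R′ (enc (padAt s i (4 ℕ.* i))) (enc (padAt s i k)) (4 ℕ.* σ ℕ.∸ 4 ℕ.* i))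
            (ℕ.m∸n+n≡m 4i≤4σ)
          (walk-along (λ m → enc (padAt s i (m ℕ.+ 4 ℕ.* i))) (4 ℕ.* σ ℕ.∸ 4 ℕ.* i) λ m m< →
            let le : suc m ℕ.+ 4 ℕ.* i ℕ.≤ 4 ℕ.* σ
                le = ℕ.≤-trans (ℕ.+-monoˡ-≤ (4 ℕ.* i) m<) (ℕ.≤-reflexive (ℕ.m∸n+n≡m 4i≤4σ))
            in survives hS hT (padAt s i (m ℕ.+ 4 ℕ.* i)) (padAt s i (suc m ℕ.+ 4 ℕ.* i))
                 (refl , inj₁ (refl , trans (pin-τ le) (cong suc (sym (pin-τ (ℕ.<⇒≤ le))))))
                 (no-fault _ _ λ (e , _ , e′ , _) → ℕ.1+n≢n (trans (sym e′) e)))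
        fan : R′ (enc (padAt s i (4 ℕ.* σ))) (enc (armAt s h c 0))
        fan = survives hS hT (padAt s i (4 ℕ.* σ)) (armAt s h c 0)
          (refl , pin-i ℕ.≤-refl , pin-τ ℕ.≤-refl , toℕ-pin 0<T 0<T) (no-fault (pad (pin 0<2σ i) (pin 0<8σ (4 ℕ.* σ)))
              (arm h c (pin 0<T 0)) λ ())
        reach : Walk R′ (enc (armAt s h c 0)) (enc (armAt s h c (z ℕ.+ 2))) (z ℕ.+ 2)
        reach = walk-along (λ m → enc (armAt s h c m)) (z ℕ.+ 2) λ m m<K →
          survives hS hT (armAt s h c m) (armAt s h c (suc m))
            (refl , refl , refl , trans (toℕ-pin 0<T (ℕ.≤-<-trans m<K K<T))
                (cong suc (sym (toℕ-pin 0<T (ℕ.<-trans m<K K<T)))))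
            (no-fault (arm h c (pin 0<T m)) (arm h c (pin 0<T (suc m))) λ ())

  ⟦pin⟧ : ∀ {n} (0<n : 0 ℕ.< n) {m} → m ℕ.< n → ⟦ pin 0<n m ⟧ ≡ + m
  ⟦pin⟧ 0<n m<n = cong +_ (toℕ-pin 0<n m<n)

  -- A line from hub to hub and the edge that it forces.

  module Lines (r z : ℕ) (1≤r : 1 ℕ.≤ r) (junks : ℕ) (5≤z : 5 ℕ.≤ z) where
    open Sizes r z
    open Network r z 1≤r junks
    open Encoding r z 1≤r junks
    open Faults r z 1≤r junks 5≤z
    open Detours r z 1≤r junks 5≤z

    block : ∀ α → α ℕ.< X → ∃ λ (c : Fin B) → ⟦ c ⟧ * R ≤ + α × + α ≤ ⟦ c ⟧ * R + R
    block α α<X = fromℕ< c<B , lower , upper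
      where
      instance
        r≢0 : ℕ.NonZero r
        r≢0 = ℕ.>-nonZero 1≤r
      X≡B*r : X ≡ B ℕ.* r
      X≡B*r = trans X≡ (trans (trans (cong (8 ℕ.*_) (ℕ.*-comm r z)) (sym (ℕ.*-assoc 8 z r))) (cong (ℕ._* r) (sym B≡)))
      c : ℕ
      c = α ℕ./ r
      c<B : c ℕ.< B
      c<B = ℕ.m<n*o⇒m/o<n (subst (α ℕ.<_) X≡B*r α<X)
      c*R : ⟦ fromℕ< c<B ⟧ * R ≡ + (c ℕ.* r)
      c*R = trans (cong (λ x → + x * R) (Fin.toℕ-fromℕ< c<B)) (sym (pos-* c r))
      lower : ⟦ fromℕ< c<B ⟧ * R ≤ + α
      lower = ≤-trans (≤-reflexive c*R) (+≤+ (ℕ.m/n*n≤m α r))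
      upper : + α ≤ ⟦ fromℕ< c<B ⟧ * R + R
      upper = ≤-trans (+≤+ (ℕ.≤-trans (ℕ.≤-reflexive (trans (ℕ.m≡m%n+[m/n]*n α r) (ℕ.+-comm (α ℕ.% r) (c ℕ.* r))))
        (ℕ.+-monoʳ-≤ (c ℕ.* r) (ℕ.<⇒≤ (ℕ.m%n<n α r))))) (≤-reflexive (cong (λ x → x + R) (sym c*R)))

    -- `ã`, `b̃` and `ỹ` are the reflected coordinates of the last point. Because a and b are
    -- exchanged, `ã` serves as second coordinate of the hub at t, which is why largeness is asked
    -- of `bₛ` and of `ã`.
    module Line (u₁ u₂ : Fin r) (aₛ bₛ yₛ g k mₑ ã b̃ ỹ : ℕ) (θ₁ θ₂ : Fin W)
        (g≡ : + g ≡ + 65 * (R * R) - ⟦ u₁ ⟧ * ⟦ u₁ ⟧ - ⟦ u₂ ⟧ * ⟦ u₂ ⟧) (mₑ<k : mₑ ℕ.< k)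
        (aₖ<X : aₛ ℕ.+ k ℕ.* toℕ u₁ ℕ.< X) (bₖ<X : bₛ ℕ.+ k ℕ.* toℕ u₂ ℕ.< X) (yₖ<Y : yₛ ℕ.+ k ℕ.* g ℕ.< Y)
        (ã<X : ã ℕ.< X) (b̃<X : b̃ ℕ.< X)
        (ã≡ : mirrorX (+ (aₛ ℕ.+ k ℕ.* toℕ u₁)) ≡ + ã) (b̃≡ : mirrorX (+ (bₛ ℕ.+ k ℕ.* toℕ u₂)) ≡ + b̃)
        (ỹ≡ : mirrorY (+ (yₛ ℕ.+ k ℕ.* g)) ≡ + ỹ)
        (start : + yₛ + + 2 * ⟦ u₁ ⟧ * + aₛ ≡ + 16 * (R * (R * Z)) + ⟦ θ₁ ⟧)
        (finish : + ỹ + + 2 * ⟦ u₂ ⟧ * + b̃ ≡ + 16 * (R * (R * Z)) + ⟦ θ₂ ⟧)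
        (bₛ-large : 0ℤ ≤ + bₛ - + 4 * (R * Z)) (ã-large : 0ℤ ≤ + ã - + 4 * (R * Z)) where

      bₛ<X : bₛ ℕ.< X
      bₛ<X = ℕ.≤-<-trans (ℕ.m≤m+n bₛ (k ℕ.* toℕ u₂)) bₖ<X

      aₛ<X : aₛ ℕ.< X
      aₛ<X = ℕ.≤-<-trans (ℕ.m≤m+n aₛ (k ℕ.* toℕ u₁)) aₖ<X

      β₁ β₂ : Fin X
      β₁ = pin 0<X bₛ
      β₂ = pin 0<X ã

      open Replacement u₁ u₂ β₁ θ₁ β₂ θ₂
        (subst (λ x → 0ℤ ≤ x - + 4 * (R * Z)) (sym (⟦pin⟧ 0<X bₛ<X)) bₛ-large)
        (subst (λ x → 0ℤ ≤ x - + 4 * (R * Z)) (sym (⟦pin⟧ 0<X ã<X)) ã-large)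

      yᵐ : ℕ → Fin Y
      yᵐ m = pin 0<Y (yₛ ℕ.+ m ℕ.* g)

      aᵐ bᵐ : ℕ → Fin X
      aᵐ m = pin 0<X (aₛ ℕ.+ m ℕ.* toℕ u₁)
      bᵐ m = pin 0<X (bₛ ℕ.+ m ℕ.* toℕ u₂)

      point : ℕ → Vertex
      point m = grid (yᵐ m) (aᵐ m) (bᵐ m)

      at : ∀ {n} (0<n : 0 ℕ.< n) s v {m} → s ℕ.+ k ℕ.* v ℕ.< n → m ℕ.≤ k →
          ⟦ pin 0<n (s ℕ.+ m ℕ.* v) ⟧ ≡ + s + + m * + v
      at 0<n s v {m} <n m≤k = trans (⟦pin⟧ 0<n (ℕ.≤-<-trans (ℕ.+-monoʳ-≤ s (ℕ.*-monoˡ-≤ v m≤k)) <n))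
          (cong (λ x → + s + x) (pos-* m v))

      a-at : ∀ {m} → m ℕ.≤ k → ⟦ aᵐ m ⟧ ≡ + aₛ + + m * ⟦ u₁ ⟧
      a-at = at 0<X aₛ (toℕ u₁) aₖ<X

      b-at : ∀ {m} → m ℕ.≤ k → ⟦ bᵐ m ⟧ ≡ + bₛ + + m * ⟦ u₂ ⟧
      b-at = at 0<X bₛ (toℕ u₂) bₖ<X

      y-at : ∀ {m} → m ℕ.≤ k → ⟦ yᵐ m ⟧ ≡ + yₛ + + m * (+ 65 * (R * R) - ⟦ u₁ ⟧ * ⟦ u₁ ⟧ - ⟦ u₂ ⟧ * ⟦ u₂ ⟧)
      y-at {m} m≤k = trans (at 0<Y yₛ g yₖ<Y m≤k) (cong (λ x → + yₛ + + m * x) g≡)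

      step : ∀ m → m ℕ.< k → Step (yᵐ m) (aᵐ m) (bᵐ m) (yᵐ (suc m)) (aᵐ (suc m)) (bᵐ (suc m)) u₁ u₂
      step m m<k = next (+ aₛ) ⟦ u₁ ⟧ (a-at m<k) (a-at (ℕ.<⇒≤ m<k)) , next (+ bₛ) ⟦ u₂ ⟧ (b-at m<k) (b-at (ℕ.<⇒≤ m<k))
          ,
        next (+ yₛ) (+ 65 * (R * R) - ⟦ u₁ ⟧ * ⟦ u₁ ⟧ - ⟦ u₂ ⟧ * ⟦ u₂ ⟧) (y-at m<k) (y-at (ℕ.<⇒≤ m<k))
        where
        eq : ∀ s m v → s + (+ 1 + m) * v ≡ s + m * v + v
        eq = solve-∀
        next : ∀ s v {p q} → q ≡ s + + suc m * v → p ≡ s + + m * v → q ≡ p + v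
        next s v e f = trans e (trans (eq s (+ m) v) (cong (λ x → x + v) (sym f)))

      online : ∀ m → m ℕ.≤ k → OnLine (+ aₛ) m (yᵐ m) (aᵐ m) (bᵐ m)
      online m m≤k = a-at m≤k , trans (b-at m≤k) (cong (λ x → x + + m * ⟦ u₂ ⟧) (sym (⟦pin⟧ 0<X bₛ<X))) ,
        (begin
          ⟦ yᵐ m ⟧ + + 2 * ⟦ u₁ ⟧ * ⟦ aᵐ m ⟧ ≡⟨ cong₂ (λ p q → p + + 2 * ⟦ u₁ ⟧ * q) (y-at m≤k) (a-at m≤k) ⟩
          + yₛ + + m * (+ 65 * (R * R) - ⟦ u₁ ⟧ * ⟦ u₁ ⟧ - ⟦ u₂ ⟧ * ⟦ u₂ ⟧) + + 2 * ⟦ u₁ ⟧ * (+ aₛ + + m * ⟦ u₁ ⟧)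
            ≡⟨ eq (+ yₛ) (+ aₛ) (+ m) (+ 65 * (R * R)) ⟦ u₁ ⟧ ⟦ u₂ ⟧ ⟩
          + yₛ + + 2 * ⟦ u₁ ⟧ * + aₛ + + m * (+ 65 * (R * R) + ⟦ u₁ ⟧ * ⟦ u₁ ⟧ - ⟦ u₂ ⟧ * ⟦ u₂ ⟧)
            ≡⟨ cong (λ x → x + + m * (+ 65 * (R * R) + ⟦ u₁ ⟧ * ⟦ u₁ ⟧ - ⟦ u₂ ⟧ * ⟦ u₂ ⟧)) start ⟩
          + 16 * (R * (R * Z)) + ⟦ θ₁ ⟧ + + m * (+ 65 * (R * R) + ⟦ u₁ ⟧ * ⟦ u₁ ⟧ - ⟦ u₂ ⟧ * ⟦ u₂ ⟧) ∎)
        where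
        open ≡-Reasoning
        eq : ∀ y a m g u v → y + m * (g - u * u - v * v) + + 2 * u * (a + m * u) ≡ y + + 2 * u * a + m *
            (g + u * u - v * v)
        eq = solve-∀

      τᴷ : Fin T
      τᴷ = pin 0<T (z ℕ.+ 2)

      cS cT : Fin B
      cS = proj₁ (block aₛ aₛ<X)
      cT = proj₁ (block b̃ b̃<X)

      a₀ : ⟦ aᵐ 0 ⟧ ≡ + aₛ
      a₀ = trans (a-at z≤n) (+-identityʳ (+ aₛ))

      dockS : DockAt false hS cS τᴷ ⟦ yᵐ 0 ⟧ ⟦ aᵐ 0 ⟧ ⟦ bᵐ 0 ⟧
      dockS = ⟦pin⟧ 0<T K<T , trans (proj₁ (proj₂ (online 0 z≤n))) (+-identityʳ ⟦ β₁ ⟧) , trans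
          (proj₂ (proj₂ (online 0 z≤n))) (+-identityʳ _) ,
        ≤-trans (proj₁ (proj₂ (block aₛ aₛ<X))) (≤-reflexive (sym a₀)) , ≤-trans (≤-reflexive a₀)
            (proj₂ (proj₂ (block aₛ aₛ<X)))

      aₖ′ : mirrorX ⟦ aᵐ k ⟧ ≡ + ã
      aₖ′ = trans (cong mirrorX (⟦pin⟧ 0<X aₖ<X)) ã≡

      bₖ′ : mirrorX ⟦ bᵐ k ⟧ ≡ + b̃
      bₖ′ = trans (cong mirrorX (⟦pin⟧ 0<X bₖ<X)) b̃≡

      yₖ′ : mirrorY ⟦ yᵐ k ⟧ ≡ + ỹ
      yₖ′ = trans (cong mirrorY (⟦pin⟧ 0<Y yₖ<Y)) ỹ≡

      dockT : DockAt true hT cT τᴷ ⟦ yᵐ k ⟧ ⟦ aᵐ k ⟧ ⟦ bᵐ k ⟧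
      dockT = ⟦pin⟧ 0<T K<T , trans aₖ′ (sym (⟦pin⟧ 0<X ã<X)) , trans (cong₂ (λ p q → p + + 2 * ⟦ u₂ ⟧ * q) yₖ′ bₖ′)
          finish ,
        ≤-trans (proj₁ (proj₂ (block b̃ b̃<X))) (≤-reflexive (sym bₖ′)) , ≤-trans (≤-reflexive bₖ′)
            (proj₂ (proj₂ (block b̃ b̃<X)))

      -- Both potentials are known at the last point of the line: it lies k tight steps beyond a
      -- point attached to `hS`, and it is attached to `hT` itself.
      total≡ : total ≡ PS.cap + PT.cap + + 2 * N + + k * N
      total≡ = begin
        total                               ≡⟨ eq total t ⟩
        total - t + t                       ≡⟨ cong₂ _+_ (bulk-sum ⟦ yᵐ k ⟧ ⟦ aᵐ k ⟧ ⟦ bᵐ k ⟧)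
            (PT.dock-tip cT τᴷ (mirrorX ⟦ bᵐ k ⟧) (mirrorX ⟦ aᵐ k ⟧) (mirrorY ⟦ yᵐ k ⟧) dockT) ⟩
        PS.bulk ⟦ aᵐ k ⟧ ⟦ bᵐ k ⟧ ⟦ yᵐ k ⟧ + (PT.cap + N)
          ≡⟨ cong (λ x → x + (PT.cap + N)) (line-bulk k (yᵐ k) (aᵐ k) (bᵐ k) (proj₁ (proj₂ (online k ℕ.≤-refl)))
              (proj₂ (proj₂ (online k ℕ.≤-refl)))) ⟩
        PS.cap + N + + k * N + (PT.cap + N) ≡⟨ eq′ PS.cap PT.cap N (+ k) ⟩
        PS.cap + PT.cap + + 2 * N + + k * N ∎
        where
        open ≡-Reasoning
        t : ℤ
        t = PT.bulk (mirrorX ⟦ bᵐ k ⟧) (mirrorX ⟦ aᵐ k ⟧) (mirrorY ⟦ yᵐ k ⟧)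
        eq : ∀ x t → x ≡ x - t + t
        eq = solve-∀
        eq′ : ∀ p q n k → p + n + k * n + (q + n) ≡ p + q + + 2 * n + k * n
        eq′ = solve-∀

      open Critical (+ aₛ) k mₑ mₑ<k (yᵐ mₑ) (aᵐ mₑ) (bᵐ mₑ) (yᵐ (suc mₑ)) (aᵐ (suc mₑ)) (bᵐ (suc mₑ))
        (online mₑ (ℕ.<⇒≤ mₑ<k)) (step mₑ mₑ<k)
        (trans (sym (a-at ℕ.≤-refl)) (trans (sym (mirrorX-involutive ⟦ aᵐ k ⟧))
            (cong mirrorX (trans aₖ′ (sym (⟦pin⟧ 0<X ã<X)))))) total≡

      potential : Fin size → ℤ
      potential v = Ψ (dec v)

      surviving-adjacent : ∀ {u v} → Surviving hS hT u v → Adjacent (dec u) (dec v)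
      surviving-adjacent {u} {v} (e , _) = adj⇒Adjacent u v e

      surviving-no-fault : ∀ {u v} → ¬ ((u , v) ∈ faults hS hT) → ¬ IsFaultV hS hT (dec u) (dec v)
      surviving-no-fault {u} {v} ∉ f = ∉ (subst₂ (λ p q → (p , q) ∈ faults hS hT) (enc∘dec u) (enc∘dec v)
          (IsFaultV⇒∈ hS hT (dec u) (dec v) f))

      potential-bounded : ∀ {u v} → Surviving hS hT u v → potential v ≤ potential u + N
      potential-bounded {u} {v} w@(_ , uv , vu) with surviving-adjacent w
      ... | inj₁ e = proj₁ (edge-near (dec u) (dec v) e (surviving-no-fault uv))
      ... | inj₂ e = proj₂ (edge-near (dec v) (dec u) e (surviving-no-fault vu))

      distance : ℕ
      distance = sideLength hS ℕ.+ (1 ℕ.+ (k ℕ.+ (1 ℕ.+ sideLength hT)))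

      replacement-path : Walk (Surviving hS hT) source sink distance
      replacement-path = side-walk hS hT false cS
        ++ʷ cons (survives hS hT (armAt false hS cS (z ℕ.+ 2)) (point 0) dockS λ ())
           (walk-along (λ m → enc (point m)) k (λ m m<k → survives hS hT (point m) (point (suc m))
               (u₁ , u₂ , step m m<k) λ ())
        ++ʷ cons (surviving-sym hS hT (survives hS hT (armAt true hT cT (z ℕ.+ 2)) (point k) dockT λ ()))
           (reverseʷ (surviving-sym hS hT) (side-walk hS hT true cT)))

      total-distance : total ≡ N * + distance
      total-distance = begin
        total                                    ≡⟨ total≡ ⟩
        PS.cap + PT.cap + + 2 * N + + k * N      ≡⟨ cong₂ (λ p q → p + q + + 2 * N + + k * N) (cap-length hS PS.cap≡)
            (cap-length hT PT.cap≡) ⟩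
        N * + sideLength hS + N * + sideLength hT + + 2 * N + + k * N ≡⟨ eq N (+ sideLength hS) (+ sideLength hT)
            (+ k) ⟩
        N * + distance ∎
        where
        open ≡-Reasoning
        cap-length : ∀ h {c} → c ≡ N * (+ (4 ℕ.* σ) - + 3 * + index h + (Z + + 3)) → c ≡ N * + sideLength h
        cap-length h e = trans e (cong (N *_) (sym (+sideLength h)))
        eq : ∀ n p q k → n * p + n * q + + 2 * n + k * n ≡ n * (p + (+ 1 + (k + (+ 1 + q))))
        eq = solve-∀

      0≤N : 0ℤ ≤ N
      0≤N = <⇒≤ 0<N

      potential-source : potential source ≡ 0ℤ
      potential-source = trans (cong Ψ (dec∘enc (padAt false 0 0)))
        (PS.level-root (pin 0<2σ 0) (pin 0<8σ 0) (toℕ-pin 0<2σ 0<2σ) (toℕ-pin 0<8σ 0<8σ))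

      potential-sink : potential sink ≡ total
      potential-sink = trans (cong Ψ (dec∘enc (padAt true 0 0)))
        (trans (cong (λ x → total - x) (PT.level-root (pin 0<2σ 0) (pin 0<8σ 0) (toℕ-pin 0<2σ 0<2σ)
            (toℕ-pin 0<8σ 0<8σ))) (+-identityʳ total))

      module _ (H : Graph size) (preserver : FT2Preserver network H source sink) where

        Target : Set
        Target = adj H (enc (point mₑ)) (enc (point (suc mₑ))) ≡ true

        in-network : ∀ {u v} → AdjMinus H (faults hS hT) u v → Surviving hS hT u v
        in-network {u} {v} (e , p) = proj₁ preserver u v e , p

        preserved-closed : ∀ {u v} → AdjMinus H (faults hS hT) u v → potential v ≡ potential u + N →
          Reached (dec u) → Reached (dec v) ⊎ Target
        preserved-closed {u} {v} w t c = Sum.map₂ used (closed (dec u) (dec v) (surviving-adjacent (in-network w)) t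
            c)
          where
          used : Used (dec u) (dec v) → Target
          used (p , q) = subst₂ (λ x y → adj H x y ≡ true) (trans (sym (enc∘dec u)) (cong enc p))
              (trans (sym (enc∘dec v)) (cong enc q)) (proj₁ w)

        short-walk-uses-edge : ∀ {l} → l ℕ.≤ distance → Walk (AdjMinus H (faults hS hT)) source sink l → Target
        short-walk-uses-edge {l} l≤d walk = Sum.[ (λ c → ⊥-elim (subst Reached (dec∘enc (padAt true 0 0)) c)) , id ]′
          (tight-walk potential N (λ w → potential-bounded (in-network w)) (λ v → Reached (dec v)) Target
            preserved-closed walk short (subst Reached (sym (dec∘enc (padAt false 0 0))) tt))
          where
          short : potential source + N * + l ≤ potential sink
          short = subst₂ _≤_ (sym (trans (cong (λ x → x + N * + l) potential-source) (+-identityˡ (N * + l))))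
            (sym (trans potential-sink total-distance)) (*-monoˡ-≤-nonNeg N {{nonNegative 0≤N}} (+≤+ l≤d))

        -- The preserver has to contain a walk no longer than `replacement-path`. The potential
        -- makes each of its steps tight, and as t is not in `Reached`, the walk must take the
        -- critical edge.
        line-edge-preserved : Target
        line-edge-preserved = short-walk-uses-edge (proj₁ (proj₂ shortcut)) (proj₂ (proj₂ shortcut))
          where
          shortcut : DistLe H (faults hS hT) source sink distance
          shortcut = Equivalence.from (proj₂ preserver (faults hS hT) (s≤s (s≤s z≤n)) (faults-adjacent hS hT)
              distance)
            (distance , ℕ.≤-refl , replacement-path)

  -- Following a line backwards from the middle of the box to a hub.

  run-short : ∀ R Z u o a m θ y → 0ℤ ≤ R → 0ℤ ≤ Z → 0ℤ ≤ u → 0ℤ ≤ R - u → 0ℤ ≤ o → 0ℤ ≤ R - o → 0ℤ ≤ a → 0ℤ ≤ m →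
      0ℤ ≤ θ →
    0ℤ ≤ + 3 * (R * Z) - a → 0ℤ ≤ + 64 * (R * (R * Z)) - y →
    y ≡ + 16 * (R * (R * Z)) + (θ + m * (+ 65 * (R * R) + u * u - o * o)) - + 2 * u * a →
    + 64 * R * (m * R) ≤ + 64 * R * (R * Z)
  run-short R Z u o a m θ _ R0 Z0 u0 Ru o0 Ro a0 m0 θ0 a3 y64 refl =
    ≤-slack (m0 ⊗ (Ro ⊗ (R0 ⊕ o0) ⊕ 0≤sq u) ⊕ θ0 ⊕ y64 ⊕ 0≤+ {2} ⊗ R0 ⊗ a3 ⊕ 0≤+ {10} ⊗ (R0 ⊗ (R0 ⊗ Z0)) ⊕ 0≤+
        {2} ⊗ Ru ⊗ a0)
      (solve (R ∷ Z ∷ u ∷ o ∷ a ∷ m ∷ θ ∷ []))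

  module Extension (r z : ℕ) (1≤r : 1 ℕ.≤ r) (5≤z : 5 ℕ.≤ z) where
    open Sizes r z

    q : ℕ
    q = r ℕ.* z

    +q : + q ≡ R * Z
    +q = pos-* r z

    +rq : + (r ℕ.* q) ≡ R * (R * Z)
    +rq = trans (pos-* r q) (cong (R *_) +q)

    sq≤ : (u : Fin r) → toℕ u ℕ.* toℕ u ℕ.≤ r ℕ.* r
    sq≤ u = ℕ.*-mono-≤ (ℕ.<⇒≤ (Fin.toℕ<n u)) (ℕ.<⇒≤ (Fin.toℕ<n u))

    -- The line through (a , b , y) in direction (u , o), followed backwards for m steps to a hub.
    record Extended (u o : Fin r) (g a b y : ℕ) : Set where
      field
        m aₛ bₛ yₛ : ℕ
        θ : Fin W
        0<m : 0 ℕ.< m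
        a≡ : aₛ ℕ.+ m ℕ.* toℕ u ≡ a
        b≡ : bₛ ℕ.+ m ℕ.* toℕ o ≡ b
        y≡ : yₛ ℕ.+ m ℕ.* g ≡ y
        start : + yₛ + + 2 * ⟦ u ⟧ * + aₛ ≡ + 16 * (R * (R * Z)) + ⟦ θ ⟧
        bₛ-large : 0ℤ ≤ + bₛ - + 4 * (R * Z)

    module _ (u o : Fin r) (g a b y : ℕ)
        (g≡ : + g ≡ + 65 * (R * R) - ⟦ u ⟧ * ⟦ u ⟧ - ⟦ o ⟧ * ⟦ o ⟧)
        (q≤a : q ℕ.≤ a) (a≤3q : a ℕ.≤ 3 ℕ.* q) (5q≤b : 5 ℕ.* q ℕ.≤ b)
        (32rq≤y : 32 ℕ.* (r ℕ.* q) ℕ.≤ y) (y≤64rq : y ℕ.≤ 64 ℕ.* (r ℕ.* q)) where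

      -- `δ` is the growth of y + 2ua per step, and `D` its height above the lower end of the
      -- window. The quotient is the number of steps back, and the remainder is the position in the
      -- window, below `W` because δ ≤ W.
      δ D : ℕ
      δ = 65 ℕ.* (r ℕ.* r) ℕ.+ toℕ u ℕ.* toℕ u ℕ.∸ toℕ o ℕ.* toℕ o
      D = y ℕ.+ 2 ℕ.* toℕ u ℕ.* a ℕ.∸ 16 ℕ.* (r ℕ.* q)

      +δ : + δ ≡ + 65 * (R * R) + ⟦ u ⟧ * ⟦ u ⟧ - ⟦ o ⟧ * ⟦ o ⟧
      +δ = trans (pos-∸ (ℕ.≤-trans (sq≤ o) (ℕ.≤-trans (ℕ.m≤n*m (r ℕ.* r) 65) (ℕ.m≤m+n _ _))))
        (cong₂ _-_ (cong₂ _+_ (trans (pos-* 65 (r ℕ.* r)) (cong (+ 65 *_) (pos-* r r))) (pos-* (toℕ u) (toℕ u)))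
            (pos-* (toℕ o) (toℕ o)))

      16rq≤ψ : 16 ℕ.* (r ℕ.* q) ℕ.≤ y ℕ.+ 2 ℕ.* toℕ u ℕ.* a
      16rq≤ψ = ℕ.≤-trans (ℕ.*-monoˡ-≤ (r ℕ.* q) {16} {32} (ℕ.≤ᵇ⇒≤ 16 32 _)) (ℕ.≤-trans 32rq≤y (ℕ.m≤m+n y _))

      +D : + D ≡ + y + + 2 * ⟦ u ⟧ * + a - + 16 * (R * (R * Z))
      +D = trans (pos-∸ 16rq≤ψ) (cong₂ (λ p q′ → + y + p - q′)
        (trans (pos-* (2 ℕ.* toℕ u) a) (cong (_* + a) (pos-* 2 (toℕ u))))
        (trans (pos-* 16 (r ℕ.* q)) (cong (+ 16 *_) +rq)))

      64rr≤δ : + 64 * (R * R) ≤ + δ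
      64rr≤δ = ≤-slack (⟦ o ⟧≤ ⊗ (0≤+ {r} ⊕ 0≤⟦ o ⟧) ⊕ 0≤sq ⟦ u ⟧) (trans +δ (eq R ⟦ u ⟧ ⟦ o ⟧))
        where
        eq : ∀ r u o → + 65 * (r * r) + u * u - o * o ≡ + 64 * (r * r) + ((r - o) * (r + o) + u * u)
        eq = solve-∀

      δ≤W : δ ℕ.≤ W
      δ≤W = drop‿+≤+ (≤-slack (⟦ u ⟧≤ ⊗ (0≤+ {r} ⊕ 0≤⟦ u ⟧) ⊕ 0≤sq ⟦ o ⟧)
        (trans +W (trans (eq R ⟦ u ⟧ ⟦ o ⟧) (cong (_+ ((R - ⟦ u ⟧) * (R + ⟦ u ⟧) + ⟦ o ⟧ * ⟦ o ⟧)) (sym +δ)))))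
        where
        eq : ∀ r u o → + 66 * (r * r) ≡ + 65 * (r * r) + u * u - o * o + ((r - u) * (r + u) + o * o)
        eq = solve-∀

      instance
        δ≢0 : ℕ.NonZero δ
        δ≢0 = ℕ.>-nonZero
            (drop‿+≤+ (≤-trans (≤-slack {+ 1} (0≤+ {63} ⊗ (0≤+ {r} ⊗ 0≤+ {r}) ⊕ i≤j⇒0≤j-i (+≤+ 1≤r) ⊗ (0≤+ {r} ⊕ 0≤+
            {1})) (eq R)) 64rr≤δ))
          where
          eq : ∀ r → + 64 * (r * r) ≡ + 1 + (+ 63 * (r * r) + (r - + 1) * (r + + 1))
          eq = solve-∀

      -- From y ≥ 32rq one gets D ≥ 16r²z, and z ≥ 5 turns this into 80r² ≥ 66r² ≥ δ. So at least
      -- one step fits; applied to the reflected point, this step is the critical edge.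
      δ≤D : δ ℕ.≤ D
      δ≤D = drop‿+≤+ (≤-slack
        (⟦ u ⟧≤ ⊗ (0≤+ {r} ⊕ 0≤⟦ u ⟧) ⊕ 0≤sq ⟦ o ⟧ ⊕ y32 ⊕ 0≤+ {2} ⊗ 0≤⟦ u ⟧ ⊗ 0≤+ {a}
          ⊕ 0≤+ {16} ⊗ (0≤+ {r} ⊗ 0≤+ {r}) ⊗ i≤j⇒0≤j-i (+≤+ 5≤z) ⊕ 0≤+ {14} ⊗ (0≤+ {r} ⊗ 0≤+ {r}))
        (trans +D (trans (eq R Z ⟦ u ⟧ ⟦ o ⟧ (+ a) (+ y))
            (cong (_+ ((R - ⟦ u ⟧) * (R + ⟦ u ⟧) + ⟦ o ⟧ * ⟦ o ⟧ + (+ y - + 32 * (R * (R * Z)))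
           + + 2 * ⟦ u ⟧ * + a + + 16 * (R * R) * (Z - + 5) + + 14 * (R * R))) (sym +δ)))))
        where
        y32 : 0ℤ ≤ + y - + 32 * (R * (R * Z))
        y32 = subst (λ x → 0ℤ ≤ + y - x) (trans (pos-* 32 (r ℕ.* q)) (cong (+ 32 *_) +rq)) (i≤j⇒0≤j-i (+≤+ 32rq≤y))
        eq : ∀ r z u o a y → y + + 2 * u * a - + 16 * (r * (r * z)) ≡ + 65 * (r * r) + u * u - o * o +
          ((r - u) * (r + u) + o * o + (y - + 32 * (r * (r * z))) + + 2 * u * a + + 16 * (r * r) * (z - + 5) + + 14 *
              (r * r))
        eq = solve-∀

      m t : ℕ
      m = D ℕ./ δ
      t = D ℕ.% δ

      y-division : + y ≡ + 16 * (R * (R * Z)) + (+ t + + m * (+ 65 * (R * R) + ⟦ u ⟧ * ⟦ u ⟧ - ⟦ o ⟧ * ⟦ o ⟧)) - + 2 *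
          ⟦ u ⟧ * + a
      y-division = trans (eq (+ y) (+ 16 * (R * (R * Z))) (+ 2 * ⟦ u ⟧ * + a))
        (cong (λ x → + 16 * (R * (R * Z)) + x - + 2 * ⟦ u ⟧ * + a)
          (trans (sym +D) (trans (cong +_ (ℕ.m≡m%n+[m/n]*n D δ))
              (cong (λ x → + t + x) (trans (pos-* m δ) (cong (+ m *_) +δ))))))
        where
        eq : ∀ y p s → y ≡ p + (y + s - p) - s
        eq = solve-∀

      -- Each step uses up at least 64r² of y + 2ua, whose height above the window is at most (64 +
      -- 6 - 16)rq. Hence a and b move by at most q and stay in the box.
      mr≤q : m ℕ.* r ℕ.≤ q
      mr≤q = drop‿+≤+ (subst₂ _≤_ (sym (pos-* m r)) (sym +q) (*-cancelˡ-≤-pos (+ m * R) (R * Z) (+ 64 * R) {{64R>0}}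
        (run-short R Z ⟦ u ⟧ ⟦ o ⟧ (+ a) (+ m) (+ t) (+ y) (0≤+ {r}) (0≤+ {z}) 0≤⟦ u ⟧ ⟦ u ⟧≤ 0≤⟦ o ⟧ ⟦ o ⟧≤ (0≤+ {a})
            (0≤+ {m}) (0≤+ {t})
          (subst (λ x → 0ℤ ≤ x - + a) (trans (pos-* 3 q) (cong (+ 3 *_) +q)) (i≤j⇒0≤j-i (+≤+ a≤3q)))
          (subst (λ x → 0ℤ ≤ x - + y) (trans (pos-* 64 (r ℕ.* q)) (cong (+ 64 *_) +rq)) (i≤j⇒0≤j-i (+≤+ y≤64rq)))
          y-division)))
        where
        64R>0 : Positive (+ 64 * R)
        64R>0 = subst Positive (pos-* 64 r) (positive (+<+ (ℕ.*-mono-< {0} {64} (s≤s z≤n) 1≤r)))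

      run≤q : ∀ (v : Fin r) → m ℕ.* toℕ v ℕ.≤ q
      run≤q v = ℕ.≤-trans (ℕ.*-monoʳ-≤ m (ℕ.<⇒≤ (Fin.toℕ<n v))) mr≤q

      aₛ bₛ yₛ : ℕ
      aₛ = a ℕ.∸ m ℕ.* toℕ u
      bₛ = b ℕ.∸ m ℕ.* toℕ o
      yₛ = 16 ℕ.* (r ℕ.* q) ℕ.+ t ℕ.∸ 2 ℕ.* toℕ u ℕ.* aₛ

      +yₛ : + yₛ ≡ + 16 * (R * (R * Z)) + + t - + 2 * ⟦ u ⟧ * + aₛ
      +yₛ = trans (pos-∸ small) (cong₂ (λ p s → p + + t - s) (trans (pos-* 16 (r ℕ.* q)) (cong (+ 16 *_) +rq))
        (trans (pos-* (2 ℕ.* toℕ u) aₛ) (cong (_* + aₛ) (pos-* 2 (toℕ u)))))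
        where
        eq : ∀ r q → 2 ℕ.* r ℕ.* (3 ℕ.* q) ℕ.+ 10 ℕ.* (r ℕ.* q) ≡ 16 ℕ.* (r ℕ.* q)
        eq = ℕ-Solver.solve-∀
        -- The base 16rq of the window exceeds 2u · aₛ ≤ 6rq, so the subtraction in `yₛ` is not
        -- truncated.
        small : 2 ℕ.* toℕ u ℕ.* aₛ ℕ.≤ 16 ℕ.* (r ℕ.* q) ℕ.+ t
        small = ℕ.≤-trans (ℕ.*-mono-≤ (ℕ.*-monoʳ-≤ 2 (ℕ.<⇒≤ (Fin.toℕ<n u))) (ℕ.≤-trans (ℕ.m∸n≤m a (m ℕ.* toℕ u))
            a≤3q))
          (ℕ.≤-trans (ℕ.m≤m+n _ (10 ℕ.* (r ℕ.* q))) (ℕ.≤-trans (ℕ.≤-reflexive (eq r q)) (ℕ.m≤m+n _ t)))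

      a-eq : aₛ ℕ.+ m ℕ.* toℕ u ≡ a
      a-eq = ℕ.m∸n+n≡m (ℕ.≤-trans (run≤q u) q≤a)

      q≤b : q ℕ.≤ b
      q≤b = ℕ.≤-trans (ℕ.m≤n*m q 5) 5q≤b

      b-eq : bₛ ℕ.+ m ℕ.* toℕ o ≡ b
      b-eq = ℕ.m∸n+n≡m (ℕ.≤-trans (run≤q o) q≤b)

      y-eq : yₛ ℕ.+ m ℕ.* g ≡ y
      y-eq = +-injective (begin
        + yₛ + + (m ℕ.* g) ≡⟨ cong₂ _+_ +yₛ (trans (pos-* m g) (cong (+ m *_) g≡)) ⟩
        + 16 * (R * (R * Z)) + + t - + 2 * ⟦ u ⟧ * + aₛ + + m * (+ 65 * (R * R) - ⟦ u ⟧ * ⟦ u ⟧ - ⟦ o ⟧ * ⟦ o ⟧)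
          ≡⟨ eq (+ 16 * (R * (R * Z))) (+ t) ⟦ u ⟧ ⟦ o ⟧ (+ aₛ) (+ m) (+ 65 * (R * R)) ⟩
        + 16 * (R * (R * Z)) + (+ t + + m * (+ 65 * (R * R) + ⟦ u ⟧ * ⟦ u ⟧ - ⟦ o ⟧ * ⟦ o ⟧)) - + 2 * ⟦ u ⟧ * (+
            aₛ + + m * ⟦ u ⟧)
          ≡⟨ cong (λ x → + 16 * (R * (R * Z)) + (+ t + + m * (+ 65 * (R * R) + ⟦ u ⟧ * ⟦ u ⟧ - ⟦ o ⟧ * ⟦ o ⟧)) - + 2 *
              ⟦ u ⟧ * x)
               (trans (cong (λ x → + aₛ + x) (sym (pos-* m (toℕ u)))) (cong +_ a-eq)) ⟩
        + 16 * (R * (R * Z)) + (+ t + + m * (+ 65 * (R * R) + ⟦ u ⟧ * ⟦ u ⟧ - ⟦ o ⟧ * ⟦ o ⟧)) - + 2 * ⟦ u ⟧ * + a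
            ≡⟨ sym y-division ⟩
        + y ∎)
        where
        open ≡-Reasoning
        eq : ∀ p t u o a m g → p + t - + 2 * u * a + m * (g - u * u - o * o) ≡ p + (t + m * (g + u * u - o * o)) - + 2
            * u * (a + m * u)
        eq = solve-∀

      t<W : t ℕ.< W
      t<W = ℕ.<-≤-trans (ℕ.m%n<n D δ) δ≤W

      -- Starting at b ≥ 5q and losing at most q, the line ends at a hub in the upper half, as
      -- `Potential` demands.
      4q≤bₛ : 4 ℕ.* q ℕ.≤ bₛ
      4q≤bₛ = ℕ.≤-trans (ℕ.≤-reflexive (sym (ℕ.m+n∸m≡n q (4 ℕ.* q)))) (ℕ.∸-mono 5q≤b (run≤q o))

      opaque
        extend : Extended u o g a b y
        extend = record
          { m = m ; aₛ = aₛ ; bₛ = bₛ ; yₛ = yₛ ; θ = fromℕ< t<W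
          ; 0<m = ℕ.m≥n⇒m/n>0 δ≤D
          ; a≡ = a-eq ; b≡ = b-eq ; y≡ = y-eq
          ; start = trans (cong (λ x → x + + 2 * ⟦ u ⟧ * + aₛ) +yₛ)
              (trans (eq (+ 16 * (R * (R * Z)) + + t) (+ 2 * ⟦ u ⟧ * + aₛ))
              (cong (λ x → + 16 * (R * (R * Z)) + + x) (sym (Fin.toℕ-fromℕ< t<W))))
          ; bₛ-large = subst (λ x → 0ℤ ≤ + bₛ - x) (trans (pos-* 4 q) (cong (+ 4 *_) +q)) (i≤j⇒0≤j-i (+≤+ 4q≤bₛ))
          }
          where
          eq : ∀ p s → p - s + s ≡ p
          eq = solve-∀

  -- Every step from the middle of the box is forced.

  complement-< : ∀ s t {n} → s ℕ.+ t ℕ.+ 1 ≡ n → s ℕ.< n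
  complement-< s t refl = ℕ.≤-trans (s≤s (ℕ.m≤m+n s t)) (ℕ.≤-reflexive (ℕ.+-comm 1 (s ℕ.+ t)))

  complement-<′ : ∀ s t {n} → s ℕ.+ t ℕ.+ 1 ≡ n → t ℕ.< n
  complement-<′ s t e = complement-< t s (trans (cong (ℕ._+ 1) (ℕ.+-comm t s)) e)

  module Core (r z : ℕ) (1≤r : 1 ℕ.≤ r) (junks : ℕ) (5≤z : 5 ℕ.≤ z) where
    open Sizes r z
    open Network r z 1≤r junks
    open Encoding r z 1≤r junks
    open Faults r z 1≤r junks 5≤z
    open Lines r z 1≤r junks 5≤z
    open Extension r z 1≤r 5≤z

    gridAt : ℕ → ℕ → ℕ → Vertex
    gridAt y a b = grid (pin 0<Y y) (pin 0<X a) (pin 0<X b)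

    mirrorX-complement : ∀ s t → s ℕ.+ t ℕ.+ 1 ≡ X → mirrorX (+ s) ≡ + t
    mirrorX-complement s t e = trans (mirrorX≡ (+ s)) (trans (cong (λ x → x - + 1 - + s) (sym (trans (cong +_ e) +X)))
        (eq (+ s) (+ t)))
      where
      eq : ∀ s t → s + t + + 1 - + 1 - s ≡ t
      eq = solve-∀

    mirrorY-complement : ∀ s t → s ℕ.+ t ℕ.+ 1 ≡ Y → mirrorY (+ s) ≡ + t
    mirrorY-complement s t e = trans (mirrorY≡ (+ s)) (trans (cong (λ x → x - + 1 - + s) (sym (trans (cong +_ e) +Y)))
        (eq (+ s) (+ t)))
      where
      eq : ∀ s t → s + t + + 1 - + 1 - s ≡ t
      eq = solve-∀

    advance : Fin r → Fin r → ℕ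
    advance u v = 65 ℕ.* (r ℕ.* r) ℕ.∸ toℕ u ℕ.* toℕ u ℕ.∸ toℕ v ℕ.* toℕ v

    +advance : ∀ u v → + advance u v ≡ + 65 * (R * R) - ⟦ u ⟧ * ⟦ u ⟧ - ⟦ v ⟧ * ⟦ v ⟧
    +advance u v = trans (pos-∸ (ℕ.≤-trans (sq≤ v) rr≤))
        (cong₂ _-_ (trans (pos-∸ (ℕ.≤-trans (sq≤ u) (ℕ.m≤n*m (r ℕ.* r) 65)))
      (cong₂ _-_ (trans (pos-* 65 (r ℕ.* r)) (cong (+ 65 *_) (pos-* r r))) (pos-* (toℕ u) (toℕ u))))
          (pos-* (toℕ v) (toℕ v)))
      where
      rr≤ : r ℕ.* r ℕ.≤ 65 ℕ.* (r ℕ.* r) ℕ.∸ toℕ u ℕ.* toℕ u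
      rr≤ = ℕ.≤-trans (ℕ.m≤n*m (r ℕ.* r) 64) (ℕ.≤-trans (ℕ.≤-reflexive (sym (ℕ.m+n∸m≡n (r ℕ.* r) (64 ℕ.* (r ℕ.* r)))))
        (ℕ.∸-monoʳ-≤ (65 ℕ.* (r ℕ.* r)) (sq≤ u)))

    advance-positive : ∀ u v → 0 ℕ.< advance u v
    advance-positive u v = drop‿+≤+ (≤-trans (advance-pos u v) (≤-reflexive (sym (+advance u v))))

    -- The primed numbers describe the reflected point. The middle a < 3q, 5q ≤ b < 7q, 32rq ≤ y <
    -- 64rq with a ≥ q is mapped onto itself by the reflection with exchange of a and b, as 8q = (q
    -- + 5q) + 2q.
    module _ (H : Graph size) (preserver : FT2Preserver network H source sink) (u₁ u₂ : Fin r) (i j l i' j' l' : ℕ)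
        (i+i' : i ℕ.+ i' ℕ.+ 1 ≡ 2 ℕ.* q) (j+j' : j ℕ.+ j' ℕ.+ 1 ≡ 2 ℕ.* q) (l+l' : l ℕ.+ l' ℕ.+ 1 ≡ 32 ℕ.* (r ℕ.* q))
            where

      a b y : ℕ
      a = q ℕ.+ i
      b = 5 ℕ.* q ℕ.+ j
      y = 32 ℕ.* (r ℕ.* q) ℕ.+ l

      double : ∀ n {x} → x ℕ.< n ℕ.* q → q ℕ.+ x ℕ.≤ suc n ℕ.* q
      double n p = ℕ.+-monoʳ-≤ q (ℕ.<⇒≤ p)

      y-upper : ∀ {x} → x ℕ.< 32 ℕ.* (r ℕ.* q) → 32 ℕ.* (r ℕ.* q) ℕ.+ x ℕ.≤ 64 ℕ.* (r ℕ.* q)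
      y-upper p = ℕ.≤-trans (ℕ.+-monoʳ-≤ (32 ℕ.* (r ℕ.* q)) (ℕ.<⇒≤ p)) (ℕ.≤-reflexive (eq (r ℕ.* q)))
        where
        eq : ∀ n → 32 ℕ.* n ℕ.+ 32 ℕ.* n ≡ 64 ℕ.* n
        eq = ℕ-Solver.solve-∀

      back : Extended u₁ u₂ (advance u₁ u₂) a b y
      back = extend u₁ u₂ (advance u₁ u₂) a b y (+advance u₁ u₂) (ℕ.m≤m+n q i) (double 2 (complement-< i i' i+i'))
        (ℕ.m≤m+n (5 ℕ.* q) j) (ℕ.m≤m+n _ l) (y-upper (complement-< l l' l+l'))

      -- The forward half of the line is the backward extension of the reflected point, with the two
      -- coordinates of the direction exchanged.
      forth : Extended u₂ u₁ (advance u₁ u₂) (q ℕ.+ j') (5 ℕ.* q ℕ.+ i') (32 ℕ.* (r ℕ.* q) ℕ.+ l')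
      forth = extend u₂ u₁ (advance u₁ u₂) (q ℕ.+ j') (5 ℕ.* q ℕ.+ i') (32 ℕ.* (r ℕ.* q) ℕ.+ l')
        (trans (+advance u₁ u₂) (eq (+ 65 * (R * R)) (⟦ u₁ ⟧ * ⟦ u₁ ⟧) (⟦ u₂ ⟧ * ⟦ u₂ ⟧))) (ℕ.m≤m+n q j')
            (double 2 (complement-<′ j j' j+j'))
        (ℕ.m≤m+n (5 ℕ.* q) i') (ℕ.m≤m+n _ l') (y-upper (complement-<′ l l' l+l'))
        where
        eq : ∀ m u v → m - u - v ≡ m - v - u
        eq = solve-∀

      module B = Extended back
      module F = Extended forth

      k : ℕ
      k = B.m ℕ.+ F.m

      join : ∀ s t m m' v c c' n → s ℕ.+ m ℕ.* v ≡ c → t ℕ.+ m' ℕ.* v ≡ c' → c ℕ.+ c' ℕ.+ 1 ≡ n →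
          s ℕ.+ (m ℕ.+ m') ℕ.* v ℕ.+ t ℕ.+ 1 ≡ n
      join s t m m' v _ _ _ refl refl refl = eq s t m m' v
        where
        eq : ∀ s t m m' v → s ℕ.+ (m ℕ.+ m') ℕ.* v ℕ.+ t ℕ.+ 1 ≡ s ℕ.+ m ℕ.* v ℕ.+ (t ℕ.+ m' ℕ.* v) ℕ.+ 1
        eq = ℕ-Solver.solve-∀

      X-sum : ∀ x x' → x ℕ.+ x' ℕ.+ 1 ≡ 2 ℕ.* q → q ℕ.+ x ℕ.+ (5 ℕ.* q ℕ.+ x') ℕ.+ 1 ≡ X
      X-sum x x' e = trans (eq q x x') (trans (cong (λ n → 6 ℕ.* q ℕ.+ n) e) (trans (eq′ q) (sym X≡)))
        where
        eq : ∀ q x x' → q ℕ.+ x ℕ.+ (5 ℕ.* q ℕ.+ x') ℕ.+ 1 ≡ 6 ℕ.* q ℕ.+ (x ℕ.+ x' ℕ.+ 1)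
        eq = ℕ-Solver.solve-∀
        eq′ : ∀ q → 6 ℕ.* q ℕ.+ 2 ℕ.* q ≡ 8 ℕ.* q
        eq′ = ℕ-Solver.solve-∀

      a-sum : B.aₛ ℕ.+ k ℕ.* toℕ u₁ ℕ.+ F.bₛ ℕ.+ 1 ≡ X
      a-sum = join B.aₛ F.bₛ B.m F.m (toℕ u₁) a (5 ℕ.* q ℕ.+ i') X B.a≡ F.b≡ (X-sum i i' i+i')

      b-sum : B.bₛ ℕ.+ k ℕ.* toℕ u₂ ℕ.+ F.aₛ ℕ.+ 1 ≡ X
      b-sum = join B.bₛ F.aₛ B.m F.m (toℕ u₂) b (q ℕ.+ j') X B.b≡ F.a≡
          (trans (eq q j j') (X-sum j' j (trans (cong (ℕ._+ 1) (ℕ.+-comm j' j)) j+j')))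
        where
        eq : ∀ q j j' → 5 ℕ.* q ℕ.+ j ℕ.+ (q ℕ.+ j') ℕ.+ 1 ≡ q ℕ.+ j' ℕ.+ (5 ℕ.* q ℕ.+ j) ℕ.+ 1
        eq = ℕ-Solver.solve-∀

      y-sum : B.yₛ ℕ.+ k ℕ.* advance u₁ u₂ ℕ.+ F.yₛ ℕ.+ 1 ≡ Y
      y-sum = join B.yₛ F.yₛ B.m F.m (advance u₁ u₂) y (32 ℕ.* (r ℕ.* q) ℕ.+ l') Y B.y≡ F.y≡
        (trans (eq (32 ℕ.* (r ℕ.* q)) l l') (trans (cong (λ n → 32 ℕ.* (r ℕ.* q) ℕ.+ 32 ℕ.* (r ℕ.* q) ℕ.+ n) l+l')
            (trans (eq′ (r ℕ.* q)) (sym Y≡))))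
        where
        eq : ∀ m l l' → m ℕ.+ l ℕ.+ (m ℕ.+ l') ℕ.+ 1 ≡ m ℕ.+ m ℕ.+ (l ℕ.+ l' ℕ.+ 1)
        eq = ℕ-Solver.solve-∀
        eq′ : ∀ n → 32 ℕ.* n ℕ.+ 32 ℕ.* n ℕ.+ 32 ℕ.* n ≡ 96 ℕ.* n
        eq′ = ℕ-Solver.solve-∀

      -- The critical edge comes right after the `B.m` steps of the backward half; `F.0<m`
      -- guarantees that the line continues there.
      module L = Line u₁ u₂ B.aₛ B.bₛ B.yₛ (advance u₁ u₂) k B.m F.bₛ F.aₛ F.yₛ B.θ F.θ (+advance u₁ u₂)
        (ℕ.m<m+n B.m F.0<m) (complement-< (B.aₛ ℕ.+ k ℕ.* toℕ u₁) F.bₛ a-sum) (complement-< (B.bₛ ℕ.+ k ℕ.* toℕ u₂)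
            F.aₛ b-sum) (complement-< (B.yₛ ℕ.+ k ℕ.* advance u₁ u₂) F.yₛ y-sum)
        (complement-<′ (B.aₛ ℕ.+ k ℕ.* toℕ u₁) F.bₛ a-sum) (complement-<′ (B.bₛ ℕ.+ k ℕ.* toℕ u₂) F.aₛ b-sum)
        (mirrorX-complement (B.aₛ ℕ.+ k ℕ.* toℕ u₁) F.bₛ a-sum) (mirrorX-complement (B.bₛ ℕ.+ k ℕ.* toℕ u₂) F.aₛ
            b-sum) (mirrorY-complement (B.yₛ ℕ.+ k ℕ.* advance u₁ u₂) F.yₛ y-sum)
        B.start F.start B.bₛ-large F.bₛ-large

      gridAt-≡ : ∀ {y y' a a' b b'} → y ≡ y' → a ≡ a' → b ≡ b' → gridAt y a b ≡ gridAt y' a' b'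
      gridAt-≡ refl refl refl = refl

      following : ∀ s m v {c} → s ℕ.+ m ℕ.* v ≡ c → s ℕ.+ suc m ℕ.* v ≡ c ℕ.+ v
      following s m v refl = eq s m v
        where
        eq : ∀ s m v → s ℕ.+ suc m ℕ.* v ≡ s ℕ.+ m ℕ.* v ℕ.+ v
        eq = ℕ-Solver.solve-∀

      core-edge-preserved : adj H (enc (gridAt y a b))
          (enc (gridAt (y ℕ.+ advance u₁ u₂) (a ℕ.+ toℕ u₁) (b ℕ.+ toℕ u₂))) ≡ true
      core-edge-preserved = subst₂ (λ v w → adj H (enc v) (enc w) ≡ true)
        (gridAt-≡ B.y≡ B.a≡ B.b≡)
        (gridAt-≡ (following B.yₛ B.m (advance u₁ u₂) B.y≡) (following B.aₛ B.m (toℕ u₁) B.a≡)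
            (following B.bₛ B.m (toℕ u₂) B.b≡))
        (L.line-edge-preserved H preserver)

      within : ∀ s m v {n c} → s ℕ.+ k ℕ.* v ℕ.< n → suc m ℕ.≤ k → s ℕ.+ m ℕ.* v ≡ c → c ℕ.+ v ℕ.< n
      within s m v {n} p m<k e = subst (ℕ._< n) (following s m v e) (ℕ.≤-<-trans (ℕ.+-monoʳ-≤ s (ℕ.*-monoˡ-≤ v m<k))
          p)

      a-next : a ℕ.+ toℕ u₁ ℕ.< X
      a-next = within B.aₛ B.m (toℕ u₁) (complement-< (B.aₛ ℕ.+ k ℕ.* toℕ u₁) F.bₛ a-sum) (ℕ.m<m+n B.m F.0<m) B.a≡

      b-next : b ℕ.+ toℕ u₂ ℕ.< X
      b-next = within B.bₛ B.m (toℕ u₂) (complement-< (B.bₛ ℕ.+ k ℕ.* toℕ u₂) F.aₛ b-sum) (ℕ.m<m+n B.m F.0<m) B.b≡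

      y-next : y ℕ.+ advance u₁ u₂ ℕ.< Y
      y-next = within B.yₛ B.m (advance u₁ u₂) (complement-< (B.yₛ ℕ.+ k ℕ.* advance u₁ u₂) F.yₛ y-sum)
          (ℕ.m<m+n B.m F.0<m) B.y≡

open Construction using (module Sizes; module Network; module Encoding; module Faults; module Extension; module Core;
    pin; toℕ-pin)
import Data.Bool as Bool
open import Data.List.Membership.Propositional.Properties using (∈-∃++; ∈-++⁻; ∈-++⁺ˡ; ∈-++⁺ʳ; ∈-allFin; ∈-tabulate⁻)
open import Data.List.Properties using (map-++; length-tabulate)
open import Data.List.Relation.Unary.AllPairs using ([]; _∷_)
open import Data.List.Relation.Unary.Unique.Propositional using (Unique)
open import Data.List.Relation.Unary.Unique.Propositional.Properties using (tabulate⁺)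
open import Data.Nat using (ℕ; zero; suc; z≤n; s≤s; _+_; _*_; _∸_; _^_; _≤_; _<_; _<ᵇ_; _<?_; >-nonZero)
open import Data.Nat.ListAction using (sum)
open import Data.Nat.ListAction.Properties using (sum-++)
open import Data.Nat.Properties
open import Data.Nat.Tactic.RingSolver using (solve-∀)

-- Counting the forced edges.

sum-subset : ∀ {A : Set} (g : A → ℕ) c xs ys → Unique xs → (∀ {x} → x ∈ xs → x ∈ ys) → (∀ {x} → x ∈ xs → c ≤ g x) →
  length xs * c ≤ sum (map g ys)
sum-subset g c [] ys _ _ _ = z≤n
sum-subset {A} g c (x ∷ xs) ys (x∉xs ∷ u) sub low with ∈-∃++ (sub (here refl))
... | as , bs , refl = begin
  c + length xs * c                              ≤⟨ +-mono-≤ (low (here refl)) (sum-subset g c xs (as ++ bs) u sub′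
      (λ m → low (there m))) ⟩
  g x + sum (map g (as ++ bs))                   ≡⟨ cong (g x +_) (total as bs) ⟩
  g x + (sum (map g as) + sum (map g bs))        ≡⟨ eq (g x) (sum (map g as)) (sum (map g bs)) ⟩
  sum (map g as) + (g x + sum (map g bs))        ≡⟨ sym (total as (x ∷ bs)) ⟩
  sum (map g (as ++ x ∷ bs))                     ∎
  where
  open ≤-Reasoning
  eq : ∀ p q s → p + (q + s) ≡ q + (p + s)
  eq = solve-∀
  total : ∀ as bs → sum (map g (as ++ bs)) ≡ sum (map g as) + sum (map g bs)
  total as bs = trans (cong sum (map-++ g as bs)) (sum-++ (map g as) (map g bs))
  sub′ : ∀ {y} → y ∈ xs → y ∈ as ++ bs
  sub′ m with ∈-++⁻ as (sub (there m))
  ... | inj₁ m′ = ∈-++⁺ˡ m′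
  ... | inj₂ (here refl) = contradiction refl (All.lookup x∉xs m)
  ... | inj₂ (there m′) = ∈-++⁺ʳ as m′

sum-injection : ∀ {m n} (g : Fin n → ℕ) c (f : Fin m → Fin n) → (∀ {i j} → f i ≡ f j → i ≡ j) → (∀ i → c ≤ g (f i)) →
  m * c ≤ sum (map g (allFin n))
sum-injection {m} {n} g c f inj low = subst (λ k → k * c ≤ sum (map g (allFin n))) (length-tabulate f)
  (sum-subset g c (tabulate f) (allFin n) (tabulate⁺ inj) (λ {x} _ → ∈-allFin x)
    (λ x∈ → let i , e = ∈-tabulate⁻ x∈ in subst (λ y → c ≤ g y) (sym e) (low i)))

-- Distinct starts occupy distinct rows of the adjacency matrix, and each row contains k distinct
-- ends above the diagonal, where `edgeCount` looks.
edgeCount-bound : ∀ {m k n} (H : Graph n) (p : Fin m → Fin n) (e : Fin m → Fin k → Fin n) →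
  (∀ {i j} → p i ≡ p j → i ≡ j) → (∀ i {j l} → e i j ≡ e i l → j ≡ l) →
  (∀ i j → toℕ (p i) < toℕ (e i j)) → (∀ i j → adj H (p i) (e i j) ≡ true) → m * k ≤ edgeCount H
edgeCount-bound {m} {k} {n} H p e p-inj e-inj less edge =
  sum-injection row k p p-inj λ i → subst (_≤ row (p i)) (*-identityʳ k)
    (sum-injection (cell (p i)) 1 (e i) (e-inj i) λ j → present (<⇒<ᵇ (less i j)) (edge i j))
  where
  cell : Fin n → Fin n → ℕ
  cell u v = if (toℕ u <ᵇ toℕ v) ∧ adj H u v then 1 else 0
  row : Fin n → ℕ
  row u = sum (map (cell u) (allFin n))
  present : ∀ {b c} → Bool.T b → c ≡ true → 1 ≤ (if b ∧ c then 1 else 0)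
  present {true} _ refl = s≤s z≤n

complement : ∀ {i n} → i < n → i + (n ∸ suc i) + 1 ≡ n
complement {i} {n} i<n = trans (eq i (n ∸ suc i)) (m+[n∸m]≡n i<n)
  where
  eq : ∀ i j → i + j + 1 ≡ suc i + j
  eq = solve-∀

remQuot-injective : ∀ {m} n {i j : Fin (m * n)} → remQuot {m} n i ≡ remQuot n j → i ≡ j
remQuot-injective {m} n {i} {j} e = trans (sym (Fin.combine-remQuot {m} n i)) (trans (cong (uncurry combine) e)
    (Fin.combine-remQuot {m} n j))

module Count (r z : ℕ) (1≤r : 1 ≤ r) (junks : ℕ) (5≤z : 5 ≤ z) where
  open Sizes r z
  open Network r z 1≤r junks
  open Encoding r z 1≤r junks
  open Faults r z 1≤r junks 5≤z
  open Extension r z 1≤r 5≤z using (q)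
  open Core r z 1≤r junks 5≤z

  Cell : Set
  Cell = Fin (2 * q * (2 * q) * (32 * (r * q)))

  iᶜ jᶜ lᶜ : Cell → ℕ
  iᶜ c = toℕ (proj₁ (remQuot {2 * q} (2 * q) (proj₁ (remQuot {2 * q * (2 * q)} (32 * (r * q)) c))))
  jᶜ c = toℕ (proj₂ (remQuot {2 * q} (2 * q) (proj₁ (remQuot {2 * q * (2 * q)} (32 * (r * q)) c))))
  lᶜ c = toℕ (proj₂ (remQuot {2 * q * (2 * q)} (32 * (r * q)) c))

  i< : ∀ c → iᶜ c < 2 * q
  i< c = Fin.toℕ<n (proj₁ (remQuot {2 * q} (2 * q) (proj₁ (remQuot {2 * q * (2 * q)} (32 * (r * q)) c))))

  j< : ∀ c → jᶜ c < 2 * q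
  j< c = Fin.toℕ<n (proj₂ (remQuot {2 * q} (2 * q) (proj₁ (remQuot {2 * q * (2 * q)} (32 * (r * q)) c))))

  l< : ∀ c → lᶜ c < 32 * (r * q)
  l< c = Fin.toℕ<n (proj₂ (remQuot {2 * q * (2 * q)} (32 * (r * q)) c))

  cell-injective : ∀ {c d} → iᶜ c ≡ iᶜ d → jᶜ c ≡ jᶜ d → lᶜ c ≡ lᶜ d → c ≡ d
  cell-injective ei ej el = remQuot-injective {2 * q * (2 * q)} (32 * (r * q)) (cong₂ _,_
    (remQuot-injective {2 * q} (2 * q) (cong₂ _,_ (Fin.toℕ-injective ei) (Fin.toℕ-injective ej)))
        (Fin.toℕ-injective el))

  uᵈ vᵈ : Fin (r * r) → Fin r
  uᵈ d = proj₁ (remQuot {r} r d)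
  vᵈ d = proj₂ (remQuot {r} r d)

  aᶜ bᶜ yᶜ : Cell → ℕ
  aᶜ c = q + iᶜ c
  bᶜ c = 5 * q + jᶜ c
  yᶜ c = 32 * (r * q) + lᶜ c

  gridAt-injective : ∀ {y a b y' a' b'} → y < Y → a < X → b < X → y' < Y → a' < X → b' < X →
    enc (gridAt y a b) ≡ enc (gridAt y' a' b') → y ≡ y' × a ≡ a' × b ≡ b'
  gridAt-injective {y} {a} {b} {y'} {a'} {b'} y< a< b< y'< a'< b'< e = at 0<Y y< y'< (proj₁ parts) , at 0<X a< a'<
      (proj₁ (proj₂ parts)) , at 0<X b< b'< (proj₂ (proj₂ parts))
    where
    grid-injective : ∀ {y y' : Fin Y} {a a' b b' : Fin X} → grid y a b ≡ grid y' a' b' → y ≡ y' × a ≡ a' × b ≡ b'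
    grid-injective refl = refl , refl , refl
    parts = grid-injective (enc-injective e)
    at : ∀ {n} (0<n : 0 < n) {s t} → s < n → t < n → pin 0<n s ≡ pin 0<n t → s ≡ t
    at 0<n s< t< e = trans (sym (toℕ-pin 0<n s<)) (trans (cong toℕ e) (toℕ-pin 0<n t<))

  module _ (H : Graph size) (preserver : FT2Preserver network H source sink) where

    start-of : Cell → Fin size
    start-of c = enc (gridAt (yᶜ c) (aᶜ c) (bᶜ c))

    end-of : Cell → Fin (r * r) → Fin size
    end-of c d = enc (gridAt (yᶜ c + advance (uᵈ d) (vᵈ d)) (aᶜ c + toℕ (uᵈ d)) (bᶜ c + toℕ (vᵈ d)))

    a-bound : ∀ c d → aᶜ c + toℕ (uᵈ d) < X
    a-bound c d = a-next H preserver (uᵈ d) (vᵈ d) (iᶜ c) (jᶜ c) (lᶜ c) _ _ _ (complement (i< c)) (complement (j< c))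
        (complement (l< c))

    b-bound : ∀ c d → bᶜ c + toℕ (vᵈ d) < X
    b-bound c d = b-next H preserver (uᵈ d) (vᵈ d) (iᶜ c) (jᶜ c) (lᶜ c) _ _ _ (complement (i< c)) (complement (j< c))
        (complement (l< c))

    y-bound : ∀ c d → yᶜ c + advance (uᵈ d) (vᵈ d) < Y
    y-bound c d = y-next H preserver (uᵈ d) (vᵈ d) (iᶜ c) (jᶜ c) (lᶜ c) _ _ _ (complement (i< c)) (complement (j< c))
        (complement (l< c))

    -- Any one direction serves to deduce the range of a start from that of an end.
    d₀ : Fin (r * r)
    d₀ = fromℕ< (*-mono-< {0} {r} 1≤r 1≤r)

    a< : ∀ c → aᶜ c < X
    a< c = ≤-<-trans (m≤m+n (aᶜ c) (toℕ (uᵈ d₀))) (a-bound c d₀)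

    b< : ∀ c → bᶜ c < X
    b< c = ≤-<-trans (m≤m+n (bᶜ c) (toℕ (vᵈ d₀))) (b-bound c d₀)

    y< : ∀ c → yᶜ c < Y
    y< c = ≤-<-trans (m≤m+n (yᶜ c) (advance (uᵈ d₀) (vᵈ d₀))) (y-bound c d₀)

    start-injective : ∀ {c d} → start-of c ≡ start-of d → c ≡ d
    start-injective {c} {d} e = cell-injective (+-cancelˡ-≡ q (iᶜ c) (iᶜ d) (proj₁ (proj₂ parts)))
      (+-cancelˡ-≡ (5 * q) (jᶜ c) (jᶜ d) (proj₂ (proj₂ parts))) (+-cancelˡ-≡ (32 * (r * q)) (lᶜ c) (lᶜ d)
          (proj₁ parts))
      where
      parts : yᶜ c ≡ yᶜ d × aᶜ c ≡ aᶜ d × bᶜ c ≡ bᶜ d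
      parts = gridAt-injective (y< c) (a< c) (b< c) (y< d) (a< d) (b< d) e

    end-injective : ∀ c {d d'} → end-of c d ≡ end-of c d' → d ≡ d'
    end-injective c {d} {d'} e = remQuot-injective {r} r (cong₂ _,_
      (Fin.toℕ-injective (+-cancelˡ-≡ (aᶜ c) (toℕ (uᵈ d)) (toℕ (uᵈ d')) (proj₁ (proj₂ parts))))
      (Fin.toℕ-injective (+-cancelˡ-≡ (bᶜ c) (toℕ (vᵈ d)) (toℕ (vᵈ d')) (proj₂ (proj₂ parts)))))
      where
      parts = gridAt-injective (y-bound c d) (a-bound c d) (b-bound c d) (y-bound c d') (a-bound c d') (b-bound c d')
          e

    start<end : ∀ c d → toℕ (start-of c) < toℕ (end-of c d)
    start<end c d = enc-grid-< (subst₂ _<_ (sym (toℕ-pin 0<Y (y< c))) (sym (toℕ-pin 0<Y (y-bound c d)))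
      (m<m+n (yᶜ c) (advance-positive (uᵈ d) (vᵈ d))))

    many-edges : 2 * q * (2 * q) * (32 * (r * q)) * (r * r) ≤ edgeCount H
    many-edges = edgeCount-bound H start-of end-of start-injective end-injective start<end λ c d →
      core-edge-preserved H preserver (uᵈ d) (vᵈ d) (iᶜ c) (jᶜ c) (lᶜ c) _ _ _ (complement (i< c)) (complement (j< c))
          (complement (l< c))

-- Choosing r for a given n, and comparing powers.

bracket : ∀ (f : ℕ → ℕ) {n} k s → f s ≤ n → n < f (k + s) → ∃ λ t → s ≤ t × f t ≤ n × n < f (suc t)
bracket f zero s lo hi = contradiction hi (≤⇒≯ lo)
bracket f {n} (suc k) s lo hi with n <? f (suc s)
... | yes p = s , ≤-refl , lo , p
... | no ¬p with bracket f k (suc s) (≮⇒≥ ¬p) (subst (λ x → n < f x) (sym (+-suc k s)) hi)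
...   | t , s≤t , rest = t , <⇒≤ s≤t , rest

^-distribʳ-* : ∀ n x y → (x * y) ^ n ≡ x ^ n * y ^ n
^-distribʳ-* zero x y = refl
^-distribʳ-* (suc n) x y = trans (cong (x * y *_) (^-distribʳ-* n x y)) (eq x y (x ^ n) (y ^ n))
  where
  eq : ∀ x y p q → x * y * (p * q) ≡ x * p * (y * q)
  eq = solve-∀

fourth : ℕ → ℕ
fourth x = x * (x * (x * x))

fourth-mono : ∀ {x y} → x ≤ y → fourth x ≤ fourth y
fourth-mono p = *-mono-≤ p (*-mono-≤ p (*-mono-≤ p p))

fourth-* : ∀ x y → fourth (x * y) ≡ fourth x * fourth y
fourth-* = eq
  where
  eq : ∀ x y → x * y * (x * y * (x * y * (x * y))) ≡ x * (x * (x * x)) * (y * (y * (y * y)))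
  eq = solve-∀

m≤fourth : ∀ x → x ≤ fourth x
m≤fourth zero = z≤n
m≤fourth (suc x) = m≤m*n (suc x) (suc x * (suc x * suc x))

-- Opaque, since unfolding a product by one of these numerals would be unary.
opaque
  gridFactor sideFactor : ℕ
  gridFactor = 96 * (8 * 8)
  sideFactor = 2 * 8 * 66 * (8 * 8 * 66) + 8 * 66 * (8 * 4)

  gridFactor≡ : gridFactor ≡ 96 * (8 * 8)
  gridFactor≡ = refl

  sideFactor≡ : sideFactor ≡ 2 * 8 * 66 * (8 * 8 * 66) + 8 * 66 * (8 * 4)
  sideFactor≡ = refl

  0<gridFactor : 0 < gridFactor
  0<gridFactor = s≤s z≤n

factor : ℕ
factor = gridFactor + (sideFactor + sideFactor)

volume : ℕ → ℕ
volume r = factor * fourth (fourth r)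

m≤volume : ∀ r → r ≤ volume r
m≤volume r = ≤-trans (m≤fourth r) (≤-trans (m≤fourth (fourth r))
  (m≤n*m (fourth (fourth r)) factor
      {{>-nonZero (≤-trans 0<gridFactor (m≤m+n gridFactor (sideFactor + sideFactor)))}}))

opaque
  -- `growth` is the loss from rounding n down to a volume. Once r reaches `threshold`, a single
  -- factor r absorbs the eleventh power of that loss; the summand 2 ensures r⁴ ≥ 16 ≥ 5.
  growth threshold : ℕ
  growth = factor * fourth (fourth 2)
  threshold = 2 + growth ^ 11

  growth≡ : growth ≡ factor * fourth (fourth 2)
  growth≡ = refl

  2≤threshold : 2 ≤ threshold
  2≤threshold = m≤m+n 2 (growth ^ 11)

  growth≤threshold : growth ^ 11 ≤ threshold
  growth≤threshold = m≤n+m (growth ^ 11) 2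

-- Since r + 1 ≤ 2r, consecutive volumes differ by a bounded factor.
volume-suc : ∀ r → 1 ≤ r → volume (suc r) ≤ growth * fourth (fourth r)
volume-suc r 1≤r = ≤-trans (*-monoʳ-≤ factor (fourth-mono (fourth-mono suc≤double))) (≤-reflexive (begin
  factor * fourth (fourth (2 * r))                       ≡⟨ cong (λ x → factor * fourth x) (fourth-* 2 r) ⟩
  factor * fourth (fourth 2 * fourth r)                  ≡⟨ cong (factor *_) (fourth-* (fourth 2) (fourth r)) ⟩
  factor * (fourth (fourth 2) * fourth (fourth r))       ≡⟨ sym (*-assoc factor (fourth (fourth 2))
      (fourth (fourth r))) ⟩
  factor * fourth (fourth 2) * fourth (fourth r)         ≡⟨ cong (_* fourth (fourth r)) (sym growth≡) ⟩
  growth * fourth (fourth r)                             ∎))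
  where
  open ≡-Reasoning
  suc≤double : suc r ≤ 2 * r
  suc≤double = ≤-trans (+-monoˡ-≤ r 1≤r) (≤-reflexive (cong (r +_) (sym (+-identityʳ r))))

grid-volume : ∀ c d r → c * (r * (r * fourth r)) * (d * (r * fourth r) * (d * (r * fourth r))) ≡ c * (d * d) * fourth
    (fourth r)
grid-volume = eq
  where
  eq : ∀ c d r →
      c * (r * (r * (r * (r * (r * r))))) * (d * (r * (r * (r * (r * r)))) * (d * (r * (r * (r * (r * r))))))
      ≡ c * (d * d) * (r * (r * (r * r)) * (r * (r * (r * r)) * (r * (r * (r * r)) * (r * (r * (r * r))))))
  eq = solve-∀

side-volume : ∀ c d e f g h r →
  c * (r * (d * (r * fourth r)) * (e * (r * r))) * (f * (r * (d * (r * fourth r)) * (e * (r * r))))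
    + r * (d * (r * fourth r)) * (e * (r * r)) * (g * fourth r * (h * fourth r))
    ≡ (c * d * e * (f * d * e) + d * e * (g * h)) * fourth (fourth r)
side-volume = eq
  where
  eq : ∀ c d e f g h r →
      c * (r * (d * (r * (r * (r * (r * r))))) * (e * (r * r))) *
      (f * (r * (d * (r * (r * (r * (r * r))))) * (e * (r * r))))
      + r * (d * (r * (r * (r * (r * r))))) * (e * (r * r)) * (g * (r * (r * (r * r))) * (h * (r * (r * (r * r)))))
      ≡ (c * d * e * (f * d * e) + d * e * (g * h)) *
          (r * (r * (r * r)) * (r * (r * (r * r)) * (r * (r * (r * r)) * (r * (r * (r * r))))))
  eq = solve-∀

rescale : ∀ {x y} → x ≡ y → ∀ w → x * w ≡ y * w
rescale refl w = refl

volume-size : ∀ r junks (1≤r : 1 ≤ r) → Encoding.size r (fourth r) 1≤r junks ≡ volume r + junks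
volume-size r junks 1≤r = trans (cong₂ (λ g s → g + (s + s + junks)) grid-size side-size)
  (eq gridFactor sideFactor (fourth (fourth r)) junks)
  where
  open Sizes r (fourth r)
  eq : ∀ c d w j → c * w + (d * w + d * w + j) ≡ (c + (d + d)) * w + j
  eq = solve-∀
  grid-size : Y * (X * X) ≡ gridFactor * fourth (fourth r)
  grid-size = trans (cong₂ (λ y x → y * (x * x)) Y≡ X≡) (trans (grid-volume 96 8 r) (rescale (sym gridFactor≡)
      (fourth (fourth r))))
  side-size : 2 * σ * (8 * σ) + σ * (B * T) ≡ sideFactor * fourth (fourth r)
  side-size = trans (cong₂ (λ x w → 2 * (r * x * w) * (8 * (r * x * w)) + r * x * w * (B * T)) X≡ W≡)
    (trans (cong₂ (λ b t →
        2 * (r * (8 * (r * fourth r)) * (66 * (r * r))) * (8 * (r * (8 * (r * fourth r)) * (66 * (r * r))))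
        + r * (8 * (r * fourth r)) * (66 * (r * r)) * (b * t)) B≡ T≡)
    (trans (side-volume 2 8 66 8 8 4 r) (rescale (sym sideFactor≡) (fourth (fourth r)))))

edge-volume : ∀ c d r → 1 ≤ c * c * d → r * r * fourth (fourth r) ≤ c * (r * fourth r) * (c * (r * fourth r)) *
    (d * (r * (r * fourth r))) * (r * r)
edge-volume c d r 1≤ccd = ≤-trans (m≤n*m (r * r * fourth (fourth r)) (c * c * d) {{>-nonZero 1≤ccd}})
    (≤-reflexive (eq c d r))
  where
  eq : ∀ c d r →
      c * c * d * (r * r * (r * (r * (r * r)) * (r * (r * (r * r)) * (r * (r * (r * r)) * (r * (r * (r * r)))))))
     ≡ c * (r * (r * (r * (r * r)))) * (c * (r * (r * (r * (r * r))))) * (d * (r * (r * (r * (r * (r * r)))))) *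
         (r * r)
  eq = solve-∀

-- With w = r¹⁶, e¹⁰ is at least r²⁰w¹⁰ while n¹¹ is at most a constant times r¹⁶w¹⁰. One of the
-- four spare factors r pays for the constant.
power-gap : ∀ {r n e} → threshold ≤ r → n ≤ growth * fourth (fourth r) → r * r * fourth (fourth r) ≤ e →
    n ^ 11 ≤ e ^ 10
power-gap {r} {n} {e} big n≤ ≤e = begin
  n ^ 11                                 ≤⟨ ^-monoˡ-≤ 11 n≤ ⟩
  (growth * w) ^ 11                ≡⟨ ^-distribʳ-* 11 growth w ⟩
  growth ^ 11 * w ^ 11             ≤⟨ *-monoˡ-≤ (w ^ 11) (≤-trans growth≤threshold big) ⟩
  r * (w * w ^ 10)                       ≡⟨ sym (*-assoc r w (w ^ 10)) ⟩
  r * w * w ^ 10                         ≤⟨ *-monoˡ-≤ (w ^ 10) rw≤ ⟩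
  (r * r) ^ 10 * w ^ 10                  ≡⟨ sym (^-distribʳ-* 10 (r * r) w) ⟩
  (r * r * w) ^ 10                       ≤⟨ ^-monoˡ-≤ 10 ≤e ⟩
  e ^ 10                                 ∎
  where
  open ≤-Reasoning
  w : ℕ
  w = fourth (fourth r)
  1≤r : 1 ≤ r
  1≤r = ≤-trans (s≤s z≤n) (≤-trans 2≤threshold big)
  rw≤ : r * w ≤ (r * r) ^ 10
  rw≤ = ≤-trans (m≤m*n (r * w) (r * (r * r)) {{>-nonZero (*-mono-≤ 1≤r (*-mono-≤ 1≤r 1≤r))}}) (≤-reflexive (eq r))
    where
    eq : ∀ r → r * (r * (r * (r * r)) * (r * (r * (r * r)) * (r * (r * (r * r)) * (r * (r * (r * r)))))) *
        (r * (r * r))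
       ≡ r * r * (r * r * (r * r * (r * r * (r * r * (r * r * (r * r * (r * r * (r * r * (r * r * 1)))))))))
    eq = solve-∀

-- The largest network that fits is used, and the remaining vertices are isolated; the next volume
-- exceeds n, so only a constant factor is lost.
hard-instance : ∀ n → volume threshold ≤ n → Σ (Graph n) λ G → Σ (Fin n) λ s → Σ (Fin n) λ t →
  ∀ (H : Graph n) → FT2Preserver G H s t → n ^ 11 ≤ edgeCount H ^ 10
hard-instance n large with bracket volume (suc n) threshold large (≤-trans (s≤s (m≤m+n n threshold))
    (m≤volume (suc n + threshold)))
... | r , big , fits , tight = subst (λ m → Σ (Graph m) λ G → Σ (Fin m) λ s → Σ (Fin m) λ t →
        ∀ (H : Graph m) → FT2Preserver G H s t → n ^ 11 ≤ edgeCount H ^ 10)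
      (trans (volume-size r junks 1≤r) (m+[n∸m]≡n fits))
      (network , source , sink , λ H preserver →
        power-gap big (<⇒≤ (<-≤-trans tight (volume-suc r 1≤r))) (≤-trans (edge-volume 2 32 r (s≤s z≤n))
            (Count.many-edges r (fourth r) 1≤r junks 5≤z H preserver)))
  where
  junks : ℕ
  junks = n ∸ volume r
  2≤r : 2 ≤ r
  2≤r = ≤-trans 2≤threshold big
  1≤r : 1 ≤ r
  1≤r = ≤-trans (s≤s z≤n) 2≤r
  5≤z : 5 ≤ fourth r
  5≤z = ≤-trans (≤ᵇ⇒≤ 5 16 _) (fourth-mono 2≤r)
  open Encoding r (fourth r) 1≤r junks using (network)
  open Faults r (fourth r) 1≤r junks 5≤z using (source; sink)

theorem4 : ∀ (k : ℕ) → 1 ≤ k → ∃ λ (N : ℕ) → ∀ (n : ℕ) → N ≤ n →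
    Σ (Graph n) λ G → Σ (Fin n) λ s → Σ (Fin n) λ t →
    ∀ (H : Graph n) → FT2Preserver G H s t →
    n ^ (11 * k ∸ 10) ≤ edgeCount H ^ (10 * k)
theorem4 k _ = volume threshold , λ n large →
  let G , s , t , hard = hard-instance n large
      1≤n = ≤-trans (≤-trans (s≤s z≤n) 2≤threshold) (≤-trans (m≤volume threshold) large)
  -- The required exponent (11k - 10) / 10k is 11/10 - 1/k; the k-th power of n¹¹ ≤ e¹⁰ gives it
  -- with room to spare.
  in G , s , t , λ H preserver → ≤-trans (^-monoʳ-≤ n {{>-nonZero 1≤n}} (m∸n≤m (11 * k) 10))
       (≤-trans (≤-reflexive (sym (^-*-assoc n 11 k)))
         (≤-trans (^-monoˡ-≤ k (hard H preserver)) (≤-reflexive (^-*-assoc (edgeCount H) 10 k))))
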